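{- For every fixed integer $k>1$, \[ \mathrm{ex}_<\bigl(n,\ \mathcal{C}^B_4\cup\mathcal{C}^B_6\cup\dots\cup\mathcal{C}^B_{2k}\bigr)=\Theta\bigl(n^{1+1/k}\bigr)\qquad (n\to\infty), \] where $\mathcal{C}^B_{2j}$ denotes the set of bordered cycles of length $2j$, and the implied constants may depend on $k$.
   Context: An ordered graph is a finite simple graph together with a linear ordering of its vertex set. An ordered graph $G$ contains an ordered graph $H$ as an ordered subgraph if there is an injective, order-preserving map from the vertices of $H$ to the vertices of $G$ that maps edges of $H$ to edges of $G$ (the copy need not be induced). For a set $\mathcal{H}$ of ordered graphs, $\mathrm{ex}_<(n,\mathcal{H})$ is the maximum number of edges of an ordered graph on $n$ vertices that contains no $H\in\mathcal{H}$ as an ordered subgraph. The interval chromatic number of an ordered graph is the minimum number of intervals into which its linearly ordered vertex set can be partitioned so that no two vertices in the same interval are adjacent. In an ordered graph with interval chromatic number $2$ and intervals $U$ and $V$ ($U$ preceding $V$), an edge joining the first vertex of $U$ to the last vertex of $V$ is called an outer border, and an edge joining the last vertex of $U$ to the first vertex of $V$ is called an inner border. A bordered cycle is an ordered cycle (an ordered graph whose underlying graph is a cycle) with interval chromatic number $2$ that contains both an inner border and an outer border. $\mathcal{C}^B_{2j}$ is the set of all bordered cycles of length $2j$ (up to order-preserving isomorphism). -}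

module Defs where

open import Data.Bool using (Bool; false; T)
open import Data.Bool.Properties using (T?)
open import Data.Fin using (Fin; toℕ; _≤_; zero; suc)
open import Data.Fin.Properties using (_<?_)
open import Data.List using (List; length; filter; allFin; cartesianProduct)
open import Data.Nat as ℕ using (ℕ; _*_; _^_)
open import Data.Product using (∃-syntax; Σ-syntax; _×_; _,_; proj₁)
open import Data.Sum using (_⊎_)
open import Function using (_⇔_; _↔_; Injective; StrictlySurjective; Inverse)
open import Level using (0ℓ)
open import Relation.Binary using (_Preserves_⟶_)
open import Relation.Binary.PropositionalEquality using (_≡_; _≢_)
open import Relation.Nullary using (¬_)
open import Relation.Nullary.Decidable using (_×-dec_)
open import Relation.Unary using (Pred)

private variable
  m n : ℕ

-- A finite linearly ordered set is uniquely isomorphic to some Fin n, so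
-- ordered graphs up to order-preserving isomorphism live on Fin n with its
-- usual order.
record OrderedGraph (n : ℕ) : Set where
  field
    adj    : Fin n → Fin n → Bool
    sym    : ∀ u v → adj u v ≡ adj v u
    irrefl : ∀ u → adj u u ≡ false

  Adj : Fin n → Fin n → Set
  Adj u v = T (adj u v)

  -- Each edge is listed once, as the pair (u , v) with u < v.
  edges : List (Fin n × Fin n)
  edges = filter (λ (u , v) → (u <? v) ×-dec T? (adj u v))
                 (cartesianProduct (allFin n) (allFin n))

  edgeCount : ℕ
  edgeCount = length edges

open OrderedGraph public using (Adj; edgeCount)

record IsEmbedding (H : OrderedGraph m) (G : OrderedGraph n)
                   (f : Fin m → Fin n) : Set where
  field
    injective       : Injective _≡_ _≡_ f
    orderPreserving : f Preserves _≤_ ⟶ _≤_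
    edgePreserving  : f Preserves Adj H ⟶ Adj G

_Contains_ : OrderedGraph n → OrderedGraph m → Set
G Contains H = ∃[ f ] IsEmbedding H G f

Family : Set₁
Family = (m : ℕ) → Pred (OrderedGraph m) 0ℓ

_Avoids_ : OrderedGraph n → Family → Set
G Avoids 𝓗 = ∀ m (H : OrderedGraph m) → 𝓗 m H → ¬ (G Contains H)

-- IsEx n 𝓗 e : the maximum defining ex_<(n, 𝓗) exists and equals e.
IsEx : ℕ → Family → ℕ → Set
IsEx n 𝓗 e =
  (∃[ G ] G Avoids 𝓗 × edgeCount {n} G ≡ e) ×
  (∀ (G : OrderedGraph n) → G Avoids 𝓗 → edgeCount G ℕ.≤ e)

-- The successor relation of the cyclic order 0, 1, …, ℓ-1, 0 on Fin ℓ.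
CyclicSucc : ∀ {ℓ} → Fin ℓ → Fin ℓ → Set
CyclicSucc {ℓ} i j =
  (ℕ.suc (toℕ i) ≡ toℕ j) ⊎ (ℕ.suc (toℕ i) ≡ ℓ × toℕ j ≡ 0)

-- The underlying graph is isomorphic to the cycle on ℓ ≥ 3 vertices; the
-- bijection need not respect the order.
IsCycle : ∀ {ℓ} → OrderedGraph ℓ → Set
IsCycle {ℓ} H =
  3 ℕ.≤ ℓ ×
  Σ[ σ ∈ (Fin ℓ ↔ Fin ℓ) ]
    (∀ i j → Adj H (Inverse.to σ i) (Inverse.to σ j)
             ⇔ (CyclicSucc i j ⊎ CyclicSucc j i))

-- A partition into r nonempty intervals is a monotone surjection onto Fin r;
-- the i-th interval is the fibre over i.
record IsIntervalColouring (G : OrderedGraph n) (r : ℕ)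
                           (c : Fin n → Fin r) : Set where
  field
    monotone   : c Preserves _≤_ ⟶ _≤_
    surjective : StrictlySurjective _≡_ c
    proper     : ∀ u v → Adj G u v → c u ≢ c v

IntervalColourable : OrderedGraph n → ℕ → Set
IntervalColourable G r = ∃[ c ] IsIntervalColouring G r c

HasIntervalChromaticNumber : OrderedGraph n → ℕ → Set
HasIntervalChromaticNumber G r =
  IntervalColourable G r × (∀ s → IntervalColourable G s → r ℕ.≤ s)

IsFirst IsLast : Pred (Fin n) 0ℓ → Fin n → Set
IsFirst P u = P u × (∀ v → P v → u ≤ v)
IsLast  P u = P u × (∀ v → P v → v ≤ u)

module _ (G : OrderedGraph n) (c : Fin n → Fin 2) where
  private
    U V : Pred (Fin n) 0ℓ
    U u = c u ≡ zero
    V v = c v ≡ suc zero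

  HasInnerBorder HasOuterBorder : Set
  HasInnerBorder = ∃[ u ] ∃[ v ] IsLast  U u × IsFirst V v × Adj G u v
  HasOuterBorder = ∃[ u ] ∃[ v ] IsFirst U u × IsLast  V v × Adj G u v

record IsBorderedCycle (H : OrderedGraph m) : Set where
  field
    isCycle                   : IsCycle H
    intervalChromaticNumber-2 : HasIntervalChromaticNumber H 2

  intervals : Fin m → Fin 2
  intervals = proj₁ (proj₁ intervalChromaticNumber-2)

  field
    innerBorder : HasInnerBorder H intervals
    outerBorder : HasOuterBorder H intervals

𝓒ᴮ : ℕ → Family
𝓒ᴮ ℓ m H = m ≡ ℓ × IsBorderedCycle H

-- 𝓒ᴮ 4 ∪ 𝓒ᴮ 6 ∪ … ∪ 𝓒ᴮ (2 * k)
𝓒ᴮ-upTo : ℕ → Family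
𝓒ᴮ-upTo k m H = ∃[ j ] 2 ℕ.≤ j × j ℕ.≤ k × 𝓒ᴮ (2 * j) m H

-- f n = Θ(n^(p/q)) for q > 0. The two bounds are n^(p/q) ≤ a · f n and
-- f n ≤ b · n^(p/q) raised to the q-th power. Natural a and b lose nothing:
-- real constants 1/a and b can be rounded to these.
IsΘ-power : (ℕ → ℕ) → (p q : ℕ) → Set
IsΘ-power f p q =
  ∃[ a ] ∃[ b ] ∃[ n₀ ] 0 ℕ.< a × 0 ℕ.< b ×
  (∀ n → n₀ ℕ.≤ n →
    (n ^ p ℕ.≤ (a * f n) ^ q) ×
    (f n ^ q ℕ.≤ b ^ q * n ^ p))

{-# OPTIONS --safe #-}
-- Upper bound. Call a path in G a zigzag if its edges are nested intervals, so that each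
-- step leaves the current interval alternately to the left and to the right. Discard k times
-- the edges with fewer than d further continuations to the left or to the right; each round
-- costs at most 2 n d edges, and an edge that survives is the root of a d-ary tree of depth k
-- of zigzags. If dᵏ > n, two branches end in the same vertex. Between the vertex where they
-- diverge and the first vertex where they meet again they form a cycle: its inner border is
-- the shorter edge at the former vertex and its outer border the longer edge at the latter.
--
-- Lower bound. Join u < v when v - u lies in a set S of size about n^(1/k) in which a sum of
-- at most k elements determines the summands. The differences along a cycle sum to the same
-- value over its even and over its odd edges, so every difference occurs in both classes;
-- but the outer border is the only edge of the cycle with its difference. For S take the
-- points (a , a² , … , aᵏ) modulo a prime p > k, read as digits in base kp + 1: by Newton's
-- identities the power sums of at most k residues determine them. Primes of the right
-- size exist by Chebyshev's argument.
module Submission where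

open import Data.Bool using (Bool; true; false; T)
open import Data.Bool.Properties using (T?; ∨-comm)
open import Data.Empty using (⊥)
open import Data.Fin as Fin using (Fin; zero; suc; toℕ; fromℕ<; combine; remQuot; finToFun; funToFin)
import Data.Fin.Properties as Finₚ
open import Data.Integer as ℤ using (ℤ; 0ℤ; 1ℤ; ∣_∣) renaming (+_ to pos)
import Data.Integer.Divisibility.Signed as ℤ∣
open ℤ∣ using () renaming (_∣_ to _∣ℤ_; divides to dividesℤ)
import Data.Integer.Properties as ℤₚ
open import Data.Integer.Tactic.RingSolver using () renaming (solve-∀ to ring)
open import Data.List as List
  using (List; []; _∷_; [_]; _++_; length; lookup; reverse; filter; tabulate; map; applyUpTo; allFin; cartesianProduct)
import Data.List.Extrema.Nat as Extrema
open import Data.List.Membership.Propositional using (_∈_; _∉_; find)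
open import Data.List.Membership.Propositional.Properties
  using (∈-lookup; ∈-∃++; ∈-++⁺ˡ; ∈-++⁻; ∈-insert; ∈-map⁺; ∈-map⁻; ∈-applyUpTo⁺; ∈-applyUpTo⁻;
         ∈-filter⁺; ∈-cartesianProduct⁺; ∈-allFin)
import Data.List.Properties as Listₚ
open import Data.List.Relation.Unary.All as All using (All; []; _∷_)
import Data.List.Relation.Unary.All.Properties as Allₚ
open import Data.List.Relation.Unary.AllPairs using ([]; _∷_)
open import Data.List.Relation.Unary.Any as Any using (Any; here; there)
import Data.List.Relation.Unary.Any.Properties as Anyₚ
open import Data.List.Relation.Unary.Unique.Propositional using (Unique)
import Data.List.Relation.Unary.Unique.Propositional.Properties as Uniqueₚ
open import Data.Nat as ℕ
  using (ℕ; zero; suc; _+_; _*_; _∸_; _^_; _!; _≤_; _<_; z≤n; s≤s; NonZero; >-nonZero)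
open import Data.Nat.Combinatorics
  using (_C_; nCk+nC[k+1]≡[n+1]C[k+1]; k>n⇒nCk≡0; nCk≡n!/k![n-k]!; k![n∸k]!∣n!)
open import Data.Nat.Coprimality using (Coprime; coprime-divisor)
open import Data.Nat.DivMod
  using (_%_; _/_; m%n<n; m≡m%n+[m/n]*n; m/n*n≡m; [m+n]%n≡m%n; [m+kn]%n≡m%n; m<n⇒m%n≡m; n%n≡0)
open import Data.Nat.Divisibility
open import Data.Nat.ListAction using (product) renaming (sum to listSum)
open import Data.Nat.Primality
  using (Prime; prime?; prime⇒irreducible; prime⇒nonTrivial; prime⇒nonZero; euclidsLemma)
open import Data.Nat.Primality.Factorisation using (factorise)
import Data.Nat.Properties as ℕₚ
open import Data.Nat.Tactic.RingSolver using (solve-∀)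
open import Data.Product as Product using (∃-syntax; Σ-syntax; _×_; _,_; proj₁; proj₂)
open import Data.Sum as Sum using (_⊎_; inj₁; inj₂; [_,_]′)
open import Function using (_∘_; id; Injective; _⇔_; mk⇔; Inverse; Equivalence; _↔_; mk↔ₛ′)
open import Relation.Binary using (tri<; tri≈; tri>)
open import Relation.Binary.PropositionalEquality hiding ([_])
open import Relation.Nullary using (¬_; Dec; yes; no; does; contradiction)
open import Relation.Nullary.Decidable using (_⊎-dec_; _×-dec_; _→-dec_; ¬?; dec-false; map′)
open import Relation.Unary using (Pred; Decidable)
open import Algebra.Properties.CommutativeMonoid.Sum ℕₚ.+-0-commutativeMonoid
  using (sum; sum-cong-≗; ∑-distrib-+; ∑-comm)
open import Defs

-- Containment quantifies over all ordered graphs `H` and all embeddings, and `IsEx` asks for an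
-- attained maximum. Both become finite through traces: injective cyclic sequences of vertices of
-- `G` with a threshold `τ` between the two intervals. Their existence is decidable, so the extremal
-- number is a maximum over an enumeration of all graphs on `n` vertices.
--
-- The threshold also explains the zigzags. All edges of the zigzags from one root edge contain that
-- edge as an interval, so a `τ` inside it is crossed by every one of them, and a cycle made of such
-- edges automatically has two intervals. Only the borders remain to be found.
--
-- The graph of the lower bound cannot be expected to avoid all short cycles: the differences a, -b,
-- c, -a, b, -c lead back to the start and may close a six-cycle. Every difference occurring in both
-- classes is therefore no contradiction by itself; the border supplies it.
--
-- A fixed ratio between the ends of a prime window, here 8, only affects the implied constants.

private variable
  m n ℓ d k p : ℕ
  S : Set

-- Bordered cycles as cyclic vertex sequences

sum-mono-≤ : ∀ {f g : Fin n → ℕ} → (∀ i → f i ≤ g i) → sum f ≤ sum g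
sum-mono-≤ {zero}  f≤g = z≤n
sum-mono-≤ {suc n} f≤g = ℕₚ.+-mono-≤ (f≤g zero) (sum-mono-≤ (f≤g ∘ suc))

sum-mono-< : ∀ {f g : Fin n → ℕ} → (∀ i → f i ≤ g i) → ∀ i → f i < g i → sum f < sum g
sum-mono-< f≤g zero    f<g = ℕₚ.+-mono-<-≤ f<g (sum-mono-≤ (f≤g ∘ suc))
sum-mono-< f≤g (suc i) f<g = ℕₚ.+-mono-≤-< (f≤g zero) (sum-mono-< (f≤g ∘ suc) i f<g)

sum-const : ∀ n c → sum {n} (λ _ → c) ≡ n * c
sum-const zero    c = refl
sum-const (suc n) c = cong (c +_) (sum-const n c)

𝟙 : ∀ {P : Set} → Dec P → ℕ
𝟙 (yes _) = 1
𝟙 (no _)  = 0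

𝟙≤1 : ∀ {P : Set} (P? : Dec P) → 𝟙 P? ≤ 1
𝟙≤1 (yes _) = s≤s z≤n
𝟙≤1 (no _)  = z≤n

𝟙-mono : ∀ {P Q : Set} (P? : Dec P) (Q? : Dec Q) → (P → Q) → 𝟙 P? ≤ 𝟙 Q?
𝟙-mono (no _)  _       f = z≤n
𝟙-mono (yes p) (yes _) f = s≤s z≤n
𝟙-mono (yes p) (no ¬q) f = contradiction (f p) ¬q

𝟙-< : ∀ {P Q : Set} (P? : Dec P) (Q? : Dec Q) → ¬ P → Q → 𝟙 P? < 𝟙 Q?
𝟙-< (yes p) _       ¬p q = contradiction p ¬p
𝟙-< (no _)  (yes _) ¬p q = s≤s z≤n
𝟙-< (no _)  (no ¬q) ¬p q = contradiction q ¬q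

T-does⇒ : ∀ {P : Set} (P? : Dec P) → T (does P?) → P
T-does⇒ (yes p) _ = p

T-does⇐ : ∀ {P : Set} (P? : Dec P) → P → T (does P?)
T-does⇐ (yes _) _ = _
T-does⇐ (no ¬p) p = contradiction p ¬p

injective⇒surjective : ∀ {f : Fin n → Fin n} → Injective _≡_ _≡_ f → ∀ y → ∃[ x ] f x ≡ y
injective⇒surjective {suc n} {f} inj y with Finₚ.any? (λ x → f x Finₚ.≟ y)
... | yes found = found
... | no  none  = contradiction
  (Finₚ.injective⇒≤ {f = λ x → Fin.punchOut (y≢f x)}
    (λ {i} {j} eq → inj (Finₚ.punchOut-injective (y≢f i) (y≢f j) eq)))
  ℕₚ.1+n≰n
  where
  y≢f : ∀ x → y ≢ f x
  y≢f x eq = none (x , sym eq)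

module Sorting (w : Fin ℓ → Fin n) (w-injective : Injective _≡_ _≡_ w) where

  private
    below? : ∀ i j → Dec (w j Fin.< w i)
    below? i j = w j Finₚ.<? w i

  -- `w` lists vertices in cyclic order, whereas an ordered graph lives on `Fin ℓ` with its usual
  -- order. Counting the smaller entries gives the permutation between the two: it serves as the
  -- bijection in `IsCycle`, and its inverse followed by `w` is the order-preserving copy.
  rankℕ : Fin ℓ → ℕ
  rankℕ i = sum (λ j → 𝟙 (below? i j))

  rankℕ<ℓ : ∀ i → rankℕ i < ℓ
  rankℕ<ℓ i = subst (rankℕ i <_) (trans (sum-const ℓ 1) (ℕₚ.*-identityʳ ℓ))
    (sum-mono-< (λ j → 𝟙≤1 (below? i j)) i
      (𝟙-< (below? i i) (yes (refl {x = i})) (Finₚ.<-irrefl refl) refl))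

  rankℕ-mono : ∀ {i j} → w i Fin.< w j → rankℕ i < rankℕ j
  rankℕ-mono {i} {j} wi<wj = sum-mono-<
    (λ x → 𝟙-mono (below? i x) (below? j x) (λ x<i → Finₚ.<-trans x<i wi<wj)) i
    (𝟙-< (below? i i) (below? j i) (Finₚ.<-irrefl refl) wi<wj)

  rank : Fin ℓ → Fin ℓ
  rank i = fromℕ< (rankℕ<ℓ i)

  rank-mono : ∀ {i j} → w i Fin.< w j → rank i Fin.< rank j
  rank-mono {i} {j} wi<wj = subst₂ _<_
    (sym (Finₚ.toℕ-fromℕ< (rankℕ<ℓ i))) (sym (Finₚ.toℕ-fromℕ< (rankℕ<ℓ j))) (rankℕ-mono wi<wj)

  rank-injective : Injective _≡_ _≡_ rank
  rank-injective {i} {j} eq with Finₚ.<-cmp (w i) (w j)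
  ... | tri< lt _ _ = contradiction (rank-mono lt) (Finₚ.<-irrefl eq)
  ... | tri≈ _ e _  = w-injective e
  ... | tri> _ _ gt = contradiction (rank-mono gt) (Finₚ.<-irrefl (sym eq))

  unrank : Fin ℓ → Fin ℓ
  unrank y = proj₁ (injective⇒surjective rank-injective y)

  rank-unrank : ∀ y → rank (unrank y) ≡ y
  rank-unrank y = proj₂ (injective⇒surjective rank-injective y)

  unrank-rank : ∀ x → unrank (rank x) ≡ x
  unrank-rank x = rank-injective (rank-unrank (rank x))

  sorted : Fin ℓ → Fin n
  sorted = w ∘ unrank

  sorted-mono : ∀ {x y} → x Fin.≤ y → sorted x Fin.≤ sorted y
  sorted-mono {x} {y} x≤y = ℕₚ.≮⇒≥ λ lt →
    ℕₚ.<⇒≱ (subst₂ Fin._<_ (rank-unrank y) (rank-unrank x) (rank-mono lt)) x≤y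

  sorted-injective : Injective _≡_ _≡_ sorted
  sorted-injective {x} {y} eq =
    trans (sym (rank-unrank x)) (trans (cong rank (w-injective eq)) (rank-unrank y))

  rank-↔ : Fin ℓ ↔ Fin ℓ
  rank-↔ = mk↔ₛ′ rank unrank rank-unrank unrank-rank

CyclicAdj : Fin ℓ → Fin ℓ → Set
CyclicAdj i j = CyclicSucc i j ⊎ CyclicSucc j i

cyclicSucc? : ∀ (i j : Fin ℓ) → Dec (CyclicSucc i j)
cyclicSucc? {ℓ} i j =
  (suc (toℕ i) ℕ.≟ toℕ j) ⊎-dec ((suc (toℕ i) ℕ.≟ ℓ) ×-dec (toℕ j ℕ.≟ 0))

cyclicAdj? : ∀ (i j : Fin ℓ) → Dec (CyclicAdj i j)
cyclicAdj? i j = cyclicSucc? i j ⊎-dec cyclicSucc? j i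

Crosses : Fin n → Fin n → Fin n → Set
Crosses τ x y = x Fin.≤ τ × τ Fin.< y

record IsInner (τ : Fin n) (w : Fin ℓ → Fin n) (i j : Fin ℓ) : Set where
  constructor mkInner
  field
    adjacent : CyclicAdj i j
    crosses  : Crosses τ (w i) (w j)
    extremal : ∀ x → (w x Fin.≤ τ → w x Fin.≤ w i) × (τ Fin.< w x → w j Fin.≤ w x)

record IsOuter (τ : Fin n) (w : Fin ℓ → Fin n) (i j : Fin ℓ) : Set where
  constructor mkOuter
  field
    adjacent : CyclicAdj i j
    crosses  : Crosses τ (w i) (w j)
    extremal : ∀ x → (w x Fin.≤ τ → w i Fin.≤ w x) × (τ Fin.< w x → w x Fin.≤ w j)

-- A bordered cycle traced in G as a cyclic sequence of vertices; the two intervals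
-- are the vertices up to τ and the vertices beyond τ.
record BorderedTrace (G : OrderedGraph n) (τ : Fin n) (w : Fin ℓ → Fin n) : Set where
  constructor mkTrace
  field
    injective : ∀ i j → w i ≡ w j → i ≡ j
    edge      : ∀ i j → CyclicSucc i j →
                Adj G (w i) (w j) × (Crosses τ (w i) (w j) ⊎ Crosses τ (w j) (w i))
    inner     : ∃[ i ] ∃[ j ] IsInner τ w i j
    outer     : ∃[ i ] ∃[ j ] IsOuter τ w i j

Bordered : OrderedGraph n → ℕ → Set
Bordered {n} G ℓ = Σ[ τ ∈ Fin n ] Σ[ w ∈ (Fin ℓ → Fin n) ] BorderedTrace G τ w

≰τ : ∀ {x τ : Fin n} → τ Fin.< x → ¬ (x Fin.≤ τ)
≰τ = ℕₚ.<⇒≱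

module TraceToCycle {G : OrderedGraph n} {τ : Fin n} {w : Fin ℓ → Fin n}
                (3≤ℓ : 3 ≤ ℓ) (trace : BorderedTrace G τ w) where
  open BorderedTrace trace
  open Sorting w (injective _ _)

  irreflexive : ∀ i → ¬ CyclicAdj {ℓ} i i
  irreflexive i = [ go , go ]′
    where
    go : ¬ CyclicSucc i i
    go (inj₁ e)        = ℕₚ.1+n≢n e
    go (inj₂ (e , e′)) =
      contradiction (subst (3 ≤_) (trans (sym e) (cong suc e′)) 3≤ℓ) λ { (s≤s ()) }

  H : OrderedGraph ℓ
  H = record
    { adj    = λ x y → does (cyclicAdj? (unrank x) (unrank y))
    ; sym    = λ x y → ∨-comm (does (cyclicSucc? (unrank x) (unrank y))) _
    ; irrefl = λ x → dec-false (cyclicAdj? (unrank x) (unrank x)) (irreflexive _)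
    }

  H-adj⇒ : ∀ {x y} → Adj H x y → CyclicAdj (unrank x) (unrank y)
  H-adj⇒ {x} {y} = T-does⇒ (cyclicAdj? (unrank x) (unrank y))

  H-adj⇐ : ∀ {x y} → CyclicAdj (unrank x) (unrank y) → Adj H x y
  H-adj⇐ {x} {y} = T-does⇐ (cyclicAdj? (unrank x) (unrank y))

  H-adj-rank : ∀ {i j} → CyclicAdj i j → Adj H (rank i) (rank j)
  H-adj-rank {i} {j} a =
    H-adj⇐ (subst₂ CyclicAdj (sym (unrank-rank i)) (sym (unrank-rank j)) a)

  contains : G Contains H
  contains = sorted , record
    { injective       = sorted-injective
    ; orderPreserving = sorted-mono
    ; edgePreserving  = λ {x} {y} a → [ (λ s → proj₁ (edge _ _ s))
                        , (λ s → subst T (OrderedGraph.sym G _ _) (proj₁ (edge _ _ s))) ]′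
                        (H-adj⇒ {x} {y} a)
    }

  isCycle : IsCycle H
  isCycle = 3≤ℓ , rank-↔ , λ i j → mk⇔
    (λ a → subst₂ CyclicAdj (unrank-rank i) (unrank-rank j) (H-adj⇒ a)) H-adj-rank

  side : ∀ {x : Fin n} → Dec (x Fin.≤ τ) → Fin 2
  side (yes _) = zero
  side (no _)  = suc zero

  colour : Fin ℓ → Fin 2
  colour x = side (sorted x Finₚ.≤? τ)

  side≡0⇒ : ∀ {x} (d : Dec (x Fin.≤ τ)) → side d ≡ zero → x Fin.≤ τ
  side≡0⇒ (yes p) _ = p

  side≡1⇒ : ∀ {x} (d : Dec (x Fin.≤ τ)) → side d ≡ suc zero → τ Fin.< x
  side≡1⇒ (no p) _ = ℕₚ.≰⇒> p

  side≡0⇐ : ∀ {x} (d : Dec (x Fin.≤ τ)) → x Fin.≤ τ → side d ≡ zero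
  side≡0⇐ (yes _) _ = refl
  side≡0⇐ (no ¬p) p = contradiction p ¬p

  side≡1⇐ : ∀ {x} (d : Dec (x Fin.≤ τ)) → τ Fin.< x → side d ≡ suc zero
  side≡1⇐ (yes p) q = contradiction p (ℕₚ.<⇒≱ q)
  side≡1⇐ (no _)  q = refl

  side-mono : ∀ {x y} (d : Dec (x Fin.≤ τ)) (d′ : Dec (y Fin.≤ τ)) → x Fin.≤ y →
              side d Fin.≤ side d′
  side-mono (yes _) _       _   = z≤n
  side-mono (no _)  (no _)  _   = s≤s z≤n
  side-mono (no ¬p) (yes p) x≤y = contradiction (ℕₚ.≤-trans x≤y p) ¬p

  Crosses⇒colour≢ : ∀ x y → Crosses τ (sorted x) (sorted y) → colour x ≢ colour y
  Crosses⇒colour≢ x y (p , q) eq = contradiction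
    (trans (sym (side≡0⇐ (sorted x Finₚ.≤? τ) p)) (trans eq (side≡1⇐ (sorted y Finₚ.≤? τ) q)))
    λ ()

  sorted-rank : ∀ i → sorted (rank i) ≡ w i
  sorted-rank i = cong w (unrank-rank i)

  colour-rank≡0 : ∀ {i} → w i Fin.≤ τ → colour (rank i) ≡ zero
  colour-rank≡0 {i} p =
    side≡0⇐ (sorted (rank i) Finₚ.≤? τ) (subst (Fin._≤ τ) (sym (sorted-rank i)) p)

  colour-rank≡1 : ∀ {i} → τ Fin.< w i → colour (rank i) ≡ suc zero
  colour-rank≡1 {i} p =
    side≡1⇐ (sorted (rank i) Finₚ.≤? τ) (subst (τ Fin.<_) (sym (sorted-rank i)) p)

  rank-mono-≤ : ∀ {i y} → w i Fin.≤ sorted y → rank i Fin.≤ y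
  rank-mono-≤ {i} {y} p = ℕₚ.≮⇒≥ λ lt → contradiction
    (sorted-injective {rank i} {y} (trans (sorted-rank i)
      (Finₚ.≤-antisym p (subst (sorted y Fin.≤_) (sorted-rank i) (sorted-mono (ℕₚ.<⇒≤ lt))))))
    λ e → Finₚ.<-irrefl (sym e) lt

  rank-mono-≥ : ∀ {i y} → sorted y Fin.≤ w i → y Fin.≤ rank i
  rank-mono-≥ {i} {y} p = ℕₚ.≮⇒≥ λ lt → contradiction
    (sorted-injective {rank i} {y} (trans (sorted-rank i)
      (Finₚ.≤-antisym (subst (Fin._≤ sorted y) (sorted-rank i) (sorted-mono (ℕₚ.<⇒≤ lt))) p)))
    λ e → Finₚ.<-irrefl e lt

  isColouring : IsIntervalColouring H 2 colour
  isColouring = record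
    { monotone   = λ {x} {y} x≤y →
        side-mono (sorted x Finₚ.≤? τ) (sorted y Finₚ.≤? τ) (sorted-mono x≤y)
    ; surjective = λ { zero → rank (proj₁ inner) ,
                              colour-rank≡0 (proj₁ (IsInner.crosses (proj₂ (proj₂ inner))))
                     ; (suc zero) → rank (proj₁ (proj₂ inner)) ,
                              colour-rank≡1 (proj₂ (IsInner.crosses (proj₂ (proj₂ inner)))) }
    ; proper     = λ x y a → [ (λ s → [ Crosses⇒colour≢ x y
                                      , (λ c → ≢-sym (Crosses⇒colour≢ y x c)) ]′ (proj₂ (edge _ _ s)))
                             , (λ s → [ (λ c → ≢-sym (Crosses⇒colour≢ y x c))
                                      , Crosses⇒colour≢ x y ]′ (proj₂ (edge _ _ s))) ]′
                             (H-adj⇒ {x} {y} a)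
    }

  -- The inner border is an edge, so one colour is not proper; `s = 0` is impossible because `Fin 0`
  -- would have to contain the colour of a vertex.
  two-colours-needed : ∀ s → IntervalColourable H s → 2 ≤ s
  two-colours-needed s (c , cIsColouring)
    with i , j , mkInner a _ _ ← inner
    with s | c (rank i) | c (rank j)
       | IsIntervalColouring.proper cIsColouring (rank i) (rank j) (H-adj-rank a)
  ... | suc zero    | zero | zero | neq = contradiction refl neq
  ... | suc (suc _) | _    | _    | _   = s≤s (s≤s z≤n)

  isBordered : IsBorderedCycle H
  isBordered = record
    { isCycle                   = isCycle
    ; intervalChromaticNumber-2 = (colour , isColouring) , two-colours-needed
    ; innerBorder = let (i , j , mkInner a (p , q) e) = inner in
        rank i , rank j
        , (colour-rank≡0 p , λ v cv → rank-mono-≥ (proj₁ (e _) (side≡0⇒ (sorted v Finₚ.≤? τ) cv)))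
        , (colour-rank≡1 q , λ v cv → rank-mono-≤ (proj₂ (e _) (side≡1⇒ (sorted v Finₚ.≤? τ) cv)))
        , H-adj-rank a
    ; outerBorder = let (i , j , mkOuter a (p , q) e) = outer in
        rank i , rank j
        , (colour-rank≡0 p , λ v cv → rank-mono-≤ (proj₁ (e _) (side≡0⇒ (sorted v Finₚ.≤? τ) cv)))
        , (colour-rank≡1 q , λ v cv → rank-mono-≥ (proj₂ (e _) (side≡1⇒ (sorted v Finₚ.≤? τ) cv)))
        , H-adj-rank a
    }

module CycleToTrace {G : OrderedGraph n} {H : OrderedGraph ℓ}
                  (bordered : IsBorderedCycle H) (copy : G Contains H) where
  open IsBorderedCycle bordered
  open IsIntervalColouring (proj₂ (proj₁ intervalChromaticNumber-2))

  f : Fin ℓ → Fin n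
  f = proj₁ copy

  open IsEmbedding (proj₂ copy) renaming (injective to f-injective)

  σ : Fin ℓ ↔ Fin ℓ
  σ = proj₁ (proj₂ isCycle)

  open Inverse σ using (to; from; strictlyInverseˡ; strictlyInverseʳ)

  w : Fin ℓ → Fin n
  w = f ∘ to

  f-mono-< : ∀ {x y} → x Fin.< y → f x Fin.< f y
  f-mono-< x<y = ℕₚ.≤∧≢⇒< (orderPreserving (ℕₚ.<⇒≤ x<y))
    λ e → Finₚ.<-irrefl (f-injective (Finₚ.toℕ-injective e)) x<y

  -- The image of the last vertex of `U`: as `f` is strictly increasing, all of `V` lands beyond it.
  τ : Fin n
  τ = f (proj₁ innerBorder)

  U⇒≤τ : ∀ {x} → intervals x ≡ zero → f x Fin.≤ τ
  U⇒≤τ {x} cx = let (_ , _ , (_ , last) , _) = innerBorder in orderPreserving (last x cx)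

  V⇒>τ : ∀ {x} → intervals x ≡ suc zero → τ Fin.< f x
  V⇒>τ {x} cx = let (u , _ , (cu , _) , _) = innerBorder in
    f-mono-< (ℕₚ.≰⇒> λ x≤u → contradiction (subst₂ Fin._≤_ cx cu (monotone x≤u)) λ ())

  ≤τ⇒U : ∀ {x} → f x Fin.≤ τ → intervals x ≡ zero
  ≤τ⇒U {x} p with intervals x in eq
  ... | zero     = refl
  ... | suc zero = contradiction p (ℕₚ.<⇒≱ (V⇒>τ eq))

  >τ⇒V : ∀ {x} → τ Fin.< f x → intervals x ≡ suc zero
  >τ⇒V {x} p with intervals x in eq
  ... | suc zero = refl
  ... | zero     = contradiction (U⇒≤τ eq) (ℕₚ.<⇒≱ p)

  adj⇒cyclicAdj : ∀ {x y} → Adj H x y → CyclicAdj (from x) (from y)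
  adj⇒cyclicAdj {x} {y} a = Equivalence.to (proj₂ (proj₂ isCycle) (from x) (from y))
    (subst₂ (Adj H) (sym (strictlyInverseˡ x)) (sym (strictlyInverseˡ y)) a)

  w-from : ∀ x → w (from x) ≡ f x
  w-from x = cong f (strictlyInverseˡ x)

  colours-differ⇒crosses : ∀ {x y} → intervals x ≢ intervals y →
                           Crosses τ (f x) (f y) ⊎ Crosses τ (f y) (f x)
  colours-differ⇒crosses {x} {y} neq with intervals x in ex | intervals y in ey
  ... | zero     | suc zero = inj₁ (U⇒≤τ ex , V⇒>τ ey)
  ... | suc zero | zero     = inj₂ (U⇒≤τ ey , V⇒>τ ex)
  ... | zero     | zero     = contradiction refl neq
  ... | suc zero | suc zero = contradiction refl neq

  trace : BorderedTrace G τ w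
  trace = mkTrace
    (λ i j e → trans (sym (strictlyInverseʳ i)) (trans (cong from (f-injective e)) (strictlyInverseʳ j)))
    (λ i j s → let a = Equivalence.from (proj₂ (proj₂ isCycle) i j) (inj₁ s) in
      edgePreserving a , colours-differ⇒crosses (proper _ _ a))
    (let (u , v , (cu , u-last) , (cv , v-first) , a) = innerBorder in
      from u , from v , mkInner (adj⇒cyclicAdj a)
        (subst₂ (Crosses τ) (sym (w-from u)) (sym (w-from v)) (U⇒≤τ cu , V⇒>τ cv))
        (λ x → (λ p → subst (w x Fin.≤_) (sym (w-from u)) (orderPreserving (u-last _ (≤τ⇒U p))))
             , (λ p → subst (Fin._≤ w x) (sym (w-from v)) (orderPreserving (v-first _ (>τ⇒V p))))))
    (let (u , v , (cu , u-first) , (cv , v-last) , a) = outerBorder in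
      from u , from v , mkOuter (adj⇒cyclicAdj a)
        (subst₂ (Crosses τ) (sym (w-from u)) (sym (w-from v)) (U⇒≤τ cu , V⇒>τ cv))
        (λ x → (λ p → subst (Fin._≤ w x) (sym (w-from u)) (orderPreserving (u-first _ (≤τ⇒U p))))
             , (λ p → subst (w x Fin.≤_) (sym (w-from v)) (orderPreserving (v-last _ (>τ⇒V p))))))

-- The extremal number

crosses? : ∀ (τ x y : Fin n) → Dec (Crosses τ x y)
crosses? τ x y = (x Finₚ.≤? τ) ×-dec (τ Finₚ.<? y)

isInner? : ∀ (τ : Fin n) (w : Fin ℓ → Fin n) i j → Dec (IsInner τ w i j)
isInner? τ w i j = map′ (λ (a , c , e) → mkInner a c e) (λ (mkInner a c e) → a , c , e)
  (cyclicAdj? i j ×-dec crosses? τ (w i) (w j) ×-dec Finₚ.all? λ x →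
    ((w x Finₚ.≤? τ) →-dec (w x Finₚ.≤? w i)) ×-dec ((τ Finₚ.<? w x) →-dec (w j Finₚ.≤? w x)))

isOuter? : ∀ (τ : Fin n) (w : Fin ℓ → Fin n) i j → Dec (IsOuter τ w i j)
isOuter? τ w i j = map′ (λ (a , c , e) → mkOuter a c e) (λ (mkOuter a c e) → a , c , e)
  (cyclicAdj? i j ×-dec crosses? τ (w i) (w j) ×-dec Finₚ.all? λ x →
    ((w x Finₚ.≤? τ) →-dec (w i Finₚ.≤? w x)) ×-dec ((τ Finₚ.<? w x) →-dec (w x Finₚ.≤? w j)))

borderedTrace? : ∀ (G : OrderedGraph n) τ (w : Fin ℓ → Fin n) → Dec (BorderedTrace G τ w)
borderedTrace? G τ w = map′
  (λ (p , e , i , o) → mkTrace p e i o) (λ (mkTrace p e i o) → p , e , i , o)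
  ( (Finₚ.all? λ i → Finₚ.all? λ j → (w i Finₚ.≟ w j) →-dec (i Finₚ.≟ j))
  ×-dec (Finₚ.all? λ i → Finₚ.all? λ j → cyclicSucc? i j →-dec
          (T? _ ×-dec (crosses? τ (w i) (w j) ⊎-dec crosses? τ (w j) (w i))))
  ×-dec (Finₚ.any? λ i → Finₚ.any? λ j → isInner? τ w i j)
  ×-dec (Finₚ.any? λ i → Finₚ.any? λ j → isOuter? τ w i j))

-- Walks and graphs recovered from their numerical codes agree with the originals only pointwise, so
-- traces have to be transported along pointwise equality.
borderedTrace-resp : ∀ {G G′ : OrderedGraph n} {τ} {w w′ : Fin ℓ → Fin n} →
  (∀ {u v} → Adj G u v → Adj G′ u v) → (∀ i → w i ≡ w′ i) →
  BorderedTrace G τ w → BorderedTrace G′ τ w′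
borderedTrace-resp {G′ = G′} {τ} {w} {w′} G⊆G′ w≗w′ (mkTrace p e (i , j , mkInner a c x) (i′ , j′ , mkOuter a′ c′ x′)) =
  mkTrace
    (λ i j eq → p i j (trans (w≗w′ i) (trans eq (sym (w≗w′ j)))))
    (λ i j s → let (ad , cr) = e i j s in
      subst₂ (Adj G′) (w≗w′ i) (w≗w′ j) (G⊆G′ ad) ,
      subst₂ (λ u v → Crosses τ u v ⊎ Crosses τ v u) (w≗w′ i) (w≗w′ j) cr)
    (i , j , mkInner a (subst₂ (Crosses τ) (w≗w′ i) (w≗w′ j) c)
      λ k → subst₂ (λ u v → (u Fin.≤ τ → u Fin.≤ v) × _) (w≗w′ k) (w≗w′ i)
            (subst₂ (λ u v → _ × (τ Fin.< u → v Fin.≤ u)) (w≗w′ k) (w≗w′ j) (x k)))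
    (i′ , j′ , mkOuter a′ (subst₂ (Crosses τ) (w≗w′ i′) (w≗w′ j′) c′)
      λ k → subst₂ (λ u v → (u Fin.≤ τ → v Fin.≤ u) × _) (w≗w′ k) (w≗w′ i′)
            (subst₂ (λ u v → _ × (τ Fin.< u → u Fin.≤ v)) (w≗w′ k) (w≗w′ j′) (x′ k)))

bordered? : ∀ (G : OrderedGraph n) ℓ → Dec (Bordered G ℓ)
bordered? {n} G ℓ = map′
  (λ (τ , c , t) → τ , finToFun c , t)
  (λ (τ , w , t) → τ , funToFin w ,
    borderedTrace-resp {G = G} {G′ = G} id (λ i → sym (Finₚ.finToFun-funToFin w i)) t)
  (Finₚ.any? λ τ → Finₚ.any? {n ^ ℓ} λ c → borderedTrace? G τ (finToFun c))

HasShortBordered : ℕ → OrderedGraph n → Set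
HasShortBordered k G = ∃[ j ] 2 ≤ j × j ≤ k × Bordered G (2 * j)

hasShortBordered? : ∀ k (G : OrderedGraph n) → Dec (HasShortBordered k G)
hasShortBordered? k G = map′
  (λ (i , 2≤j , b) → toℕ i , 2≤j , ℕₚ.≤-pred (Finₚ.toℕ<n i) , b)
  (λ (j , 2≤j , j≤k , b) → fromℕ< (s≤s j≤k) ,
    subst (λ j → 2 ≤ j × Bordered G (2 * j)) (sym (Finₚ.toℕ-fromℕ< (s≤s j≤k))) (2≤j , b))
  (Finₚ.any? {suc k} λ i → (2 ℕ.≤? toℕ i) ×-dec bordered? G (2 * toℕ i))

-- Trades the quantification over all `H` and all embeddings for a finite search over walks in `G`;
-- from here on only traces are used.
avoids⇔ : ∀ k (G : OrderedGraph n) → G Avoids 𝓒ᴮ-upTo k ⇔ (¬ HasShortBordered k G)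
avoids⇔ k G = mk⇔ to from
  where
  to : G Avoids 𝓒ᴮ-upTo k → ¬ HasShortBordered k G
  to avoids (j , 2≤j , j≤k , τ , w , t) =
    avoids (2 * j) H (j , 2≤j , j≤k , refl , isBordered) contains
    where open TraceToCycle (ℕₚ.≤-trans (s≤s (s≤s (s≤s z≤n))) (ℕₚ.*-monoʳ-≤ 2 2≤j)) t
  from : ¬ HasShortBordered k G → G Avoids 𝓒ᴮ-upTo k
  from none _ H (j , 2≤j , j≤k , refl , b) copy =
    none (j , 2≤j , j≤k , τ , w , trace)
    where open CycleToTrace b copy

-- Reading only the entries with smaller row than column turns every matrix into a graph. Both the
-- enumeration of all graphs and the graph of the lower bound are obtained this way.
fromMatrix : (Fin n → Fin n → Bool) → OrderedGraph n
fromMatrix {n} M = record { adj = adj ; sym = adj-sym ; irrefl = adj-irrefl }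
  where
  pick : ∀ u v → Dec (u Fin.< v) → Dec (v Fin.< u) → Bool
  pick u v (yes _) _       = M u v
  pick u v (no _)  (yes _) = M v u
  pick u v (no _)  (no _)  = false
  adj : Fin n → Fin n → Bool
  adj u v = pick u v (u Finₚ.<? v) (v Finₚ.<? u)
  adj-sym : ∀ u v → adj u v ≡ adj v u
  adj-sym u v with u Finₚ.<? v | v Finₚ.<? u
  ... | yes p | yes q = contradiction p (Finₚ.<-asym q)
  ... | yes _ | no _  = refl
  ... | no _  | yes _ = refl
  ... | no _  | no _  = refl
  adj-irrefl : ∀ u → adj u u ≡ false
  adj-irrefl u with u Finₚ.<? u
  ... | yes p = contradiction p (Finₚ.<-irrefl refl)
  ... | no _  = refl

fromMatrix-adj : ∀ (G : OrderedGraph n) (M : Fin n → Fin n → Bool) →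
  (∀ u v → M u v ≡ OrderedGraph.adj G u v) →
  ∀ u v → OrderedGraph.adj (fromMatrix M) u v ≡ OrderedGraph.adj G u v
fromMatrix-adj G M M≗G u v with u Finₚ.<? v | v Finₚ.<? u
... | yes _  | _      = M≗G u v
... | no _   | yes _  = trans (M≗G v u) (OrderedGraph.sym G v u)
... | no u≮v | no v≮u with refl ← Finₚ.≤-antisym {i = u} {v} (ℕₚ.≮⇒≥ v≮u) (ℕₚ.≮⇒≥ u≮v) =
  sym (OrderedGraph.irrefl G u)

bit : Fin 2 → Bool
bit zero    = false
bit (suc _) = true

unbit : Bool → Fin 2
unbit false = zero
unbit true  = suc zero

bit-unbit : ∀ b → bit (unbit b) ≡ b
bit-unbit false = refl
bit-unbit true  = refl

decodeGraph : ∀ n → Fin (2 ^ (n * n)) → OrderedGraph n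
decodeGraph n c = fromMatrix λ u v → bit (finToFun c (combine u v))

encodeGraph : OrderedGraph n → Fin (2 ^ (n * n))
encodeGraph {n} G = funToFin λ i → let (u , v) = Fin.remQuot n i in unbit (OrderedGraph.adj G u v)

decode-encode : ∀ (G : OrderedGraph n) u v →
  OrderedGraph.adj (decodeGraph n (encodeGraph G)) u v ≡ OrderedGraph.adj G u v
decode-encode {n} G = fromMatrix-adj G _ λ u v → begin
  bit (finToFun (encodeGraph G) (combine u v))
    ≡⟨ cong bit (Finₚ.finToFun-funToFin _ (combine u v)) ⟩
  bit (unbit (entry (Fin.remQuot n (combine u v))))
    ≡⟨ bit-unbit _ ⟩
  entry (Fin.remQuot n (combine u v))
    ≡⟨ cong entry (Finₚ.remQuot-combine u v) ⟩
  OrderedGraph.adj G u v ∎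
  where
  open ≡-Reasoning
  entry : Fin n × Fin n → Bool
  entry (u , v) = OrderedGraph.adj G u v

edgeCount-cong : ∀ (G G′ : OrderedGraph n) →
  (∀ u v → OrderedGraph.adj G u v ≡ OrderedGraph.adj G′ u v) → edgeCount G ≡ edgeCount G′
edgeCount-cong {n} G G′ eq = cong length (Listₚ.filter-≐ _ _
  ( (λ {(u , v)} (lt , a) → lt , subst T (eq u v) a)
  , (λ {(u , v)} (lt , a) → lt , subst T (sym (eq u v)) a))
  (cartesianProduct (allFin n) (allFin n)))

emptyGraph : ∀ n → OrderedGraph n
emptyGraph n = record { adj = λ _ _ → false ; sym = λ _ _ → refl ; irrefl = λ _ → refl }

emptyGraph-avoids : ∀ k n → ¬ HasShortBordered k (emptyGraph n)
emptyGraph-avoids k n (_ , _ , _ , _ , _ , mkTrace _ e (i , j , mkInner (inj₁ s) _ _) _) = proj₁ (e i j s)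
emptyGraph-avoids k n (_ , _ , _ , _ , _ , mkTrace _ e (i , j , mkInner (inj₂ s) _ _) _) = proj₁ (e j i s)

resp-hasShortBordered : ∀ k (G G′ : OrderedGraph n) →
  (∀ u v → OrderedGraph.adj G u v ≡ OrderedGraph.adj G′ u v) →
  HasShortBordered k G → HasShortBordered k G′
resp-hasShortBordered k G G′ eq (j , 2≤j , j≤k , τ , w , t) = j , 2≤j , j≤k , τ , w ,
  borderedTrace-resp {G = G} {G′ = G′} (λ {u} {v} → subst T (eq u v)) (λ _ → refl) t

module _ (k n : ℕ) where
  private
    Code : Set
    Code = Fin (2 ^ (n * n))

    Admissible : Code → Set
    Admissible c = ¬ HasShortBordered k (decodeGraph n c)

    admissible? : Decidable Admissible
    admissible? c = ¬? (hasShortBordered? k (decodeGraph n c))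

    codes : List Code
    codes = filter admissible? (allFin _)

    size : Code → ℕ
    size c = edgeCount (decodeGraph n c)

    encode-admissible : ∀ (G : OrderedGraph n) → ¬ HasShortBordered k G → Admissible (encodeGraph G)
    encode-admissible G none b = none (resp-hasShortBordered k _ G (decode-encode G) b)

    empty best : Code
    -- The default value of the maximum is itself admissible, so the maximiser is admissible in
    -- every case.
    empty = encodeGraph (emptyGraph n)
    best  = Extrema.argmax size empty codes

  -- Unfolding ex would start a search through all graphs on n vertices.
  abstract
    ex : ℕ
    ex = size best

    extremal-graph : ∃[ G ] ¬ HasShortBordered k G × edgeCount {n} G ≡ ex
    extremal-graph = decodeGraph n best ,
      Extrema.argmax-all size {P = Admissible}
        (encode-admissible (emptyGraph n) (emptyGraph-avoids k n))
        (Allₚ.all-filter admissible? (allFin _)) ,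
      refl

    ex-upper : ∀ (G : OrderedGraph n) → ¬ HasShortBordered k G → edgeCount G ≤ ex
    ex-upper G none = subst (_≤ ex)
      (edgeCount-cong (decodeGraph n (encodeGraph G)) G (decode-encode G))
      (All.lookup (Extrema.f[xs]≤f[argmax] {f = size} empty codes)
        (∈-filter⁺ admissible? (∈-allFin (encodeGraph G)) (encode-admissible G none)))

    isEx : IsEx n (𝓒ᴮ-upTo k) ex
    isEx = (let (G , none , eq) = extremal-graph in G , Equivalence.from (avoids⇔ k G) none , eq)
         , λ G avoids → ex-upper G (Equivalence.to (avoids⇔ k G) avoids)

-- Zigzags

data Step {S : Set} : List S → S → S → Set where
  here  : ∀ {x y zs} → Step (x ∷ y ∷ zs) x y
  there : ∀ {x y z zs} → Step zs x y → Step (z ∷ zs) x y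

Step-++⁺ˡ : ∀ {xs ys : List S} {u v} → Step xs u v → Step (xs ++ ys) u v
Step-++⁺ˡ here      = here
Step-++⁺ˡ (there s) = there (Step-++⁺ˡ s)

Step-++⁺ʳ : ∀ (xs : List S) {ys u v} → Step ys u v → Step (xs ++ ys) u v
Step-++⁺ʳ []       s = s
Step-++⁺ʳ (x ∷ xs) s = there (Step-++⁺ʳ xs s)

-- Both pieces keep `t`, so that the step into `t` and the step out of it each lie within one piece.
Step-split : ∀ (xs : List S) {t ys u v} → Step (xs ++ t ∷ ys) u v →
             Step (xs ++ [ t ]) u v ⊎ Step (t ∷ ys) u v
Step-split []           s         = inj₂ s
Step-split (x ∷ [])     here      = inj₁ here
Step-split (x ∷ y ∷ xs) here      = inj₁ here
Step-split (x ∷ xs)     (there s) = Sum.map₁ there (Step-split xs s)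

Step-merge : ∀ (xs : List S) {t ys u v} → Step (xs ++ [ t ]) u v ⊎ Step (t ∷ ys) u v →
             Step (xs ++ t ∷ ys) u v
Step-merge xs {t} {ys} {u} {v} (inj₁ s) =
  subst (λ zs → Step zs u v) (Listₚ.++-assoc xs [ t ] ys) (Step-++⁺ˡ s)
Step-merge xs (inj₂ s) = Step-++⁺ʳ xs s

Step-reverse : ∀ {xs : List S} {u v} → Step xs u v → Step (reverse xs) v u
Step-reverse {xs = x ∷ y ∷ zs} here = subst (λ l → Step l y x)
  (sym (trans (Listₚ.unfold-reverse x (y ∷ zs))
       (trans (cong (_++ [ x ]) (Listₚ.unfold-reverse y zs)) (Listₚ.++-assoc (reverse zs) [ y ] [ x ]))))
  (Step-++⁺ʳ (reverse zs) here)
Step-reverse {xs = z ∷ zs} {u} {v} (there s) =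
  subst (λ l → Step l v u) (sym (Listₚ.unfold-reverse z zs)) (Step-++⁺ˡ (Step-reverse s))

Step-lookup : ∀ (xs : List S) {y} i j → suc (toℕ i) ≡ toℕ j → Step (xs ++ [ y ]) (lookup xs i) (lookup xs j)
Step-lookup (x ∷ x′ ∷ xs) zero    (suc zero)    _  = here
Step-lookup (x ∷ xs)      (suc i) (suc j)       eq = there (Step-lookup xs i j (ℕₚ.suc-injective eq))

Step-last : ∀ (xs : List S) {y} i → suc (toℕ i) ≡ length xs → Step (xs ++ [ y ]) (lookup xs i) y
Step-last (x ∷ [])      zero    _  = here
Step-last (x ∷ xs)      (suc i) eq = there (Step-last xs i (ℕₚ.suc-injective eq))

Step-index : ∀ (xs : List S) {y u v} → Step (xs ++ [ y ]) u v →
  (∃[ i ] ∃[ j ] suc (toℕ i) ≡ toℕ j × lookup xs i ≡ u × lookup xs j ≡ v) ⊎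
  (∃[ i ] suc (toℕ i) ≡ length xs × lookup xs i ≡ u × y ≡ v)
Step-index []            (there ())
Step-index (x ∷ [])      here      = inj₂ (zero , refl , refl , refl)
Step-index (x ∷ x′ ∷ xs) here      = inj₁ (zero , suc zero , refl , refl , refl)
Step-index (x ∷ xs)      (there s) = Sum.map
  (λ (i , j , e , eu , ev) → suc i , suc j , cong suc e , eu , ev)
  (λ (i , e , eu , ev) → suc i , cong suc e , eu , ev)
  (Step-index xs s)

-- Repeating the first entry at the end turns cyclic succession into plain succession: the
-- wrap-around is the step into the repeated entry.
closed : ∀ {x : S} {xs} {i j} → CyclicSucc i j →
         Step (x ∷ xs ++ [ x ]) (lookup (x ∷ xs) i) (lookup (x ∷ xs) j)
closed {x = x} {xs} {i} {j} (inj₁ e) = Step-lookup (x ∷ xs) i j e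
closed {x = x} {xs} {i} {zero} (inj₂ (e , _)) = Step-last (x ∷ xs) i e

closed⁻ : ∀ {x : S} {xs} {u v} → Step (x ∷ xs ++ [ x ]) u v →
          ∃[ i ] ∃[ j ] CyclicSucc i j × lookup (x ∷ xs) i ≡ u × lookup (x ∷ xs) j ≡ v
closed⁻ {x = x} {xs} s with Step-index (x ∷ xs) s
... | inj₁ (i , j , e , eu , ev) = i , j , inj₁ e , eu , ev
... | inj₂ (i , e , eu , ev)     = i , zero , inj₂ (e , refl) , eu , ev

-- Directions, sides of a threshold, and nested paths

data Dir : Set where
  left right : Dir

data Opposite : Dir → Dir → Set where
  lr : Opposite left right
  rl : Opposite right left

opp-sym : ∀ {δ ε} → Opposite δ ε → Opposite ε δ
opp-sym lr = rl
opp-sym rl = lr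

Beyond Beyond≤ : Dir → Fin n → Fin n → Set
Beyond left  a c = c Fin.< a
Beyond right a c = a Fin.< c
Beyond≤ left  a c = c Fin.≤ a
Beyond≤ right a c = a Fin.≤ c

On : Fin n → Dir → Fin n → Set
On τ left  x = x Fin.≤ τ
On τ right x = τ Fin.< x

Beyond-irrefl : ∀ δ {a : Fin n} → ¬ Beyond δ a a
Beyond-irrefl left  = Finₚ.<-irrefl refl
Beyond-irrefl right = Finₚ.<-irrefl refl

Beyond-trans : ∀ δ {a b c : Fin n} → Beyond δ a b → Beyond δ b c → Beyond δ a c
Beyond-trans left  p q = Finₚ.<-trans q p
Beyond-trans right p q = Finₚ.<-trans p q

Beyond⇒≤ : ∀ δ {a b : Fin n} → Beyond δ a b → Beyond≤ δ a b
Beyond⇒≤ left  = ℕₚ.<⇒≤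
Beyond⇒≤ right = ℕₚ.<⇒≤

Beyond≤-refl : ∀ δ {a : Fin n} → Beyond≤ δ a a
Beyond≤-refl left  = ℕₚ.≤-refl
Beyond≤-refl right = ℕₚ.≤-refl

Beyond≤-trans : ∀ δ {a b c : Fin n} → Beyond≤ δ a b → Beyond≤ δ b c → Beyond≤ δ a c
Beyond≤-trans left  p q = ℕₚ.≤-trans q p
Beyond≤-trans right p q = ℕₚ.≤-trans p q

Beyond≤-total : ∀ δ (a b : Fin n) → Beyond≤ δ a b ⊎ Beyond≤ δ b a
Beyond≤-total left  a b = Finₚ.≤-total b a
Beyond≤-total right a b = Finₚ.≤-total a b

module _ {τ : Fin n} where

  On-beyond : ∀ δ {a c : Fin n} → On τ δ a → Beyond δ a c → On τ δ c
  On-beyond left  a≤τ c<a = ℕₚ.≤-trans (ℕₚ.<⇒≤ c<a) a≤τ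
  On-beyond right τ<a a<c = ℕₚ.<-trans τ<a a<c

  On-unique : ∀ {δ ε x} → On τ δ x → On τ ε x → δ ≡ ε
  On-unique {left}  {left}  _ _ = refl
  On-unique {right} {right} _ _ = refl
  On-unique {left}  {right} p q = contradiction p (ℕₚ.<⇒≱ q)
  On-unique {right} {left}  p q = contradiction q (ℕₚ.<⇒≱ p)

  On-opposite : ∀ {δ ε x} → Opposite δ ε → On τ δ x → ¬ On τ ε x
  On-opposite lr p q with () ← On-unique {left} {right} p q
  On-opposite rl p q with () ← On-unique {right} {left} p q

  Beyond≤-extend : ∀ {ε ζ b c y} → On τ ε b → On τ ε c → Beyond ε b c →
    (On τ ζ c → Beyond≤ ζ c y) → On τ ζ b → Beyond≤ ζ b y
  Beyond≤-extend {ε} ob oc b<c h o with refl ← On-unique ob o =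
    Beyond≤-trans ε (Beyond⇒≤ ε b<c) (h oc)

  On⇒crosses : ∀ {δ ε u v} → Opposite δ ε → On τ δ u → On τ ε v → Crosses τ u v ⊎ Crosses τ v u
  On⇒crosses lr p q = inj₁ (p , q)
  On⇒crosses rl p q = inj₂ (q , p)

-- Every new vertex lies beyond the last but one, so the edges of a zigzag are nested intervals.
data Zigzag (G : OrderedGraph n) : Dir → Dir → Fin n → Fin n → List (Fin n) → Set where
  []   : ∀ {δ ε a b} → Zigzag G δ ε a b []
  step : ∀ {δ ε a b c cs} → Adj G b c → Beyond δ a c → Zigzag G ε δ b c cs →
         Zigzag G δ ε a b (c ∷ cs)

-- Alternates with `i`, starting from `δ`. Thus `lastDir δ ε (length p)` is the side on which the
-- zigzag `p ++ [ t ]` reaches `t`, and `lastDir ε δ (length p)` is the side of the vertex before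
-- it.
lastDir : Dir → Dir → ℕ → Dir
lastDir δ ε zero    = δ
lastDir δ ε (suc i) = lastDir ε δ i

lastDir-opposite : ∀ {δ ε} i → Opposite δ ε → Opposite (lastDir δ ε i) (lastDir ε δ i)
lastDir-opposite zero    o = o
lastDir-opposite (suc i) o = lastDir-opposite i (opp-sym o)

-- Two zigzags from one root edge reach a common vertex on the same side, so their lengths have
-- equal parity. This is why the cycle they close is even.
even-sum : ∀ {δ ε} i j → Opposite δ ε → lastDir δ ε i ≡ lastDir δ ε j → ∃[ h ] i + j ≡ 2 * h
even-sum zero          zero          _  _  = 0 , refl
even-sum zero          (suc zero)    lr ()
even-sum zero          (suc zero)    rl ()
even-sum (suc zero)    zero          lr ()
even-sum (suc zero)    zero          rl ()
even-sum zero          (suc (suc j)) o  eq =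
  let (h , e) = even-sum zero j o eq in suc h , trans (cong (2 +_) e) (sym (ℕₚ.*-suc 2 h))
even-sum (suc (suc i)) zero          o  eq =
  let (h , e) = even-sum i zero o eq in suc h , trans (cong (2 +_) e) (sym (ℕₚ.*-suc 2 h))
even-sum (suc i)       (suc j)       o  eq =
  let (h , e) = even-sum i j (opp-sym o) eq in
  suc h , trans (cong suc (trans (ℕₚ.+-suc i j) (cong suc e))) (sym (ℕₚ.*-suc 2 h))

zigzag-prefix : ∀ {G : OrderedGraph n} {δ ε a b} p {t r} → Zigzag G δ ε a b (p ++ t ∷ r) → Zigzag G δ ε a b (p ++ [ t ])
zigzag-prefix []      (step e f z) = step e f []
zigzag-prefix (c ∷ p) (step e f z) = step e f (zigzag-prefix p z)

module _ {G : OrderedGraph n} {τ : Fin n} where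

  -- Follows from transitivity of `Beyond` along the alternating sides. Both the distinctness of the
  -- vertices and the extremality of the first edge rest on it.
  zigzag-sides : ∀ {δ ε a b cs} → On τ δ a → On τ ε b → Zigzag G δ ε a b cs →
    All (λ x → (On τ δ x × Beyond δ a x) ⊎ (On τ ε x × Beyond ε b x)) cs
  zigzag-sides oa ob []           = []
  zigzag-sides {δ} oa ob (step _ f z) =
    let oc = On-beyond δ oa f in
    inj₁ (oc , f) ∷
    All.map [ inj₂ , (λ (o , g) → inj₁ (o , Beyond-trans δ f g)) ]′ (zigzag-sides ob oc z)

  zigzag-unique : ∀ {δ ε a b cs} → Opposite δ ε → On τ δ a → On τ ε b → Zigzag G δ ε a b cs →
    Unique (b ∷ cs)
  zigzag-unique opp oa ob []               = [] ∷ []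
  zigzag-unique {δ} {ε} opp oa ob z@(step _ f z′) =
    All.map (λ { (inj₁ (o , _)) refl → On-opposite opp o ob
               ; (inj₂ (_ , g)) refl → Beyond-irrefl ε g }) (zigzag-sides oa ob z)
    ∷ zigzag-unique (opp-sym opp) ob (On-beyond δ oa f) z′

  zigzag-edge : ∀ {δ ε a b cs} → Opposite δ ε → On τ δ a → On τ ε b → Zigzag G δ ε a b cs →
    ∀ {u v} → Step (b ∷ cs) u v → Adj G u v × (Crosses τ u v ⊎ Crosses τ v u)
  zigzag-edge {δ} opp oa ob (step e f z) here =
    e , On⇒crosses (opp-sym opp) ob (On-beyond δ oa f)
  zigzag-edge {δ} opp oa ob (step e f z) (there s) =
    zigzag-edge (opp-sym opp) ob (On-beyond δ oa f) z s

  -- Later vertices only move outwards, so the first edge is the inner border of the zigzag taken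
  -- alone.
  zigzag-first : ∀ {δ ε a b c cs} → Opposite δ ε → On τ δ a → On τ ε b →
    Zigzag G δ ε a b (c ∷ cs) → On τ δ c × Beyond δ a c ×
    All (λ x → (On τ δ x → Beyond≤ δ c x) × (On τ ε x → Beyond≤ ε b x)) (b ∷ c ∷ cs)
  zigzag-first {δ} {ε} opp oa ob (step e f z) =
    let oc = On-beyond δ oa f in
    oc , f ,
    ((λ o → contradiction ob (On-opposite opp o)) , (λ _ → Beyond≤-refl ε)) ∷
    ((λ _ → Beyond≤-refl δ) , (λ o → contradiction o (On-opposite opp oc))) ∷
    All.map [ (λ (o , g) → (λ o′ → contradiction o (On-opposite opp o′)) , (λ _ → Beyond⇒≤ ε g))
            , (λ (o , g) → (λ _ → Beyond⇒≤ δ g) , (λ o′ → contradiction o′ (On-opposite opp o))) ]′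
      (zigzag-sides ob oc z)

  zigzag-head : ∀ {δ ε a b} p {t} → Opposite δ ε → On τ δ a → On τ ε b →
    Zigzag G δ ε a b (p ++ [ t ]) →
    ∃[ c ] c ∈ p ++ [ t ] × On τ δ c × Beyond δ a c × Step (b ∷ p ++ [ t ]) b c ×
           All (λ x → (On τ δ x → Beyond≤ δ c x) × (On τ ε x → Beyond≤ ε b x)) (b ∷ p ++ [ t ])
  zigzag-head []      opp oa ob z =
    let (o , f , e) = zigzag-first opp oa ob z in _ , here refl , o , f , here , e
  zigzag-head (c ∷ p) opp oa ob z =
    let (o , f , e) = zigzag-first opp oa ob z in _ , here refl , o , f , here , e

  -- The last edge is the outer border of the zigzag taken alone. The induction hypothesis covers
  -- every vertex but the start `b`; the next vertex `c′` on the side of `b` lies beyond `b` and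
  -- passes its own bounds on to it.
  zigzag-last : ∀ {δ ε a b} p {t} → Opposite δ ε → On τ δ a → On τ ε b →
    Zigzag G δ ε a b (p ++ [ t ]) →
    let ζ = lastDir δ ε (length p); η = lastDir ε δ (length p) in
    ∃[ y ] On τ ζ t × On τ η y × Step (b ∷ p ++ [ t ]) y t ×
           All (λ x → (On τ ζ x → Beyond≤ ζ x t) × (On τ η x → Beyond≤ η x y)) (b ∷ p ++ [ t ])
  zigzag-last {δ} {ε} {b = b} [] opp oa ob (step e f []) =
    let ot = On-beyond δ oa f in
    b , ot , ob , here ,
    ((λ o → contradiction ob (On-opposite opp o)) , (λ _ → Beyond≤-refl ε)) ∷
    ((λ _ → Beyond≤-refl δ) , (λ o → contradiction o (On-opposite opp ot))) ∷ []
  zigzag-last {δ} {ε} (c ∷ p) opp oa ob (step e f z) =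
    let oc                          = On-beyond δ oa f
        (y , ot , oy , s , extreme) = zigzag-last p (opp-sym opp) ob oc z
        (c′ , c′∈ , oc′ , b<c′ , _) = zigzag-head p (opp-sym opp) ob oc z
        (ζ-c′ , η-c′)               = All.lookup extreme (there c′∈)
    in
    y , ot , oy , there s ,
    (Beyond≤-extend ob oc′ b<c′ ζ-c′ , Beyond≤-extend ob oc′ b<c′ η-c′) ∷ extreme

-- Cycles closed by two zigzags

lastFrom : S → List S → S
lastFrom x []       = x
lastFrom x (y ∷ ys) = lastFrom y ys

lastFrom-∈ : ∀ (x : S) ys → lastFrom x ys ∈ x ∷ ys
lastFrom-∈ x []       = here refl
lastFrom-∈ x (y ∷ ys) = there (lastFrom-∈ y ys)

-- Stopping at the first entry of `cs` that occurs in `ds` leaves a prefix disjoint from all of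
-- `ds`, which makes the closed loop a simple cycle.
first-common : ∀ {cs ds : List (Fin n)} → Any (_∈ ds) cs →
  ∃[ p ] ∃[ t ] ∃[ r ] cs ≡ p ++ t ∷ r × All (_∉ ds) p × t ∈ ds
first-common {cs = c ∷ cs} {ds = ds} any with Any.any? (c Finₚ.≟_) ds
... | yes c∈ds = [] , c , cs , refl , [] , c∈ds
first-common {cs = c ∷ cs} (here c∈ds) | no c∉ds = contradiction c∈ds c∉ds
first-common {cs = c ∷ cs} (there any) | no c∉ds =
  let (p , t , r , eq , p∉ , t∈) = first-common any in
  c ∷ p , t , r , cong (c ∷_) eq , c∉ds ∷ p∉ , t∈

Unique-reverse : ∀ {xs : List S} → Unique xs → Unique (reverse xs)
Unique-reverse []                          = []
Unique-reverse {xs = x ∷ xs} (x∉ ∷ u) = subst Unique (sym (Listₚ.unfold-reverse x xs))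
  (Uniqueₚ.++⁺ (Unique-reverse u) ([] ∷ [])
    λ { (x∈ , here refl) → All.lookup x∉ (Anyₚ.reverse⁻ x∈) refl })

lookup-injective : ∀ {xs : List S} → Unique xs → ∀ i j → lookup xs i ≡ lookup xs j → i ≡ j
lookup-injective (x∉ ∷ u) zero    zero    eq = refl
lookup-injective (x∉ ∷ u) zero    (suc j) eq = contradiction eq (All.lookup x∉ (∈-lookup j))
lookup-injective (x∉ ∷ u) (suc i) zero    eq = contradiction (sym eq) (All.lookup x∉ (∈-lookup i))
lookup-injective (x∉ ∷ u) (suc i) (suc j) eq = cong suc (lookup-injective u i j eq)

Unique-prefix : ∀ (xs : List S) {t ys} → Unique (xs ++ t ∷ ys) → Unique xs × t ∉ xs
Unique-prefix []       u       = [] , λ ()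
Unique-prefix (x ∷ xs) {t} (x∉ ∷ u) =
  let (uxs , t∉) = Unique-prefix xs u in
  Allₚ.++⁻ˡ xs x∉ ∷ uxs ,
  λ { (here refl) → All.lookup x∉ (∈-insert xs) refl ; (there t∈) → t∉ t∈ }

module _ {G : OrderedGraph n} {τ : Fin n} {δ ε : Dir} {a b : Fin n} (opp : Opposite δ ε)
         (oa : On τ δ a) (ob : On τ ε b) {p q : List (Fin n)} {t : Fin n}
         (zp : Zigzag G δ ε a b (p ++ [ t ])) (zq : Zigzag G δ ε a b (q ++ [ t ]))
         (p∉q : All (_∉ q ++ [ t ]) p) where

  private
    -- Out along `p` to `t` and back along `q`; the shared vertices `b` and `t` are listed once.
    loop : List (Fin n)
    loop = b ∷ p ++ t ∷ reverse q

    w : Fin (length loop) → Fin n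
    w = lookup loop

    closing : reverse (b ∷ q ++ [ t ]) ≡ t ∷ reverse q ++ [ b ]
    closing = trans (Listₚ.unfold-reverse b (q ++ [ t ])) (cong (_++ [ b ]) (Listₚ.reverse-++ q [ t ]))

    closed-loop : loop ++ [ b ] ≡ b ∷ p ++ t ∷ reverse q ++ [ b ]
    closed-loop = cong (b ∷_) (Listₚ.++-assoc p (t ∷ reverse q) [ b ])

    step⁻ : ∀ {u v} → Step (loop ++ [ b ]) u v → Step (b ∷ p ++ [ t ]) u v ⊎ Step (b ∷ q ++ [ t ]) v u
    step⁻ {u} {v} s = Sum.map₂
      (λ s′ → subst (λ l → Step l v u)
                (trans (cong reverse (sym closing)) (Listₚ.reverse-involutive (b ∷ q ++ [ t ])))
                (Step-reverse s′))
      (Step-split (b ∷ p) (subst (λ l → Step l u v) closed-loop s))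

    step⁺ : ∀ {u v} → Step (b ∷ p ++ [ t ]) u v ⊎ Step (b ∷ q ++ [ t ]) v u → Step (loop ++ [ b ]) u v
    step⁺ {u} {v} s = subst (λ l → Step l u v) (sym closed-loop)
      (Step-merge (b ∷ p) (Sum.map₂ (λ s′ → subst (λ l → Step l u v) closing (Step-reverse s′)) s))

    from-reverse : ∀ {x} → x ∈ reverse q → x ∈ q
    from-reverse = Anyₚ.reverse⁻ {xs = q}

    on-path : ∀ {x} → x ∈ loop → x ∈ b ∷ p ++ [ t ] ⊎ x ∈ b ∷ q ++ [ t ]
    on-path (here refl) = inj₁ (here refl)
    on-path (there x∈) with ∈-++⁻ p x∈
    ... | inj₁ x∈p           = inj₁ (there (∈-++⁺ˡ x∈p))
    ... | inj₂ (here refl)   = inj₁ (there (∈-insert p))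
    ... | inj₂ (there x∈q)   = inj₂ (there (∈-++⁺ˡ (from-reverse x∈q)))

    loop-unique : Unique loop
    loop-unique with zigzag-unique opp oa ob zp | zigzag-unique opp oa ob zq
    ... | b∉pt ∷ upt | b∉qt ∷ uqt =
      let (up , t∉p) = Unique-prefix p upt
          (uq , t∉q) = Unique-prefix q uqt
      in
      Allₚ.++⁺ (Allₚ.++⁻ˡ p b∉pt) (All.lookup b∉pt (∈-insert p) ∷
        All.tabulate (λ x∈ → All.lookup b∉qt (∈-++⁺ˡ (from-reverse x∈))))
      ∷ Uniqueₚ.++⁺ up
          (All.tabulate (λ x∈ eq → t∉q (subst (_∈ q) (sym eq) (from-reverse x∈)))
            ∷ Unique-reverse uq)
          (λ { (x∈p , here refl) → t∉p x∈p
             ; (x∈p , there x∈q) → All.lookup p∉q x∈p (∈-++⁺ˡ (from-reverse x∈q)) })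

    adjacent : ∀ {u v} → Step (b ∷ p ++ [ t ]) u v ⊎ Step (b ∷ q ++ [ t ]) u v →
      ∃[ i ] ∃[ j ] CyclicAdj i j × w i ≡ u × w j ≡ v
    adjacent (inj₁ s) = let (i , j , c , ei , ej) = closed⁻ (step⁺ (inj₁ s)) in i , j , inj₁ c , ei , ej
    adjacent (inj₂ s) = let (i , j , c , ei , ej) = closed⁻ (step⁺ (inj₂ s)) in j , i , inj₂ c , ej , ei

    inner⁺ : ∀ {ζ η u v} → Opposite ζ η → On τ ζ u → On τ η v →
      ∃[ i ] ∃[ j ] CyclicAdj i j × w i ≡ u × w j ≡ v →
      (∀ {x} → x ∈ loop → (On τ ζ x → Beyond≤ ζ u x) × (On τ η x → Beyond≤ η v x)) →
      ∃[ i ] ∃[ j ] IsInner τ w i j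
    inner⁺ lr ou ov (i , j , c , refl , refl) e = i , j , mkInner c (ou , ov) λ k → e (∈-lookup k)
    inner⁺ rl ou ov (i , j , c , refl , refl) e =
      j , i , mkInner (Sum.swap c) (ov , ou) λ k → Product.swap (e (∈-lookup k))

    outer⁺ : ∀ {ζ η u v} → Opposite ζ η → On τ ζ u → On τ η v →
      ∃[ i ] ∃[ j ] CyclicAdj i j × w i ≡ u × w j ≡ v →
      (∀ {x} → x ∈ loop → (On τ ζ x → Beyond≤ ζ x u) × (On τ η x → Beyond≤ η x v)) →
      ∃[ i ] ∃[ j ] IsOuter τ w i j
    outer⁺ lr ou ov (i , j , c , refl , refl) e = i , j , mkOuter c (ou , ov) λ k → e (∈-lookup k)
    outer⁺ rl ou ov (i , j , c , refl , refl) e =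
      j , i , mkOuter (Sum.swap c) (ov , ou) λ k → Product.swap (e (∈-lookup k))

    inner : ∃[ i ] ∃[ j ] IsInner τ w i j
    inner with zigzag-head p opp oa ob zp | zigzag-head q opp oa ob zq
    ... | c , _ , oc , _ , s , e | c′ , _ , oc′ , _ , s′ , e′ with Beyond≤-total δ c c′
    ... | inj₁ c≤c′ = inner⁺ (opp-sym opp) ob oc (adjacent (inj₁ s)) λ x∈ → Product.swap
      ([ All.lookup e
       , (λ x∈ → Product.map₁ (Beyond≤-trans δ c≤c′ ∘_) (All.lookup e′ x∈)) ]′ (on-path x∈))
    ... | inj₂ c′≤c = inner⁺ (opp-sym opp) ob oc′ (adjacent (inj₂ s′)) λ x∈ → Product.swap
      ([ (λ x∈ → Product.map₁ (Beyond≤-trans δ c′≤c ∘_) (All.lookup e x∈))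
       , All.lookup e′ ]′ (on-path x∈))

    ends : lastDir δ ε (length p) ≡ lastDir δ ε (length q)
    ends with zigzag-last p opp oa ob zp | zigzag-last q opp oa ob zq
    ... | _ , ot , _ | _ , ot′ , _ = On-unique ot ot′

    outer : ∃[ i ] ∃[ j ] IsOuter τ w i j
    outer with zigzag-last p opp oa ob zp | zigzag-last q opp oa ob zq
    ... | y , ot , oy , s , e | y′ , ot′ , oy′ , s′ , e′ = go _ _ ζ≡ η≡ ot′ oy′ s′ e′
      where
      ζ = lastDir δ ε (length p)
      η = lastDir ε δ (length p)
      ζη : Opposite ζ η
      ζη = lastDir-opposite (length p) opp
      ζ≡ : ζ ≡ lastDir δ ε (length q)
      ζ≡ = On-unique ot ot′
      η≡ : η ≡ lastDir ε δ (length q)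
      η≡ = opposite-unique (subst (λ d → Opposite d η) ζ≡ ζη) (lastDir-opposite (length q) opp)
        where
        opposite-unique : ∀ {α β γ} → Opposite α β → Opposite α γ → β ≡ γ
        opposite-unique lr lr = refl
        opposite-unique rl rl = refl
      -- The side of `t` is computed from `length p` for one zigzag and from `length q` for the
      -- other. Here the latter is a variable, so that the two can be identified by matching.
      go : ∀ ζ′ η′ → ζ ≡ ζ′ → η ≡ η′ → On τ ζ′ t → On τ η′ y′ → Step (b ∷ q ++ [ t ]) y′ t →
        All (λ x → (On τ ζ′ x → Beyond≤ ζ′ x t) × (On τ η′ x → Beyond≤ η′ x y′)) (b ∷ q ++ [ t ]) →
        ∃[ i ] ∃[ j ] IsOuter τ w i j
      go _ _ refl refl ot′ oy′ s′ e′ with Beyond≤-total η y y′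
      ... | inj₂ y′≤y = outer⁺ (opp-sym ζη) oy ot (adjacent (inj₁ s)) λ x∈ → Product.swap
        ([ All.lookup e
         , (λ x∈ → Product.map₂ (λ h o → Beyond≤-trans η (h o) y′≤y) (All.lookup e′ x∈)) ]′ (on-path x∈))
      ... | inj₁ y≤y′ = outer⁺ (opp-sym ζη) oy′ ot′ (adjacent (inj₂ s′)) λ x∈ → Product.swap
        ([ (λ x∈ → Product.map₂ (λ h o → Beyond≤-trans η (h o) y≤y′) (All.lookup e x∈))
         , All.lookup e′ ]′ (on-path x∈))

    Adj-sym : ∀ {u v} → Adj G u v → Adj G v u
    Adj-sym {u} {v} = subst T (OrderedGraph.sym G u v)

  loop-trace : BorderedTrace G τ w
  loop-trace = mkTrace
    (λ i j → lookup-injective loop-unique i j)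
    (λ i j c → [ zigzag-edge opp oa ob zp
               , (λ s → Product.map Adj-sym Sum.swap (zigzag-edge opp oa ob zq s)) ]′
               (step⁻ (closed {i = i} {j} c)))
    inner outer

  loop-length : length loop ≡ 2 + (length p + length q)
  loop-length = cong suc (begin
    length (p ++ t ∷ reverse q)         ≡⟨ Listₚ.length-++ p ⟩
    length p + suc (length (reverse q)) ≡⟨ ℕₚ.+-suc (length p) _ ⟩
    suc (length p + length (reverse q)) ≡⟨ cong (λ l → suc (length p + l)) (Listₚ.length-reverse q) ⟩
    suc (length p + length q)           ∎)
    where open ≡-Reasoning

  -- The loop has `2 + (length p + length q)` vertices. Parity makes this even, positivity then
  -- makes it at least 4, and the bounds by `k` make it at most `2 * k`.
  meeting-zigzags⇒bordered : 1 ≤ length p + length q → length p < k → length q < k → HasShortBordered k G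
  meeting-zigzags⇒bordered {k} 1≤ p<k q<k with even-sum (length p) (length q) opp ends
  ... | h , eq = suc h , s≤s (half eq 1≤) , ℕₚ.*-cancelˡ-≤ 2 bound ,
    subst (Bordered G) (trans loop-length 2+) (τ , w , loop-trace)
    where
    2+ : 2 + (length p + length q) ≡ 2 * suc h
    2+ = trans (cong (2 +_) eq) (sym (ℕₚ.*-suc 2 h))
    half : ∀ {s h} → s ≡ 2 * h → 1 ≤ s → 1 ≤ h
    half {h = zero}  refl ()
    half {h = suc h} _    _ = s≤s z≤n
    bound : 2 * suc h ≤ 2 * k
    bound = begin
      2 * suc h                         ≡⟨ 2+ ⟨
      2 + (length p + length q)         ≡⟨ cong suc (ℕₚ.+-suc (length p) (length q)) ⟨
      suc (length p) + suc (length q)   ≤⟨ ℕₚ.+-mono-≤ p<k q<k ⟩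
      k + k                             ≡⟨ cong (k +_) (ℕₚ.+-identityʳ k) ⟨
      2 * k                             ∎
      where open ℕₚ.≤-Reasoning

-- The equal ends guarantee a first common vertex `t`. The prefixes before `t` are not both empty,
-- since otherwise `t` would be both `c` and `c′`.
diverging-zigzags⇒bordered : ∀ {G : OrderedGraph n} {τ δ ε a b c c′ cs cs′} → Opposite δ ε →
  On τ δ a → On τ ε b → Zigzag G δ ε a b (c ∷ cs) → Zigzag G δ ε a b (c′ ∷ cs′) → c ≢ c′ →
  lastFrom c cs ≡ lastFrom c′ cs′ → length cs < k → length cs′ < k → HasShortBordered k G
diverging-zigzags⇒bordered {G = G} {δ = δ} {ε} {a} {b} {c} {c′} {cs} {cs′} opp oa ob z z′ c≢c′ same l<k l′<k
  with p , t , r , eq , p∉ , t∈ ← first-common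
         (Any.map (λ { refl → subst (_∈ c′ ∷ cs′) (sym same) (lastFrom-∈ c′ cs′) }) (lastFrom-∈ c cs))
  with q , r′ , eq′ ← ∈-∃++ t∈
  = meeting-zigzags⇒bordered opp oa ob
      (zigzag-prefix p (subst (Zigzag G δ ε a b) eq z))
      (zigzag-prefix q (subst (Zigzag G δ ε a b) eq′ z′))
      (All.map (λ x∉ x∈ → x∉ (subst (_ ∈_) (sym eq′) (widen q x∈))) p∉)
      (nontrivial p q eq eq′)
      (ℕₚ.≤-trans (shorter p eq) l<k) (ℕₚ.≤-trans (shorter q eq′) l′<k)
  where
  widen : ∀ q {r x t} → x ∈ q ++ [ t ] → x ∈ q ++ t ∷ r
  widen q x∈ with ∈-++⁻ q x∈
  ... | inj₁ x∈q         = ∈-++⁺ˡ x∈q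
  ... | inj₂ (here refl) = ∈-insert q
  nontrivial : ∀ p q {t r r′} → c ∷ cs ≡ p ++ t ∷ r → c′ ∷ cs′ ≡ q ++ t ∷ r′ → 1 ≤ length p + length q
  nontrivial []      []      refl refl = contradiction refl c≢c′
  nontrivial []      (_ ∷ _) _    _    = s≤s z≤n
  nontrivial (_ ∷ _) _       _    _    = s≤s z≤n
  shorter : ∀ p {c : Fin _} {cs t r} → c ∷ cs ≡ p ++ t ∷ r → suc (length p) ≤ suc (length cs)
  shorter p {t = t} {r} e = subst (suc (length p) ≤_) (sym (cong length e))
    (subst (suc (length p) ≤_) (sym (trans (Listₚ.length-++ p) (ℕₚ.+-suc (length p) (length r))))
      (s≤s (ℕₚ.m≤m+n (length p) (length r))))

-- Only the children of one node are required to differ. Vertices of different subtrees may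
-- coincide, and `d ^ i` counts branches rather than vertices.
data Tree (G : OrderedGraph n) (d : ℕ) : ℕ → Dir → Dir → Fin n → Fin n → Set where
  leaf : ∀ {δ ε a b} → Tree G d zero δ ε a b
  node : ∀ {i δ ε a b} (next : Fin d → Fin n) → Injective _≡_ _≡_ next →
         (∀ x → Adj G b (next x)) → (∀ x → Beyond δ a (next x)) →
         (∀ x → Tree G d i ε δ b (next x)) → Tree G d (suc i) δ ε a b

module _ {G : OrderedGraph n} {d : ℕ} where

  branch : ∀ {i δ ε a b} → Tree G d i δ ε a b → Fin (d ^ i) → List (Fin n)
  branch leaf                       c = []
  branch (node {i} next _ _ _ sub) c =
    let (x , c′) = remQuot {d} (d ^ i) c in next x ∷ branch (sub x) c′

  branch-zigzag : ∀ {i δ ε a b} (T : Tree G d i δ ε a b) c → Zigzag G δ ε a b (branch T c)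
  branch-zigzag leaf                             c = []
  branch-zigzag (node {i} next _ adj further sub) c =
    let (x , c′) = remQuot {d} (d ^ i) c in step (adj x) (further x) (branch-zigzag (sub x) c′)

  branch-length : ∀ {i δ ε a b} (T : Tree G d i δ ε a b) c → length (branch T c) ≡ i
  branch-length leaf                       c = refl
  branch-length (node {i} next _ _ _ sub) c =
    let (x , c′) = remQuot {d} (d ^ i) c in cong suc (branch-length (sub x) c′)

  -- The descent follows the two branches while they agree. Where they part, the last common edge
  -- takes the role of the root edge.
  merging-branches⇒bordered : ∀ {i δ ε a b τ} (T : Tree G d i δ ε a b) c c′ → Opposite δ ε →
    On τ δ a → On τ ε b → i ≤ k → c ≢ c′ → lastFrom b (branch T c) ≡ lastFrom b (branch T c′) →
    HasShortBordered k G
  merging-branches⇒bordered leaf zero zero _ _ _ _ c≢c′ _ = contradiction refl c≢c′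
  merging-branches⇒bordered {k = k} {δ = δ} (node {i} next next-inj adj further sub) c c′ opp oa ob i<k c≢c′ =
    go (remQuot {d} (d ^ i) c) (remQuot {d} (d ^ i) c′)
      (λ e → c≢c′ (trans (sym (Finₚ.combine-remQuot {d} (d ^ i) c))
        (trans (cong (λ (x , y) → combine x y) e) (Finₚ.combine-remQuot {d} (d ^ i) c′))))
    where
    go : ∀ ((x , y) (x′ , y′) : Fin d × Fin (d ^ i)) → (x , y) ≢ (x′ , y′) →
      lastFrom (next x) (branch (sub x) y) ≡ lastFrom (next x′) (branch (sub x′) y′) →
      HasShortBordered k G
    go (x , y) (x′ , y′) xy≢ same with x Finₚ.≟ x′
    ... | yes refl = merging-branches⇒bordered (sub x) y y′ (opp-sym opp) ob
      (On-beyond δ oa (further x)) (ℕₚ.<⇒≤ i<k) (λ { refl → xy≢ refl }) same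
    ... | no x≢x′ = diverging-zigzags⇒bordered opp oa ob
      (step (adj x) (further x) (branch-zigzag (sub x) y))
      (step (adj x′) (further x′) (branch-zigzag (sub x′) y′))
      (λ e → x≢x′ (next-inj e)) same
      (subst (_< k) (sym (branch-length (sub x) y)) i<k)
      (subst (_< k) (sym (branch-length (sub x′) y′)) i<k)

  tree⇒bordered : ∀ {δ ε a b τ} → Tree G d k δ ε a b → Opposite δ ε → On τ δ a → On τ ε b →
    n < d ^ k → HasShortBordered k G
  tree⇒bordered {b = b} T opp oa ob n<dᵏ
    with c , c′ , c<c′ , same ← Finₚ.pigeonhole n<dᵏ (λ c → lastFrom b (branch T c))
    = merging-branches⇒bordered T c c′ opp oa ob ℕₚ.≤-refl (λ e → Finₚ.<-irrefl e c<c′) same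

-- The upper bound on the number of edges

length-filter-∷ : ∀ {P : Pred S _} (P? : Decidable P) x xs →
  length (filter P? (x ∷ xs)) ≡ 𝟙 (P? x) + length (filter P? xs)
length-filter-∷ P? x xs with P? x
... | yes _ = refl
... | no _  = refl

length-filter-tabulate : ∀ {P : Pred S _} (P? : Decidable P) (f : Fin n → S) →
  length (filter P? (tabulate f)) ≡ sum (λ i → 𝟙 (P? (f i)))
length-filter-tabulate {n = zero}  P? f = refl
length-filter-tabulate {n = suc n} P? f =
  trans (length-filter-∷ P? (f zero) _) (cong (𝟙 (P? (f zero)) +_) (length-filter-tabulate P? (f ∘ suc)))

length-filter-product : ∀ {P : Pred (S × S) _} (P? : Decidable P) (f : Fin m → S) (g : Fin n → S) →
  length (filter P? (cartesianProduct (tabulate f) (tabulate g))) ≡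
  sum (λ i → sum (λ j → 𝟙 (P? (f i , g j))))
length-filter-product {m = zero}  P? f g = refl
length-filter-product {m = suc m} P? f g = begin
  length (filter P? (List.map (f zero ,_) (tabulate g) ++ rest))
    ≡⟨ cong length (Listₚ.filter-++ P? (List.map (f zero ,_) (tabulate g)) rest) ⟩
  length (filter P? (List.map (f zero ,_) (tabulate g)) ++ filter P? rest)
    ≡⟨ Listₚ.length-++ (filter P? (List.map (f zero ,_) (tabulate g))) ⟩
  length (filter P? (List.map (f zero ,_) (tabulate g))) + length (filter P? rest)
    ≡⟨ cong₂ _+_
         (trans (cong (length ∘ filter P?) (Listₚ.map-tabulate g (f zero ,_)))
                (length-filter-tabulate P? ((f zero ,_) ∘ g)))
         (length-filter-product P? (f ∘ suc) g) ⟩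
  sum (λ i → sum (λ j → 𝟙 (P? (f i , g j)))) ∎
  where
  open ≡-Reasoning
  rest = cartesianProduct (tabulate (f ∘ suc)) (tabulate g)

choose : ∀ {P : Pred (Fin n) _} (P? : Decidable P) → d ≤ sum (𝟙 ∘ P?) →
  Σ[ f ∈ (Fin d → Fin n) ] Injective _≡_ _≡_ f × (∀ x → P (f x))
choose {d = zero} P? _ = (λ ()) , (λ { {()} }) , λ ()
choose {suc n} {suc d} P? d≤ with P? zero
... | no _ = let (f , inj , Pf) = choose (P? ∘ suc) d≤ in
  suc ∘ f , inj ∘ Finₚ.suc-injective , Pf
... | yes P0 = let (f , inj , Pf) = choose (P? ∘ suc) (ℕₚ.≤-pred d≤) in
  (λ { zero → zero ; (suc x) → suc (f x) }) ,
  (λ { {zero} {zero} _ → refl ; {suc _} {suc _} e → cong suc (inj (Finₚ.suc-injective e)) }) ,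
  (λ { zero → P0 ; (suc x) → Pf x })

beyond? : ∀ δ (a c : Fin n) → Dec (Beyond δ a c)
beyond? left  a c = c Finₚ.<? a
beyond? right a c = a Finₚ.<? c

beyondCount : Dir → {P : Pred (Fin n) _} → Decidable P → Fin n → ℕ
beyondCount δ P? a = sum (λ c → 𝟙 (beyond? δ a c ×-dec P? c))

-- Everything counted is among the `d` outermost elements of `P`. The induction removes vertex 0. On
-- the left it is the outermost one: if in `P`, it uses up one unit of `d` and raises every other
-- count by one. On the right it is the innermost one: if it is counted, fewer than `d` elements of
-- `P` lie beyond it, and these include all the others that are counted.
few-outermost : ∀ δ {P : Pred (Fin n) _} (P? : Decidable P) d →
  sum (λ a → 𝟙 (P? a ×-dec (beyondCount δ P? a ℕ.<? d))) ≤ d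
few-outermost {zero}  δ     P? d = z≤n
few-outermost {suc n} left  P? zero = ℕₚ.≤-trans
  (sum-mono-≤ (λ a → 𝟙-mono (P? a ×-dec (beyondCount left P? a ℕ.<? 0)) (0 ℕ.<? 0) λ ()))
  (ℕₚ.≤-reflexive (trans (sum-const (suc n) 0) (ℕₚ.*-zeroʳ n)))
few-outermost {suc n} left  {P} P? (suc d) = go (P? zero)
  where
  head : ℕ
  head = 𝟙 (P? zero ×-dec (beyondCount left P? zero ℕ.<? suc d))
  shift : ∀ a → beyondCount left (P? ∘ suc) a ≤
                sum (λ c → 𝟙 ((suc c Finₚ.<? suc a) ×-dec P? (suc c)))
  shift a = sum-mono-≤ (λ c → 𝟙-mono ((c Finₚ.<? a) ×-dec P? (suc c)) ((suc c Finₚ.<? suc a) ×-dec P? (suc c))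
    (λ (lt , p) → s≤s lt , p))
  go : Dec (P zero) → head + sum (λ a → 𝟙 (P? (suc a) ×-dec (beyondCount left P? (suc a) ℕ.<? suc d))) ≤ suc d
  go (yes P0) = ℕₚ.+-mono-≤ (𝟙≤1 (P? zero ×-dec (beyondCount left P? zero ℕ.<? suc d))) (ℕₚ.≤-trans
    (sum-mono-≤ (λ a → 𝟙-mono
      (P? (suc a) ×-dec (beyondCount left P? (suc a) ℕ.<? suc d))
      (P? (suc a) ×-dec (beyondCount left (P? ∘ suc) a ℕ.<? d))
      (λ (p , lt) → p , ℕₚ.≤-pred (ℕₚ.≤-trans (s≤s (more a)) lt))))
    (few-outermost left (P? ∘ suc) d))
    where
    more : ∀ a → suc (beyondCount left (P? ∘ suc) a) ≤ beyondCount left P? (suc a)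
    more a = ℕₚ.+-mono-≤ {1}
      (𝟙-mono (yes P0) ((zero {n} Finₚ.<? suc a) ×-dec P? zero) (λ p → s≤s z≤n , p)) (shift a)
  go (no ¬P0) = ℕₚ.+-mono-≤ {y = 0}
    (𝟙-mono (P? zero ×-dec (beyondCount left P? zero ℕ.<? suc d)) (0 ℕ.<? 0) (λ (p , _) → contradiction p ¬P0))
    (ℕₚ.≤-trans
      (sum-mono-≤ (λ a → 𝟙-mono
        (P? (suc a) ×-dec (beyondCount left P? (suc a) ℕ.<? suc d))
        (P? (suc a) ×-dec (beyondCount left (P? ∘ suc) a ℕ.<? suc d))
        (λ (p , lt) → p , ℕₚ.≤-trans (s≤s (ℕₚ.≤-trans (shift a) (ℕₚ.m≤n+m _ _))) lt)))
      (few-outermost left (P? ∘ suc) (suc d)))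
few-outermost {suc n} right {P} P? d = go (beyondCount right P? zero ℕ.<? d)
  where
  tail : ℕ
  tail = sum (λ a → 𝟙 (P? (suc a) ×-dec (beyondCount right P? (suc a) ℕ.<? d)))
  shift : ∀ a → beyondCount right (P? ∘ suc) a ≤ beyondCount right P? (suc a)
  shift a = ℕₚ.≤-trans
    (sum-mono-≤ (λ c → 𝟙-mono ((a Finₚ.<? c) ×-dec P? (suc c)) ((suc a Finₚ.<? suc c) ×-dec P? (suc c))
      (λ (lt , p) → s≤s lt , p)))
    (ℕₚ.m≤n+m _ _)
  tail≤d : tail ≤ d
  tail≤d = ℕₚ.≤-trans
    (sum-mono-≤ (λ a → 𝟙-mono
      (P? (suc a) ×-dec (beyondCount right P? (suc a) ℕ.<? d))
      (P? (suc a) ×-dec (beyondCount right (P? ∘ suc) a ℕ.<? d))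
      (λ (p , lt) → p , ℕₚ.≤-trans (s≤s (shift a)) lt)))
    (few-outermost right (P? ∘ suc) d)
  tail≤count : tail ≤ beyondCount right P? zero
  tail≤count = ℕₚ.≤-trans
    (sum-mono-≤ (λ a → 𝟙-mono
      (P? (suc a) ×-dec (beyondCount right P? (suc a) ℕ.<? d))
      ((zero {suc n} Finₚ.<? suc a) ×-dec P? (suc a))
      (λ (p , _) → s≤s z≤n , p)))
    (ℕₚ.m≤n+m _ _)
  go : Dec (beyondCount right P? zero < d) →
       𝟙 (P? zero ×-dec (beyondCount right P? zero ℕ.<? d)) + tail ≤ d
  go (yes lt) = ℕₚ.≤-trans (ℕₚ.+-mono-≤ (𝟙≤1 (P? zero ×-dec (beyondCount right P? zero ℕ.<? d))) tail≤count) lt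
  go (no ≮d)  = ℕₚ.+-mono-≤ {y = 0}
    (𝟙-mono (P? zero ×-dec (beyondCount right P? zero ℕ.<? d)) (0 ℕ.<? 0) (λ (_ , lt) → contradiction lt ≮d))
    tail≤d

module _ (G : OrderedGraph n) (d : ℕ) where

  mutual
    -- The edges left after `i` rounds. An edge can be continued from either end: from `v` to some
    -- `x` left of `u`, or from `u` to some `x` right of `v`. The continuing edges must have
    -- survived the earlier rounds themselves, so that trees can grow from them.
    Level : ℕ → Fin n → Fin n → Set
    Level zero    u v = u Fin.< v × Adj G u v
    Level (suc i) u v = Level i u v × d ≤ beyondCount left (λ x → level? i x v) u
                                    × d ≤ beyondCount right (level? i u) v

    level? : ∀ i u v → Dec (Level i u v)
    level? zero    u v = (u Finₚ.<? v) ×-dec T? (OrderedGraph.adj G u v)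
    level? (suc i) u v = level? i u v ×-dec (d ℕ.≤? beyondCount left (λ x → level? i x v) u)
                                      ×-dec (d ℕ.≤? beyondCount right (level? i u) v)

  Level⇒edge : ∀ i {u v} → Level i u v → u Fin.< v × Adj G u v
  Level⇒edge zero    e       = e
  Level⇒edge (suc i) (e , _) = Level⇒edge i e

  -- Both orientations are built together, because a continuation to the left is in turn continued
  -- to the right and conversely.
  Level⇒trees : ∀ i {u v} → Level i u v → Tree G d i left right u v × Tree G d i right left v u
  Level⇒trees zero    _                 = leaf , leaf
  Level⇒trees (suc i) {u} {v} (_ , manyˡ , manyʳ) =
    (let (next , inj , ok) = choose (λ x → beyond? left u x ×-dec level? i x v) manyˡ in
     node next inj
       (λ x → subst T (OrderedGraph.sym G (next x) v) (proj₂ (Level⇒edge i (proj₂ (ok x)))))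
       (proj₁ ∘ ok) (λ x → proj₂ (Level⇒trees i (proj₂ (ok x))))) ,
    (let (next , inj , ok) = choose (λ x → beyond? right v x ×-dec level? i u x) manyʳ in
     node next inj (λ x → proj₂ (Level⇒edge i (proj₂ (ok x))))
       (proj₁ ∘ ok) (λ x → proj₁ (Level⇒trees i (proj₂ (ok x)))))

  size : ℕ → ℕ
  size i = sum (λ u → sum (λ v → 𝟙 (level? i u v)))

  edgeCount≡size : edgeCount G ≡ size 0
  edgeCount≡size = length-filter-product (λ (u , v) → level? 0 u v) id id

  size-step : ∀ i → size i ≤ size (suc i) + (n * d + n * d)
  size-step i = begin
    size i
      ≤⟨ sum-mono-≤ (λ u → sum-mono-≤ (λ v → survives-or-fails u v)) ⟩
    sum (λ u → sum (λ v → 𝟙 (level? (suc i) u v) + (failsˡ u v + failsʳ u v)))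
      ≡⟨ sum-cong-≗ (λ u → trans (∑-distrib-+ (λ v → 𝟙 (level? (suc i) u v)) _)
                                 (cong (sum (λ v → 𝟙 (level? (suc i) u v)) +_) (∑-distrib-+ (failsˡ u) (failsʳ u)))) ⟩
    sum (λ u → sum (λ v → 𝟙 (level? (suc i) u v)) + (sum (failsˡ u) + sum (failsʳ u)))
      ≡⟨ ∑-distrib-+ (λ u → sum (λ v → 𝟙 (level? (suc i) u v))) _ ⟩
    size (suc i) + sum (λ u → sum (failsˡ u) + sum (failsʳ u))
      ≡⟨ cong (size (suc i) +_) (∑-distrib-+ (λ u → sum (failsˡ u)) _) ⟩
    size (suc i) + (sum (λ u → sum (failsˡ u)) + sum (λ u → sum (failsʳ u)))
      -- Left failures are few for each fixed right end `v`, so their double sum is exchanged; right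
      -- failures are few for each fixed left end `u`.
      ≡⟨ cong (λ s → size (suc i) + (s + sum (λ u → sum (failsʳ u)))) (∑-comm failsˡ) ⟩
    size (suc i) + (sum (λ v → sum (λ u → failsˡ u v)) + sum (λ u → sum (failsʳ u)))
      ≤⟨ ℕₚ.+-monoʳ-≤ (size (suc i)) (ℕₚ.+-mono-≤
           (sum-mono-≤ (λ v → few-outermost left (λ u → level? i u v) d))
           (sum-mono-≤ (λ u → few-outermost right (level? i u) d))) ⟩
    size (suc i) + (sum {n} (λ _ → d) + sum {n} (λ _ → d))
      ≡⟨ cong (λ s → size (suc i) + (s + s)) (sum-const n d) ⟩
    size (suc i) + (n * d + n * d) ∎
    where
    open ℕₚ.≤-Reasoning
    failsˡ failsʳ : Fin n → Fin n → ℕ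
    failsˡ u v = 𝟙 (level? i u v ×-dec (beyondCount left (λ x → level? i x v) u ℕ.<? d))
    failsʳ u v = 𝟙 (level? i u v ×-dec (beyondCount right (level? i u) v ℕ.<? d))
    survives-or-fails : ∀ u v → 𝟙 (level? i u v) ≤ 𝟙 (level? (suc i) u v) + (failsˡ u v + failsʳ u v)
    survives-or-fails u v = go (level? i u v)
        (beyondCount left (λ x → level? i x v) u ℕ.<? d) (beyondCount right (level? i u) v ℕ.<? d)
      where
      go : (l : Dec (Level i u v)) → Dec (beyondCount left (λ x → level? i x v) u < d) →
           Dec (beyondCount right (level? i u) v < d) →
           𝟙 l ≤ 𝟙 (level? (suc i) u v) + (failsˡ u v + failsʳ u v)
      go (no _)  _       _       = z≤n
      go (yes l) (yes p) _       = ℕₚ.≤-trans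
        (𝟙-mono (yes l) (level? i u v ×-dec (_ ℕ.<? d)) (_, p))
        (ℕₚ.≤-trans (ℕₚ.m≤m+n (failsˡ u v) (failsʳ u v)) (ℕₚ.m≤n+m _ (𝟙 (level? (suc i) u v))))
      go (yes l) (no _)  (yes p) = ℕₚ.≤-trans
        (𝟙-mono (yes l) (level? i u v ×-dec (_ ℕ.<? d)) (_, p))
        (ℕₚ.≤-trans (ℕₚ.m≤n+m (failsʳ u v) (failsˡ u v)) (ℕₚ.m≤n+m _ (𝟙 (level? (suc i) u v))))
      go (yes l) (no p)  (no q)  = ℕₚ.≤-trans
        (𝟙-mono (yes l) (level? (suc i) u v) (λ l → l , ℕₚ.≮⇒≥ p , ℕₚ.≮⇒≥ q))
        (ℕₚ.m≤m+n (𝟙 (level? (suc i) u v)) _)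

  size-bound : ∀ i → size 0 ≤ size i + i * (n * d + n * d)
  size-bound zero    = ℕₚ.≤-reflexive (sym (ℕₚ.+-identityʳ (size 0)))
  size-bound (suc i) = begin
    size 0                                               ≤⟨ size-bound i ⟩
    size i + i * (n * d + n * d)                         ≤⟨ ℕₚ.+-monoˡ-≤ _ (size-step i) ⟩
    size (suc i) + (n * d + n * d) + i * (n * d + n * d) ≡⟨ ℕₚ.+-assoc (size (suc i)) _ _ ⟩
    size (suc i) + suc i * (n * d + n * d)               ∎
    where open ℕₚ.≤-Reasoning

sum-zero : ∀ {f : Fin n → ℕ} → (∀ i → f i ≡ 0) → sum f ≡ 0
sum-zero {n} f≡0 = trans (sum-cong-≗ f≡0) (trans (sum-const n 0) (ℕₚ.*-zeroʳ n))

edgeCount-upper : ∀ k d (G : OrderedGraph n) → n < d ^ k → ¬ HasShortBordered k G →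
  edgeCount G ≤ k * (n * d + n * d)
edgeCount-upper {n} k d G n<dᵏ none = begin
  edgeCount G                           ≡⟨ edgeCount≡size G d ⟩
  size G d 0                            ≤⟨ size-bound G d k ⟩
  size G d k + k * (n * d + n * d)      ≡⟨ cong (_+ k * (n * d + n * d)) (sum-zero λ u → sum-zero λ v → empty u v) ⟩
  k * (n * d + n * d)                   ∎
  where
  open ℕₚ.≤-Reasoning
  empty : ∀ u v → 𝟙 (level? G d k u v) ≡ 0
  empty u v with level? G d k u v
  ... | no _  = refl
  ... | yes l = contradiction
    -- Since `u` itself counts as left of the threshold `u`, this threshold separates the ends of
    -- the root edge.
    (tree⇒bordered {τ = u} (proj₁ (Level⇒trees G d k l)) lr ℕₚ.≤-refl (proj₁ (Level⇒edge G d k l)) n<dᵏ) none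

-- Primes between powers of two

absorption : ∀ n m → suc m * (suc n C suc m) ≡ suc n * (n C m)
absorption zero    zero    = refl
absorption zero    (suc m) = trans
  (cong (suc (suc m) *_) (k>n⇒nCk≡0 {1} {suc (suc m)} (s≤s (s≤s z≤n))))
  (trans (ℕₚ.*-zeroʳ m) (sym (trans (ℕₚ.*-identityˡ _) (k>n⇒nCk≡0 {0} {suc m} (s≤s z≤n)))))
absorption (suc n) m = begin
  suc m * (suc (suc n) C suc m)                      ≡⟨ cong (suc m *_) (nCk+nC[k+1]≡[n+1]C[k+1] (suc n) m) ⟨
  suc m * ((suc n C m) + (suc n C suc m))            ≡⟨ ℕₚ.*-distribˡ-+ (suc m) (suc n C m) _ ⟩
  suc m * (suc n C m) + suc m * (suc n C suc m)      ≡⟨ cong (suc m * (suc n C m) +_) (absorption n m) ⟩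
  suc m * (suc n C m) + suc n * (n C m)              ≡⟨ go m ⟩
  suc (suc n) * (suc n C m)                          ∎
  where
  open ≡-Reasoning
  go : ∀ m → suc m * (suc n C m) + suc n * (n C m) ≡ suc (suc n) * (suc n C m)
  go zero    = lemma n
    where
    lemma : ∀ n → 1 * 1 + suc n * 1 ≡ suc (suc n) * 1
    lemma = solve-∀
  go (suc m) = begin
    (suc n C suc m) + suc m * (suc n C suc m) + suc n * (n C suc m)
      ≡⟨ cong (λ x → (suc n C suc m) + x + suc n * (n C suc m)) (absorption n m) ⟩
    (suc n C suc m) + suc n * (n C m) + suc n * (n C suc m)
      ≡⟨ ℕₚ.+-assoc (suc n C suc m) _ _ ⟩
    (suc n C suc m) + (suc n * (n C m) + suc n * (n C suc m))
      ≡⟨ cong ((suc n C suc m) +_) (ℕₚ.*-distribˡ-+ (suc n) (n C m) (n C suc m)) ⟨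
    (suc n C suc m) + suc n * ((n C m) + (n C suc m))
      ≡⟨ cong (λ x → (suc n C suc m) + suc n * x) (nCk+nC[k+1]≡[n+1]C[k+1] n m) ⟩
    suc (suc n) * (suc n C suc m) ∎

C>0 : ∀ n m → m ≤ n → 0 < n C m
C>0 n       zero    _         = s≤s z≤n
C>0 (suc n) (suc m) (s≤s m≤n) = subst (0 <_) (nCk+nC[k+1]≡[n+1]C[k+1] n m)
  (ℕₚ.≤-trans (C>0 n m m≤n) (ℕₚ.m≤m+n _ _))

C≤2^ : ∀ n m → n C m ≤ 2 ^ n
C≤2^ n       zero    = ℕₚ.m^n>0 2 n
C≤2^ zero    (suc m) = ℕₚ.≤-trans (ℕₚ.≤-reflexive (k>n⇒nCk≡0 {0} {suc m} (s≤s z≤n))) z≤n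
C≤2^ (suc n) (suc m) = subst₂ _≤_ (nCk+nC[k+1]≡[n+1]C[k+1] n m) (cong (2 ^ n +_) (sym (ℕₚ.+-identityʳ _)))
  (ℕₚ.+-mono-≤ (C≤2^ n m) (C≤2^ n (suc m)))

-- Pascal's rule splits the next central coefficient into two terms, each of which is at least the
-- present one.
2^≤central : ∀ m → 2 ^ m ≤ (m + m) C m
2^≤central zero    = s≤s z≤n
2^≤central (suc m) = begin
  2 ^ m + (2 ^ m + 0)
    ≡⟨ cong (2 ^ m +_) (ℕₚ.+-identityʳ _) ⟩
  2 ^ m + 2 ^ m
    ≤⟨ ℕₚ.+-mono-≤ (2^≤central m) (2^≤central m) ⟩
  (m + m) C m + (m + m) C m
    ≤⟨ ℕₚ.+-mono-≤ (lower m) (ℕₚ.≤-trans (ℕₚ.m≤m+n _ _) (ℕₚ.≤-reflexive (nCk+nC[k+1]≡[n+1]C[k+1] (m + m) m))) ⟩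
  suc (m + m) C m + suc (m + m) C suc m
    ≡⟨ nCk+nC[k+1]≡[n+1]C[k+1] (suc (m + m)) m ⟩
  suc (suc (m + m)) C suc m
    ≡⟨ cong (λ x → suc x C suc m) (ℕₚ.+-suc m m) ⟨
  (suc m + suc m) C suc m ∎
  where
  open ℕₚ.≤-Reasoning
  lower : ∀ m {n} → n C m ≤ suc n C m
  lower zero        = ℕₚ.≤-refl
  lower (suc m) {n} = ℕₚ.≤-trans (ℕₚ.m≤n+m _ (n C m)) (ℕₚ.≤-reflexive (nCk+nC[k+1]≡[n+1]C[k+1] n m))

DivisibleUpTo : ℕ → ℕ → Set
DivisibleUpTo N D = ∀ i → 1 ≤ i → i ≤ N → i ∣ D

-- The entries 1 / ((n + 1) C(n , m)) of Leibniz' harmonic triangle are differences of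
-- neighbouring entries, so every denominator divides what all of 1 , … , n + 1 divide.
leibniz : ∀ {N D} → DivisibleUpTo N D → ∀ n m → m ≤ n → n < N → suc n * (n C m) ∣ D
leibniz {N} {D} div n       zero    _         n<N = subst (_∣ D) (sym (ℕₚ.*-identityʳ (suc n))) (div (suc n) (s≤s z≤n) n<N)
leibniz {N} {D} div (suc n) (suc m) (s≤s m≤n) n<N
  with leibniz div n m m≤n (ℕₚ.<-trans (ℕₚ.n<1+n n) n<N) | leibniz div (suc n) m (ℕₚ.m≤n⇒m≤1+n m≤n) n<N
... | divides x D≡xP | divides y D≡yQ =
  ∣m+n∣m⇒∣n (divides x (trans (ℕₚ.+-comm (y * A) D) (sym xA≡D+yA))) (n∣m*n y)
  where
  open ≡-Reasoning
  c c₁ c′ c″ P Q A : ℕ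
  c  = n C m
  c₁ = suc n C m
  c′ = suc n C suc m
  c″ = suc (suc n) C suc m
  P = suc n * c
  Q = suc (suc n) * c₁
  A = suc (suc n) * c′

  absorbed : c₁ + c′ ≡ c″
  absorbed = nCk+nC[k+1]≡[n+1]C[k+1] (suc n) m

  -- The recursion 1/A = 1/P - 1/Q of the harmonic triangle, cleared of denominators. Multiplied by
  -- `D` it says that D/A is the integer x - y.
  PQ+AP≡AQ : P * Q + A * P ≡ A * Q
  PQ+AP≡AQ = begin
    P * Q + A * P                             ≡⟨ lemma₁ n c c₁ c′ ⟩
    suc (suc n) * (suc n * c * (c₁ + c′))     ≡⟨ cong₂ (λ u v → suc (suc n) * (u * v)) (sym (absorption n m)) absorbed ⟩
    suc (suc n) * (suc m * c′ * c″)           ≡⟨ lemma₂ n m c′ c″ ⟩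
    suc (suc n) * c′ * (suc m * c″)           ≡⟨ cong (A *_) (absorption (suc n) m) ⟩
    A * Q                                     ∎
    where
    lemma₁ : ∀ n c c₁ c′ → suc n * c * (suc (suc n) * c₁) + suc (suc n) * c′ * (suc n * c) ≡
             suc (suc n) * (suc n * c * (c₁ + c′))
    lemma₁ = solve-∀
    lemma₂ : ∀ n m c′ c″ → suc (suc n) * (suc m * c′ * c″) ≡ suc (suc n) * c′ * (suc m * c″)
    lemma₂ = solve-∀

  PQ>0 : 0 < P * Q
  PQ>0 = ℕₚ.*-mono-≤ (ℕₚ.*-mono-≤ (s≤s (z≤n {n})) (C>0 n m m≤n))
                     (ℕₚ.*-mono-≤ (s≤s (z≤n {suc n})) (C>0 (suc n) m (ℕₚ.m≤n⇒m≤1+n m≤n)))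

  xA≡D+yA : x * A ≡ D + y * A
  xA≡D+yA = ℕₚ.*-cancelʳ-≡ (x * A) (D + y * A) (P * Q) {{>-nonZero PQ>0}} (begin
    x * A * (P * Q)               ≡⟨ lemma₁ x A P Q ⟩
    x * P * (A * Q)               ≡⟨ cong₂ _*_ (sym D≡xP) (sym PQ+AP≡AQ) ⟩
    D * (P * Q + A * P)           ≡⟨ ℕₚ.*-distribˡ-+ D (P * Q) (A * P) ⟩
    D * (P * Q) + D * (A * P)     ≡⟨ cong (λ z → D * (P * Q) + z * (A * P)) D≡yQ ⟩
    D * (P * Q) + y * Q * (A * P) ≡⟨ lemma₂ D A P Q y ⟩
    (D + y * A) * (P * Q)         ∎)
    where
    lemma₁ : ∀ x A P Q → x * A * (P * Q) ≡ x * P * (A * Q)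
    lemma₁ = solve-∀
    lemma₂ : ∀ D A P Q y → D * (P * Q) + y * Q * (A * P) ≡ (D + y * A) * (P * Q)
    lemma₂ = solve-∀

-- By `absorption`, `suc m` times the central coefficient is a denominator of the harmonic triangle,
-- in row `m + suc m`.
central-∣ : ∀ {D} m → DivisibleUpTo (suc m + suc m) D → (suc m + suc m) C suc m ∣ D
central-∣ {D} m div = ∣-trans (n∣m*n (suc m))
  (subst (_∣ D) (sym (absorption (m + suc m) m)) (leibniz div (m + suc m) m (ℕₚ.m≤m+n m (suc m)) ℕₚ.≤-refl))

-- Primorials and Chebyshev's argument

primeOrOne : ℕ → ℕ
primeOrOne i with prime? i
... | yes _ = i
... | no _  = 1

primeProduct : ℕ → ℕ → ℕ
primeProduct a zero    = 1
primeProduct a (suc l) = primeOrOne (a + suc l) * primeProduct a l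

prime>1 : Prime p → 1 < p
prime>1 {p} pp = ℕ.nonTrivial⇒n>1 p {{prime⇒nonTrivial pp}}

prime∤1 : Prime p → ¬ (p ∣ 1)
prime∤1 pp p∣1 = ℕₚ.<⇒≱ (prime>1 pp) (∣⇒≤ p∣1)

prime∣primeProduct⇒≤ : Prime p → ∀ a l → p ∣ primeProduct a l → p ≤ a + l
prime∣primeProduct⇒≤ pp a zero    p∣ = contradiction p∣ (prime∤1 pp)
prime∣primeProduct⇒≤ {p} pp a (suc l) p∣
  with prime? (a + suc l) | euclidsLemma (primeOrOne (a + suc l)) (primeProduct a l) pp p∣
... | _     | inj₂ p∣rest = ℕₚ.≤-trans (prime∣primeProduct⇒≤ pp a l p∣rest) (ℕₚ.+-monoʳ-≤ a (ℕₚ.n≤1+n l))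
... | yes q | inj₁ p∣q    = ∣⇒≤ {{prime⇒nonZero q}} p∣q
... | no _  | inj₁ p∣1    = contradiction p∣1 (prime∤1 pp)

-- The largest prime of the range exceeds all primes in the remaining product, hence is coprime to
-- it and can be split off.
primeProduct-∣ : ∀ {X} a l → (∀ p → Prime p → a < p → p ≤ a + l → p ∣ X) → primeProduct a l ∣ X
primeProduct-∣ {X} a zero    all = 1∣ X
primeProduct-∣ {X} a (suc l) all
  with prime? (a + suc l) | primeProduct-∣ {X} a l (λ p pp lo hi → all p pp lo (ℕₚ.≤-trans hi (ℕₚ.+-monoʳ-≤ a (ℕₚ.n≤1+n l))))
... | no _  | Y∣X = subst (_∣ X) (sym (ℕₚ.*-identityˡ _)) Y∣X
... | yes q | Y∣X with all (a + suc l) q (ℕₚ.m<m+n a (s≤s z≤n)) ℕₚ.≤-refl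
... | divides z X≡zp = subst (p₀ * primeProduct a l ∣_) (trans (ℕₚ.*-comm p₀ z) (sym X≡zp))
    (*-monoʳ-∣ p₀ (coprime-divisor coprime (subst (primeProduct a l ∣_) (trans X≡zp (ℕₚ.*-comm z p₀)) Y∣X)))
  where
  p₀ = a + suc l
  coprime : Coprime (primeProduct a l) p₀
  coprime (d∣Y , d∣p) with prime⇒irreducible q d∣p
  ... | inj₁ d≡1 = d≡1
  ... | inj₂ refl = contradiction (prime∣primeProduct⇒≤ q a l d∣Y) (ℕₚ.<⇒≱ (ℕₚ.+-monoʳ-< a ℕₚ.≤-refl))

primeProduct-++ : ∀ a l l′ → primeProduct a (l + l′) ≡ primeProduct (a + l) l′ * primeProduct a l
primeProduct-++ a l zero     = trans (cong (primeProduct a) (ℕₚ.+-identityʳ l)) (sym (ℕₚ.+-identityʳ _))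
primeProduct-++ a l (suc l′) = begin
  primeProduct a (l + suc l′)
    ≡⟨ cong (primeProduct a) (ℕₚ.+-suc l l′) ⟩
  primeOrOne (a + suc (l + l′)) * primeProduct a (l + l′)
    ≡⟨ cong₂ _*_ (cong primeOrOne (trans (cong (a +_) (sym (ℕₚ.+-suc l l′))) (sym (ℕₚ.+-assoc a l (suc l′))))) (primeProduct-++ a l l′) ⟩
  primeOrOne (a + l + suc l′) * (primeProduct (a + l) l′ * primeProduct a l)
    ≡⟨ ℕₚ.*-assoc (primeOrOne (a + l + suc l′)) _ _ ⟨
  primeProduct (a + l) (suc l′) * primeProduct a l ∎
  where open ≡-Reasoning

prime∣!⇒≤ : Prime p → ∀ m → p ∣ m ! → p ≤ m
prime∣!⇒≤ pp zero    p∣ = contradiction p∣ (prime∤1 pp)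
prime∣!⇒≤ pp (suc m) p∣ with euclidsLemma (suc m) (m !) pp p∣
... | inj₁ p∣m = ∣⇒≤ p∣m
... | inj₂ p∣! = ℕₚ.m≤n⇒m≤1+n (prime∣!⇒≤ pp m p∣!)

∣! : ∀ {i m} → 1 ≤ i → i ≤ m → i ∣ m !
∣! {suc i} {m} _ i≤m = ∣-trans (m∣m*n (i !)) (m≤n⇒m!∣n! i≤m)

n!≤n^n : ∀ n → n ! ≤ n ^ n
n!≤n^n zero    = s≤s z≤n
n!≤n^n (suc n) = ℕₚ.*-monoʳ-≤ (suc n) (ℕₚ.≤-trans (n!≤n^n n) (ℕₚ.^-monoˡ-≤ n (ℕₚ.n≤1+n n)))

-- `p` divides `(m + m) !` but, being larger than `m`, neither of the two factors `m !` in the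
-- denominator.
prime∣central : ∀ m → Prime p → m < p → p ≤ m + m → p ∣ (m + m) C m
prime∣central {p} m pp m<p p≤2m
  with euclidsLemma ((m + m) C m) (m ! * (m + m ∸ m) !) pp
         (subst (p ∣_) (sym factorial) (∣! (ℕₚ.<⇒≤ (prime>1 pp)) p≤2m))
  where
  instance
    _ = ℕₚ._!*_!≢0 m (m + m ∸ m)
  factorial : ((m + m) C m) * (m ! * (m + m ∸ m) !) ≡ (m + m) !
  factorial = trans (cong (_* (m ! * (m + m ∸ m) !)) (nCk≡n!/k![n-k]! (ℕₚ.m≤m+n m m)))
                    (m/n*n≡m (k![n∸k]!∣n! (ℕₚ.m≤m+n m m)))
... | inj₁ p∣C = p∣C
... | inj₂ p∣!! with euclidsLemma (m !) ((m + m ∸ m) !) pp p∣!!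
... | inj₁ p∣! = contradiction (prime∣!⇒≤ pp m p∣!) (ℕₚ.<⇒≱ m<p)
... | inj₂ p∣! = contradiction (prime∣!⇒≤ pp m (subst (λ x → p ∣ x !) (ℕₚ.m+n∸m≡n m m) p∣!)) (ℕₚ.<⇒≱ m<p)

-- Erdős' bound of 4 to the power N for the primorial of N, at powers of two: the primes between `h`
-- and `h + h` divide a central binomial coefficient, which is at most `2 ^ (h + h)`.
primorial-bound : ∀ r → primeProduct 0 (2 ^ r) ≤ 2 ^ (2 ^ suc r)
primorial-bound zero    = s≤s z≤n
primorial-bound (suc r) = begin
  primeProduct 0 (2 ^ suc r)
    ≡⟨ cong (primeProduct 0) 2h≡h+h ⟩
  primeProduct 0 (h + h)
    ≡⟨ primeProduct-++ 0 h h ⟩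
  primeProduct h h * primeProduct 0 h
    ≤⟨ ℕₚ.*-mono-≤ (∣⇒≤ {{>-nonZero (C>0 (h + h) h (ℕₚ.m≤m+n h h))}} (primeProduct-∣ h h (λ p pp → prime∣central h pp))) (primorial-bound r) ⟩
  ((h + h) C h) * 2 ^ (2 ^ suc r)
    ≤⟨ ℕₚ.*-monoˡ-≤ (2 ^ (2 ^ suc r)) (C≤2^ (h + h) h) ⟩
  2 ^ (h + h) * 2 ^ (2 ^ suc r)
    ≡⟨ cong (λ x → 2 ^ x * 2 ^ (2 ^ suc r)) 2h≡h+h ⟨
  2 ^ (2 ^ suc r) * 2 ^ (2 ^ suc r)
    ≡⟨ ℕₚ.^-distribˡ-+-* 2 (2 ^ suc r) (2 ^ suc r) ⟨
  2 ^ (2 ^ suc r + 2 ^ suc r)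
    ≡⟨ cong (λ x → 2 ^ (2 ^ suc r + x)) (ℕₚ.+-identityʳ (2 ^ suc r)) ⟨
  2 ^ (2 ^ suc (suc r)) ∎
  where
  open ℕₚ.≤-Reasoning
  h = 2 ^ r
  2h≡h+h : 2 ^ suc r ≡ h + h
  2h≡h+h = cong (h +_) (ℕₚ.+-identityʳ h)

product-∣-power : ∀ {X fs} → All (_∣ X) fs → product fs ∣ X ^ length fs
product-∣-power []       = ∣-refl
product-∣-power (d ∷ ds) = *-pres-∣ d (product-∣-power ds)

2^length≤product : ∀ {fs} → All Prime fs → 2 ^ length fs ≤ product fs
2^length≤product []       = s≤s z≤n
2^length≤product (p ∷ ps) = ℕₚ.*-mono-≤ (prime>1 p) (2^length≤product ps)

∈⇒∣product : ∀ {x fs} → x ∈ fs → x ∣ product fs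
∈⇒∣product (here refl)          = m∣m*n _
∈⇒∣product {fs = y ∷ _} (there x∈) = ∣n⇒∣m*n y (∈⇒∣product x∈)

^-∣-mono : ∀ X {a b} → a ≤ b → X ^ a ∣ X ^ b
^-∣-mono X {b = b} z≤n       = 1∣ (X ^ b)
^-∣-mono X (s≤s a≤b) = *-monoʳ-∣ X (^-∣-mono X a≤b)

PrimeIn : ℕ → ℕ → Set
PrimeIn a b = ∃[ p ] Prime p × a < p × p ≤ b

-- At most one prime factor of i exceeds R; the others are at most e in number.
no-primes⇒divisible : ∀ {L R e} → R * R ≡ 2 ^ e → 1 ≤ e → ¬ PrimeIn L (2 ^ e) →
  DivisibleUpTo (2 ^ e) (primeProduct 0 L * (R !) ^ e)
no-primes⇒divisible {L} {R} {e} R²≡ 1≤e none i 1≤i i≤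
  with factorise i {{>-nonZero 1≤i}}
... | record { factors = fs ; isFactorisation = i≡ ; factorsPrime = ps } with All.all? (ℕ._≤? R) fs
... | yes small = ∣n⇒∣m*n (primeProduct 0 L) (subst (_∣ (R !) ^ e) (sym i≡)
        (∣-trans (product-∣-power (All.zipWith (λ (q , q≤R) → ∣! (ℕₚ.<⇒≤ (prime>1 q)) q≤R) (ps , small)))
                 (^-∣-mono (R !) length≤e)))
  where
  length≤e : length fs ≤ e
  length≤e = ℕₚ.≮⇒≥ λ e<l → ℕₚ.<⇒≱ (ℕₚ.^-monoʳ-< 2 ℕₚ.≤-refl e<l)
    (ℕₚ.≤-trans (2^length≤product ps) (subst (_≤ 2 ^ e) i≡ i≤))
-- The large factor `q` is not in the empty window, so it is at most `L` and divides the primorial.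
-- Its cofactor is at most `R`, because `i` is at most `R * R`, and divides `R !`.
... | no ¬small with find (Allₚ.¬All⇒Any¬ (ℕ._≤? R) fs ¬small)
... | q , q∈ , q≰R with subst (q ∣_) (sym i≡) (∈⇒∣product q∈)
... | divides s i≡sq = subst (_∣ _) (trans (ℕₚ.*-comm q s) (sym i≡sq)) (*-pres-∣ q∣T s∣R!ᵉ)
  where
  qq : Prime q
  qq = All.lookup ps q∈
  q≤i : q ≤ i
  q≤i = ∣⇒≤ {{>-nonZero 1≤i}} (divides s i≡sq)
  q≤L : q ≤ L
  q≤L = ℕₚ.≮⇒≥ λ L<q → none (q , qq , L<q , ℕₚ.≤-trans q≤i i≤)
  q∣T : q ∣ primeProduct 0 L
  q∣T = go L q≤L
    where
    go : ∀ L → q ≤ L → q ∣ primeProduct 0 L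
    go zero    q≤0 = contradiction (ℕₚ.≤-trans (prime>1 qq) q≤0) λ ()
    go (suc L) q≤ with ℕₚ.m≤n⇒m<n∨m≡n q≤
    ... | inj₁ q<  = ∣n⇒∣m*n (primeOrOne (suc L)) (go L (ℕₚ.≤-pred q<))
    ... | inj₂ refl with prime? (suc L)
    ... | yes _  = m∣m*n (primeProduct 0 L)
    ... | no ¬p  = contradiction qq ¬p
  1≤s : 1 ≤ s
  1≤s = ℕₚ.≰⇒> λ { z≤n → contradiction (subst (1 ≤_) i≡sq 1≤i) λ () }
  s≤R : s ≤ R
  s≤R = ℕₚ.≮⇒≥ λ R<s → ℕₚ.<⇒≱ (ℕₚ.*-mono-< R<s (ℕₚ.≰⇒> q≰R))
    (subst₂ _≤_ i≡sq (sym R²≡) i≤)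
  s∣R!ᵉ : s ∣ (R !) ^ e
  s∣R!ᵉ = ∣-trans (∣! 1≤s s≤R) (subst (_∣ (R !) ^ e) (ℕₚ.^-identityʳ (R !)) (^-∣-mono (R !) 1≤e))

growth : ∀ u → 9 ≤ u → 2 * ((u + 2) * (u + 2)) < 2 ^ u
growth u 9≤u = subst (λ u → 2 * ((u + 2) * (u + 2)) < 2 ^ u) (ℕₚ.m+[n∸m]≡n 9≤u) (go (u ∸ 9))
  where
  go : ∀ v → 2 * ((9 + v + 2) * (9 + v + 2)) < 2 ^ (9 + v)
  go zero    = ℕₚ.<ᵇ⇒< _ _ _
  go (suc v) = begin-strict
    2 * ((9 + suc v + 2) * (9 + suc v + 2))          ≤⟨ ℕₚ.m≤m+n _ _ ⟩
    2 * ((9 + suc v + 2) * (9 + suc v + 2)) + (2 * (v * v) + 40 * v + 196) ≡⟨ lemma v ⟩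
    2 * (2 * ((9 + v + 2) * (9 + v + 2)))            <⟨ ℕₚ.*-monoʳ-< 2 (go v) ⟩
    2 * 2 ^ (9 + v)                                  ≡⟨ cong (2 ^_) (ℕₚ.+-suc 9 v) ⟨
    2 ^ (9 + suc v)                                  ∎
    where
    open ℕₚ.≤-Reasoning
    lemma : ∀ v → 2 * ((9 + suc v + 2) * (9 + suc v + 2)) + (2 * (v * v) + 40 * v + 196) ≡
            2 * (2 * ((9 + v + 2) * (9 + v + 2)))
    lemma = solve-∀

-- Without a prime in the window, `D` is divisible by everything up to `2 ^ e = M + M`, hence by a
-- central coefficient of size at least `2 ^ M`. As the window starts at an eighth of its end, the
-- primorial in `D` contributes at most M/2 to the exponent of 2, and `growth` keeps the
-- contribution of the factorials below M/2. The exponent `e` is even so that `R` is the exact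
-- square root of `2 ^ e`.
prime-in-window : ∀ u → 9 ≤ u → PrimeIn (2 ^ (2 * u + 1)) (2 ^ (2 * u + 4))
prime-in-window u 9≤u
  with ℕₚ.anyUpTo? (λ p → prime? p ×-dec (2 ^ (2 * u + 1) ℕ.<? p)) (suc (2 ^ (2 * u + 4)))
... | yes (p , s≤s p≤ , pp , <p) = p , pp , <p , p≤
... | no none = contradiction 2^M≤ (ℕₚ.<⇒≱ (begin-strict
  D
    ≤⟨ ℕₚ.*-mono-≤ (primorial-bound r) (ℕₚ.^-monoˡ-≤ e (n!≤n^n R)) ⟩
  2 ^ (2 ^ suc r) * (R ^ R) ^ e
    ≡⟨ cong (λ x → 2 ^ (2 ^ suc r) * x ^ e) (ℕₚ.^-*-assoc 2 (u + 2) R) ⟩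
  2 ^ (2 ^ suc r) * (2 ^ ((u + 2) * R)) ^ e
    ≡⟨ cong (2 ^ (2 ^ suc r) *_) (ℕₚ.^-*-assoc 2 ((u + 2) * R) e) ⟩
  2 ^ (2 ^ suc r) * 2 ^ ((u + 2) * R * e)
    ≡⟨ ℕₚ.^-distribˡ-+-* 2 (2 ^ suc r) ((u + 2) * R * e) ⟨
  2 ^ (2 ^ suc r + (u + 2) * R * e)
    <⟨ ℕₚ.^-monoʳ-< 2 ℕₚ.≤-refl exponent ⟩
  2 ^ M ∎))
  where
  open ℕₚ.≤-Reasoning
  r e R M D : ℕ
  r = 2 * u + 1
  e = 2 * u + 4
  R = 2 ^ (u + 2)
  M = 2 ^ (2 * u + 3)
  D = primeProduct 0 (2 ^ r) * (R !) ^ e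

  M+M≡ : M + M ≡ 2 ^ e
  M+M≡ = trans (cong (M +_) (sym (ℕₚ.+-identityʳ M))) (cong (2 ^_) (sym (ℕₚ.+-suc (2 * u) 3)))

  R²≡ : R * R ≡ 2 ^ e
  R²≡ = trans (sym (ℕₚ.^-distribˡ-+-* 2 (u + 2) (u + 2))) (cong (2 ^_) (double u))
    where
    double : ∀ u → u + 2 + (u + 2) ≡ 2 * u + 4
    double = solve-∀

  2^r≡ : 2 ^ suc r ≡ 2 ^ u * R
  2^r≡ = trans (cong (2 ^_) (double u)) (ℕₚ.^-distribˡ-+-* 2 u (u + 2))
    where
    double : ∀ u → suc (2 * u + 1) ≡ u + (u + 2)
    double = solve-∀

  exponent : 2 ^ suc r + (u + 2) * R * e < M
  exponent = begin-strict
    2 ^ suc r + (u + 2) * R * e               ≡⟨ cong (2 ^ suc r +_) (regroup u R) ⟩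
    2 ^ suc r + 2 * ((u + 2) * (u + 2)) * R   <⟨ ℕₚ.+-monoʳ-< (2 ^ suc r)
                                                  (ℕₚ.*-monoˡ-< R {{ℕₚ.m^n≢0 2 (u + 2)}} (growth u 9≤u)) ⟩
    2 ^ suc r + 2 ^ u * R                     ≡⟨ cong (2 ^ suc r +_) 2^r≡ ⟨
    2 ^ suc r + 2 ^ suc r                     ≡⟨ cong (2 ^ suc r +_) (ℕₚ.+-identityʳ (2 ^ suc r)) ⟨
    2 ^ suc (suc r)                           ≡⟨ cong (2 ^_) (shift u) ⟩
    M                                         ∎
    where
    regroup : ∀ u R → (u + 2) * R * (2 * u + 4) ≡ 2 * ((u + 2) * (u + 2)) * R
    regroup = solve-∀
    shift : ∀ u → suc (suc (2 * u + 1)) ≡ 2 * u + 3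
    shift = solve-∀

  D>0 : 0 < D
  D>0 = ℕₚ.*-mono-≤ (primeProduct>0 0 (2 ^ r)) (ℕₚ.m^n>0 (R !) {{ℕₚ._!≢0 R}} e)
    where
    primeOrOne>0 : ∀ i → 0 < primeOrOne i
    primeOrOne>0 i with prime? i
    ... | yes p = ℕₚ.<⇒≤ (prime>1 p)
    ... | no _  = s≤s z≤n
    primeProduct>0 : ∀ a l → 0 < primeProduct a l
    primeProduct>0 a zero    = s≤s z≤n
    primeProduct>0 a (suc l) = ℕₚ.*-mono-≤ (primeOrOne>0 (a + suc l)) (primeProduct>0 a l)

  divisible : DivisibleUpTo (M + M) D
  divisible = subst (λ N → DivisibleUpTo N D) (sym M+M≡)
    (no-primes⇒divisible {R = R} R²≡ (ℕₚ.≤-trans (s≤s z≤n) (ℕₚ.m≤n+m 4 (2 * u)))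
      λ (p , pp , <p , p≤) → none (p , s≤s p≤ , pp , <p))

  2^M≤ : 2 ^ M ≤ D
  2^M≤ = ℕₚ.≤-trans (2^≤central M) (∣⇒≤ {{>-nonZero D>0}} (central M (ℕₚ.m^n>0 2 (2 * u + 3)) divisible))
    where
    central : ∀ M → 0 < M → DivisibleUpTo (M + M) D → (M + M) C M ∣ D
    central (suc m) _ = central-∣ m

-- Newton's identities

-- The Cauchy product: coefficient `r` of the product of the power series with coefficients `f` and
-- `g`.
conv : (ℕ → ℤ) → (ℕ → ℤ) → ℕ → ℤ
conv f g zero    = f 0 ℤ.* g 0
conv f g (suc r) = conv (f ∘ suc) g r ℤ.+ f 0 ℤ.* g (suc r)

conv-peelʳ : ∀ f g r → conv f g (suc r) ≡ f (suc r) ℤ.* g 0 ℤ.+ conv f (g ∘ suc) r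
conv-peelʳ f g zero    = refl
conv-peelʳ f g (suc r) = trans (cong (ℤ._+ f 0 ℤ.* g (suc (suc r))) (conv-peelʳ (f ∘ suc) g r))
  (ℤₚ.+-assoc (f (suc (suc r)) ℤ.* g 0) _ _)

conv-combineˡ : ∀ x f f′ g r →
  conv (λ i → f i ℤ.- x ℤ.* f′ i) g r ≡ conv f g r ℤ.- x ℤ.* conv f′ g r
conv-combineˡ x f f′ g zero    = lemma x (f 0) (f′ 0) (g 0)
  where
  lemma : ∀ x a b c → (a ℤ.- x ℤ.* b) ℤ.* c ≡ a ℤ.* c ℤ.- x ℤ.* (b ℤ.* c)
  lemma = ring
conv-combineˡ x f f′ g (suc r) = trans
  (cong (ℤ._+ (f 0 ℤ.- x ℤ.* f′ 0) ℤ.* g (suc r)) (conv-combineˡ x (f ∘ suc) (f′ ∘ suc) g r))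
  (lemma x (f 0) (f′ 0) (g (suc r)) (conv (f ∘ suc) g r) (conv (f′ ∘ suc) g r))
  where
  lemma : ∀ x a b c u v → u ℤ.- x ℤ.* v ℤ.+ (a ℤ.- x ℤ.* b) ℤ.* c ≡
          (u ℤ.+ a ℤ.* c) ℤ.- x ℤ.* (v ℤ.+ b ℤ.* c)
  lemma = ring

conv-distribʳ : ∀ f g h r → conv f (λ i → g i ℤ.+ h i) r ≡ conv f g r ℤ.+ conv f h r
conv-distribʳ f g h zero    = ℤₚ.*-distribˡ-+ (f 0) (g 0) (h 0)
conv-distribʳ f g h (suc r) = trans
  (cong (ℤ._+ f 0 ℤ.* (g (suc r) ℤ.+ h (suc r))) (conv-distribʳ (f ∘ suc) g h r))
  (lemma (f 0) (g (suc r)) (h (suc r)) (conv (f ∘ suc) g r) (conv (f ∘ suc) h r))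
  where
  lemma : ∀ a b c u v → u ℤ.+ v ℤ.+ a ℤ.* (b ℤ.+ c) ≡ u ℤ.+ a ℤ.* b ℤ.+ (v ℤ.+ a ℤ.* c)
  lemma = ring

conv-scaleʳ : ∀ x f g r → conv f (λ i → x ℤ.* g i) r ≡ x ℤ.* conv f g r
conv-scaleʳ x f g zero    = lemma x (f 0) (g 0)
  where
  lemma : ∀ x a b → a ℤ.* (x ℤ.* b) ≡ x ℤ.* (a ℤ.* b)
  lemma = ring
conv-scaleʳ x f g (suc r) = trans
  (cong (ℤ._+ f 0 ℤ.* (x ℤ.* g (suc r))) (conv-scaleʳ x (f ∘ suc) g r))
  (lemma x (f 0) (g (suc r)) (conv (f ∘ suc) g r))
  where
  lemma : ∀ x a b u → x ℤ.* u ℤ.+ a ℤ.* (x ℤ.* b) ≡ x ℤ.* (u ℤ.+ a ℤ.* b)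
  lemma = ring

conv-zeroʳ : ∀ f r → conv f (λ _ → 0ℤ) r ≡ 0ℤ
conv-zeroʳ f zero    = ℤₚ.*-zeroʳ (f 0)
conv-zeroʳ f (suc r) = cong₂ ℤ._+_ (conv-zeroʳ (f ∘ suc) r) (ℤₚ.*-zeroʳ (f 0))

delay : (ℕ → ℤ) → ℕ → ℤ
delay f zero    = 0ℤ
delay f (suc i) = f i

-- The coefficient of z ^ (length xs ∸ i) in the product of all z - x with x in xs,
-- i.e. the i-th elementary symmetric polynomial up to sign.
coeff : List ℤ → ℕ → ℤ
coeff []       zero    = 1ℤ
coeff []       (suc i) = 0ℤ
coeff (x ∷ xs) i       = coeff xs i ℤ.- x ℤ.* delay (coeff xs) i

-- Shifted by one: index `i` stands for the exponent `suc i`, as for the digits of the moment curve.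
powerSum : List ℤ → ℕ → ℤ
powerSum []       i = 0ℤ
powerSum (x ∷ xs) i = x ℤ.^ suc i ℤ.+ powerSum xs i

-- For power series in t: multiplication by 1 - x t cancels the denominator of x / (1 - x t), the
-- series of the powers of `x`.
conv-geometric : ∀ x s r →
  conv s (λ i → x ℤ.^ suc i) r ℤ.- x ℤ.* conv (delay s) (λ i → x ℤ.^ suc i) r ≡ x ℤ.* s r
conv-geometric x s zero    = lemma x (s 0)
  where
  lemma : ∀ x a → a ℤ.* (x ℤ.* 1ℤ) ℤ.- x ℤ.* (0ℤ ℤ.* (x ℤ.* 1ℤ)) ≡ x ℤ.* a
  lemma = ring
conv-geometric x s (suc r) = trans
  (cong (ℤ._- x ℤ.* conv (delay s) (λ i → x ℤ.^ suc i) (suc r))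
    (trans (conv-peelʳ s _ r) (cong (λ v → s (suc r) ℤ.* (x ℤ.^ 1) ℤ.+ v) (conv-scaleʳ x s _ r))))
  (lemma x (s (suc r)) (conv s (λ i → x ℤ.^ suc i) r) (x ℤ.^ suc (suc r)))
  where
  lemma : ∀ x a c y → a ℤ.* (x ℤ.* 1ℤ) ℤ.+ x ℤ.* c ℤ.- x ℤ.* (c ℤ.+ 0ℤ ℤ.* y) ≡ x ℤ.* a
  lemma = ring

-- This is E' = - E P for the generating functions E of `coeff xs` and P of `powerSum xs`. A new
-- entry `x` multiplies E by 1 - x t and adds x / (1 - x t) to P, so the product rule carries the
-- identity over.
newton : ∀ xs r → pos (suc r) ℤ.* coeff xs (suc r) ℤ.+ conv (coeff xs) (powerSum xs) r ≡ 0ℤ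
newton []       r = cong₂ ℤ._+_ (ℤₚ.*-zeroʳ (pos (suc r))) (conv-zeroʳ (coeff []) r)
newton (x ∷ xs) r = trans
  (cong (λ v → pos (suc r) ℤ.* coeff (x ∷ xs) (suc r) ℤ.+ v) expand)
  (finish r)
  where
  s q : ℕ → ℤ
  s = coeff xs
  q = powerSum xs
  open ≡-Reasoning
  expand : conv (coeff (x ∷ xs)) (powerSum (x ∷ xs)) r ≡
           x ℤ.* s r ℤ.+ (conv s q r ℤ.- x ℤ.* conv (delay s) q r)
  expand = begin
    conv (coeff (x ∷ xs)) (powerSum (x ∷ xs)) r
      ≡⟨ conv-distribʳ (coeff (x ∷ xs)) (λ i → x ℤ.^ suc i) q r ⟩
    conv (coeff (x ∷ xs)) (λ i → x ℤ.^ suc i) r ℤ.+ conv (coeff (x ∷ xs)) q r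
      ≡⟨ cong₂ ℤ._+_
           (trans (conv-combineˡ x s (delay s) (λ i → x ℤ.^ suc i) r) (conv-geometric x s r))
           (conv-combineˡ x s (delay s) q r) ⟩
    x ℤ.* s r ℤ.+ (conv s q r ℤ.- x ℤ.* conv (delay s) q r) ∎
  finish : ∀ r → pos (suc r) ℤ.* (s (suc r) ℤ.- x ℤ.* s r) ℤ.+
                 (x ℤ.* s r ℤ.+ (conv s q r ℤ.- x ℤ.* conv (delay s) q r)) ≡ 0ℤ
  finish zero    = trans (lemma x (s 0) (s 1) (q 0)) (newton xs 0)
    where
    lemma : ∀ x a b c → 1ℤ ℤ.* (b ℤ.- x ℤ.* a) ℤ.+ (x ℤ.* a ℤ.+ (a ℤ.* c ℤ.- x ℤ.* (0ℤ ℤ.* c))) ≡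
            1ℤ ℤ.* b ℤ.+ a ℤ.* c
    lemma = ring
  finish (suc t) = trans
    (lemma x (pos (suc t)) (s (suc t)) (s (suc (suc t))) (conv s q (suc t)) (conv s q t) (q (suc t)))
    (trans (cong₂ (λ u v → u ℤ.- x ℤ.* v) (newton xs (suc t)) (newton xs t))
           (cong (λ y → 0ℤ ℤ.- y) (ℤₚ.*-zeroʳ x)))
    where
    lemma : ∀ x c a b u v y →
      (1ℤ ℤ.+ c) ℤ.* (b ℤ.- x ℤ.* a) ℤ.+ (x ℤ.* a ℤ.+ (u ℤ.- x ℤ.* (v ℤ.+ 0ℤ ℤ.* y))) ≡
      (1ℤ ℤ.+ c) ℤ.* b ℤ.+ u ℤ.- x ℤ.* (c ℤ.* a ℤ.+ v)
    lemma = ring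

-- Roots of polynomials, over the integers and modulo a prime

horner : (ℕ → ℤ) → ℤ → ℕ → ℤ
horner s z zero    = s 0
horner s z (suc r) = z ℤ.* horner s z r ℤ.+ s (suc r)

rootProduct : ℤ → List ℤ → ℤ
rootProduct z []       = 1ℤ
rootProduct z (x ∷ xs) = (z ℤ.- x) ℤ.* rootProduct z xs

coeff-vanishes : ∀ xs i → length xs < i → coeff xs i ≡ 0ℤ
coeff-vanishes []       (suc i) _         = refl
coeff-vanishes (x ∷ xs) (suc i) (s≤s lt) = trans
  (cong₂ (λ u v → u ℤ.- x ℤ.* v) (coeff-vanishes xs (suc i) (ℕₚ.m≤n⇒m≤1+n lt)) (coeff-vanishes xs i lt))
  (cong (λ y → 0ℤ ℤ.- y) (ℤₚ.*-zeroʳ x))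

-- The last term is the error of truncating after `r` coefficients. It vanishes at `r = length xs`,
-- where the recursion becomes the factorisation into z - x and the rest.
horner-∷ : ∀ z x xs r →
  horner (coeff (x ∷ xs)) z (suc r) ≡ (z ℤ.- x) ℤ.* horner (coeff xs) z r ℤ.+ coeff xs (suc r)
horner-∷ z x xs zero    = lemma z x (coeff xs 0) (coeff xs 1)
  where
  lemma : ∀ z x a b → z ℤ.* (a ℤ.- x ℤ.* 0ℤ) ℤ.+ (b ℤ.- x ℤ.* a) ≡ (z ℤ.- x) ℤ.* a ℤ.+ b
  lemma = ring
horner-∷ z x xs (suc r) = trans
  (cong (λ y → z ℤ.* y ℤ.+ coeff (x ∷ xs) (suc (suc r))) (horner-∷ z x xs r))
  (lemma z x (horner (coeff xs) z r) (coeff xs (suc r)) (coeff xs (suc (suc r))))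
  where
  lemma : ∀ z x h a b → z ℤ.* ((z ℤ.- x) ℤ.* h ℤ.+ a) ℤ.+ (b ℤ.- x ℤ.* a) ≡
          (z ℤ.- x) ℤ.* (z ℤ.* h ℤ.+ a) ℤ.+ b
  lemma = ring

horner-roots : ∀ z xs → horner (coeff xs) z (length xs) ≡ rootProduct z xs
horner-roots z []       = refl
horner-roots z (x ∷ xs) = begin
  horner (coeff (x ∷ xs)) z (suc (length xs))
    ≡⟨ horner-∷ z x xs (length xs) ⟩
  (z ℤ.- x) ℤ.* horner (coeff xs) z (length xs) ℤ.+ coeff xs (suc (length xs))
    ≡⟨ cong₂ (λ u v → (z ℤ.- x) ℤ.* u ℤ.+ v) (horner-roots z xs) (coeff-vanishes xs _ ℕₚ.≤-refl) ⟩
  (z ℤ.- x) ℤ.* rootProduct z xs ℤ.+ 0ℤ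
    ≡⟨ ℤₚ.+-identityʳ _ ⟩
  rootProduct z (x ∷ xs) ∎
  where open ≡-Reasoning

rootProduct-∈ : ∀ {z xs} → z ∈ xs → rootProduct z xs ≡ 0ℤ
rootProduct-∈ {z} {xs = _ ∷ xs} (here refl) = trans (cong (ℤ._* rootProduct z xs) (ℤₚ.+-inverseʳ z)) (ℤₚ.*-zeroˡ (rootProduct z xs))
rootProduct-∈ {z} {xs = x ∷ _}  (there z∈)  = trans (cong ((z ℤ.- x) ℤ.*_) (rootProduct-∈ z∈)) (ℤₚ.*-zeroʳ (z ℤ.- x))

module Modulo (p : ℕ) (p-prime : Prime p) where

  infix 4 _≈_
  _≈_ : ℤ → ℤ → Set
  x ≈ y = pos p ∣ℤ x ℤ.- y

  ≈-refl : ∀ {x} → x ≈ x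
  ≈-refl {x} = subst (pos p ∣ℤ_) (sym (ℤₚ.+-inverseʳ x)) (dividesℤ 0ℤ refl)

  ≡⇒≈ : ∀ {x y} → x ≡ y → x ≈ y
  ≡⇒≈ {x} refl = ≈-refl {x}

  ≈-sym : ∀ {x y} → x ≈ y → y ≈ x
  ≈-sym {x} {y} h = subst (pos p ∣ℤ_) (lemma x y) (ℤ∣.∣n⇒∣m*n (ℤ.- 1ℤ) h)
    where
    lemma : ∀ x y → ℤ.- 1ℤ ℤ.* (x ℤ.- y) ≡ y ℤ.- x
    lemma = ring

  ≈-trans : ∀ {x y z} → x ≈ y → y ≈ z → x ≈ z
  ≈-trans {x} {y} {z} h h′ = subst (pos p ∣ℤ_) (lemma x y z) (ℤ∣.∣m∣n⇒∣m+n h h′)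
    where
    lemma : ∀ x y z → x ℤ.- y ℤ.+ (y ℤ.- z) ≡ x ℤ.- z
    lemma = ring

  +-≈ : ∀ {x x′ y y′} → x ≈ x′ → y ≈ y′ → x ℤ.+ y ≈ x′ ℤ.+ y′
  +-≈ {x} {x′} {y} {y′} h h′ = subst (pos p ∣ℤ_) (lemma x x′ y y′) (ℤ∣.∣m∣n⇒∣m+n h h′)
    where
    lemma : ∀ x x′ y y′ → x ℤ.- x′ ℤ.+ (y ℤ.- y′) ≡ x ℤ.+ y ℤ.- (x′ ℤ.+ y′)
    lemma = ring

  *-≈ : ∀ {x x′ y y′} → x ≈ x′ → y ≈ y′ → x ℤ.* y ≈ x′ ℤ.* y′
  *-≈ {x} {x′} {y} {y′} h h′ = subst (pos p ∣ℤ_) (lemma x x′ y y′)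
    (ℤ∣.∣m∣n⇒∣m+n (ℤ∣.∣n⇒∣m*n y h) (ℤ∣.∣n⇒∣m*n x′ h′))
    where
    lemma : ∀ x x′ y y′ → y ℤ.* (x ℤ.- x′) ℤ.+ x′ ℤ.* (y ℤ.- y′) ≡ x ℤ.* y ℤ.- x′ ℤ.* y′
    lemma = ring

  euclid : ∀ x y → pos p ∣ℤ x ℤ.* y → pos p ∣ℤ x ⊎ pos p ∣ℤ y
  euclid x y h = Sum.map (ℤ∣.∣ᵤ⇒∣ {pos p} {x}) (ℤ∣.∣ᵤ⇒∣ {pos p} {y})
    (euclidsLemma ∣ x ∣ ∣ y ∣ p-prime (subst (p ∣_) (ℤₚ.abs-* x y) (ℤ∣.∣⇒∣ᵤ h)))

  small-unit : ∀ {r} → suc r < p → ¬ (pos p ∣ℤ pos (suc r))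
  small-unit r<p h = ℕₚ.<⇒≱ r<p (∣⇒≤ (ℤ∣.∣⇒∣ᵤ h))

  conv-≈ : ∀ {f f′ g g′} r → (∀ i → i ≤ r → f i ≈ f′ i) → (∀ i → i ≤ r → g i ≈ g′ i) →
           conv f g r ≈ conv f′ g′ r
  conv-≈ {f} {f′} {g} {g′} zero    hf hg = *-≈ {f 0} {f′ 0} {g 0} {g′ 0} (hf 0 z≤n) (hg 0 z≤n)
  conv-≈ {f} {f′} {g} {g′} (suc r) hf hg = +-≈ {conv (f ∘ suc) g r} {conv (f′ ∘ suc) g′ r}
    (conv-≈ r (λ i i≤r → hf (suc i) (s≤s i≤r)) (λ i i≤r → hg i (ℕₚ.m≤n⇒m≤1+n i≤r)))
    (*-≈ {f 0} {f′ 0} {g (suc r)} {g′ (suc r)} (hf 0 z≤n) (hg (suc r) ℕₚ.≤-refl))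

  horner-≈ : ∀ {s s′} z r → (∀ i → i ≤ r → s i ≈ s′ i) → horner s z r ≈ horner s′ z r
  horner-≈ z zero    h = h 0 z≤n
  horner-≈ {s} {s′} z (suc r) h = +-≈ {z ℤ.* horner s z r} {z ℤ.* horner s′ z r}
    (*-≈ {z} {z} {horner s z r} {horner s′ z r} (≈-refl {z}) (horner-≈ z r (λ i i≤r → h i (ℕₚ.m≤n⇒m≤1+n i≤r))))
    (h (suc r) ℕₚ.≤-refl)

  module _ {k : ℕ} (k<p : k < p) (xs ys : List ℤ)
           (power-sums : ∀ i → i < k → powerSum xs i ≈ powerSum ys i) where

    -- Newton's identities express `suc r` times the next coefficient through data already known to
    -- be congruent; since `suc r ≤ k < p`, the factor `suc r` can be cancelled.
    coeff-≈-suc : ∀ r → r < k → (∀ i → i ≤ r → coeff xs i ≈ coeff ys i) →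
                  coeff xs (suc r) ≈ coeff ys (suc r)
    coeff-≈-suc r r<k ih = [ (λ p∣r+1 → contradiction p∣r+1 (small-unit (ℕₚ.≤-<-trans r<k k<p))) , id ]′
      (euclid (pos (suc r)) (X ℤ.- Y) (subst (pos p ∣ℤ_) (lemma (pos (suc r)) X Y cX cY)
        (ℤ∣.∣m∣n⇒∣m+n
          (≡⇒≈ {pos (suc r) ℤ.* X ℤ.+ cX} {pos (suc r) ℤ.* Y ℤ.+ cY} (trans (newton xs r) (sym (newton ys r))))
          (≈-sym {cX} {cY} (conv-≈ r ih (λ i i≤r → power-sums i (ℕₚ.≤-<-trans i≤r r<k)))))))
      where
      X Y cX cY : ℤ
      X = coeff xs (suc r)
      Y = coeff ys (suc r)
      cX = conv (coeff xs) (powerSum xs) r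
      cY = conv (coeff ys) (powerSum ys) r
      lemma : ∀ c x y u v → c ℤ.* x ℤ.+ u ℤ.- (c ℤ.* y ℤ.+ v) ℤ.+ (v ℤ.- u) ≡ c ℤ.* (x ℤ.- y)
      lemma = ring

    coeff-≈ : ∀ r → r ≤ k → ∀ i → i ≤ r → coeff xs i ≈ coeff ys i
    coeff-≈ zero    _   zero _ = ≡⇒≈ (trans (coeff-zero xs) (sym (coeff-zero ys)))
      where
      coeff-zero : ∀ xs → coeff xs 0 ≡ 1ℤ
      coeff-zero []       = refl
      coeff-zero (x ∷ xs) = cong₂ ℤ._-_ (coeff-zero xs) (ℤₚ.*-zeroʳ x)
    coeff-≈ (suc r) r<k i i≤r+1 =
      [ (λ i<r+1 → ih i (ℕₚ.≤-pred i<r+1))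
      , (λ i≡r+1 → subst (λ i → coeff xs i ≈ coeff ys i) (sym i≡r+1) (coeff-≈-suc r r<k ih)) ]′
      (ℕₚ.m≤n⇒m<n∨m≡n i≤r+1)
      where
      ih : ∀ i → i ≤ r → coeff xs i ≈ coeff ys i
      ih = coeff-≈ r (ℕₚ.<⇒≤ r<k)

    -- The monic polynomials with roots `xs` and `ys` have congruent coefficients, so the second one
    -- also vanishes at `z` modulo `p`; as `p` is prime, one of its linear factors does.
    common-root : length xs ≡ length ys → length xs ≤ k → ∀ {z} → z ∈ xs → ∃[ y ] y ∈ ys × z ≈ y
    common-root same short {z} z∈xs = locate ys (subst (pos p ∣ℤ_) (ℤₚ.+-identityʳ _)
      (≈-trans {rootProduct z ys} {horner (coeff ys) z (length xs)} {0ℤ}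
        (≡⇒≈ (sym (trans (cong (horner (coeff ys) z) same) (horner-roots z ys))))
        (≈-trans {horner (coeff ys) z (length xs)} {horner (coeff xs) z (length xs)} {0ℤ}
          (≈-sym {horner (coeff xs) z (length xs)} {horner (coeff ys) z (length xs)}
            (horner-≈ z (length xs) (coeff-≈ (length xs) short)))
          (≡⇒≈ (trans (horner-roots z xs) (rootProduct-∈ z∈xs))))))
      where
      locate : ∀ ys → pos p ∣ℤ rootProduct z ys → ∃[ y ] y ∈ ys × z ≈ y
      locate []       h = contradiction (ℤ∣.∣⇒∣ᵤ h) (prime∤1 p-prime)
      locate (y ∷ ys) h with euclid (z ℤ.- y) (rootProduct z ys) h
      ... | inj₁ h′ = y , here refl , h′
      ... | inj₂ h′ = let (y′ , y′∈ , e) = locate ys h′ in y′ , there y′∈ , e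

  small-≈⇒≡ : ∀ {a b} → a < p → b < p → pos a ≈ pos b → a ≡ b
  small-≈⇒≡ {a} {b} a<p b<p h with ∣ pos a ℤ.- pos b ∣ in eq | ℤ∣.∣⇒∣ᵤ h
  ... | zero  | _   = ℤₚ.+-injective (ℤₚ.i-j≡0⇒i≡j (pos a) (pos b) (ℤₚ.∣i∣≡0⇒i≡0 eq))
  ... | suc c | p∣c = contradiction (∣⇒≤ p∣c) (ℕₚ.<⇒≱ (ℕₚ.≤-<-trans
    (subst (_≤ a ℕ.⊔ b) (trans (cong ∣_∣ (sym (ℤₚ.m-n≡m⊖n a b))) eq) (ℤₚ.∣m⊝n∣≤m⊔n a b))
    (ℕₚ.⊔-lub a<p b<p)))

-- Sums of points of the moment curve

encode : ℕ → ℕ → (ℕ → ℕ) → ℕ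
encode B zero    f = 0
encode B (suc k) f = f 0 + B * encode B k (f ∘ suc)

encode-< : ∀ B k {f} → (∀ i → f i < B) → encode B k f < B ^ k
encode-< B zero        f<B = s≤s z≤n
encode-< B (suc k) {f} f<B = begin-strict
  f 0 + B * encode B k (f ∘ suc) <⟨ ℕₚ.+-monoˡ-< (B * encode B k (f ∘ suc)) (f<B 0) ⟩
  B + B * encode B k (f ∘ suc)   ≡⟨ ℕₚ.*-suc B _ ⟨
  B * suc (encode B k (f ∘ suc)) ≤⟨ ℕₚ.*-monoʳ-≤ B (encode-< B k (f<B ∘ suc)) ⟩
  B * B ^ k                      ∎
  where open ℕₚ.≤-Reasoning

encode-injective : ∀ B k {f g} → (∀ i → f i < B) → (∀ i → g i < B) →
  encode B k f ≡ encode B k g → ∀ i → i < k → f i ≡ g i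
encode-injective B@(suc _) (suc k) {f} {g} f<B g<B eq = go
  where
  digit : ∀ {f} → (∀ i → f i < B) → encode B (suc k) f % B ≡ f 0
  digit {f} f<B = trans (cong (λ e → (f 0 + e) % B) (ℕₚ.*-comm B _))
    (trans ([m+kn]%n≡m%n (f 0) (encode B k (f ∘ suc)) B) (m<n⇒m%n≡m (f<B 0)))
  f0≡g0 : f 0 ≡ g 0
  f0≡g0 = trans (sym (digit f<B)) (trans (cong (_% B) eq) (digit g<B))
  rest : encode B k (f ∘ suc) ≡ encode B k (g ∘ suc)
  rest = ℕₚ.*-cancelˡ-≡ _ _ B (ℕₚ.+-cancelˡ-≡ (f 0) _ _ (trans eq (cong (_+ B * encode B k (g ∘ suc)) (sym f0≡g0))))
  go : ∀ i → i < suc k → f i ≡ g i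
  go zero    _         = f0≡g0
  go (suc i) (s≤s i<k) = encode-injective B k (f<B ∘ suc) (g<B ∘ suc) rest i i<k
encode-injective zero    (suc k) f<B g<B eq = contradiction (f<B 0) λ ()

encode-+ : ∀ B k f g → encode B k (λ i → f i + g i) ≡ encode B k f + encode B k g
encode-+ B zero    f g = refl
encode-+ B (suc k) f g = trans (cong (λ e → f 0 + g 0 + B * e) (encode-+ B k (f ∘ suc) (g ∘ suc)))
  (lemma (f 0) (g 0) B (encode B k (f ∘ suc)) (encode B k (g ∘ suc)))
  where
  lemma : ∀ a b B u v → a + b + B * (u + v) ≡ a + B * u + (b + B * v)
  lemma = solve-∀

encode-0 : ∀ B k → encode B k (λ _ → 0) ≡ 0
encode-0 B zero    = refl
encode-0 B (suc k) = trans (cong (B *_) (encode-0 B k)) (ℕₚ.*-zeroʳ B)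

-- The moment curve a ↦ (a , a² , … , aᵏ) over ℤ/p, its coordinates read as digits. The base
-- leaves room for adding k of its points without carries.
module MomentCurve (p k : ℕ) (p-prime : Prime p) (0<k : 0 < k) (k<p : k < p) where
  private instance
    p≢0 : NonZero p
    p≢0 = prime⇒nonZero p-prime

  open Modulo p p-prime

  base : ℕ
  base = suc (k * p)

  digit : ℕ → ℕ → ℕ
  digit a i = a ^ suc i % p

  point : ℕ → ℕ
  point a = encode base k (digit a)

  digit<base : ∀ a i → digit a i < base
  digit<base a i = ℕₚ.≤-trans (m%n<n (a ^ suc i) p)
    (ℕₚ.≤-trans (ℕₚ.m≤n*m p k {{ℕ.>-nonZero 0<k}}) (ℕₚ.n≤1+n (k * p)))

  point<base^k : ∀ a → point a < base ^ k
  point<base^k a = encode-< base k (digit<base a)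

  digit-zero : ∀ {a} → a < p → digit a 0 ≡ a
  digit-zero {a} a<p = trans (cong (_% p) (ℕₚ.*-identityʳ a)) (m<n⇒m%n≡m a<p)

  -- The first digit of `point a` is `a` itself when `a < p`.
  point-injective : ∀ {a b} → a < p → b < p → point a ≡ point b → a ≡ b
  point-injective {a} {b} a<p b<p eq = trans (sym (digit-zero a<p))
    (trans (encode-injective base k (digit<base a) (digit<base b) eq 0 0<k) (digit-zero b<p))

  point>0 : ∀ {a} → 0 < a → a < p → 0 < point a
  point>0 {a} 0<a a<p = ℕₚ.n≢0⇒n>0 λ eq → ℕₚ.<⇒≢ 0<a (sym (trans (sym (digit-zero a<p))
    (encode-injective base k (digit<base a) (λ _ → s≤s z≤n) (trans eq (sym (encode-0 base k))) 0 0<k)))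

  digitSum : List ℕ → ℕ → ℕ
  digitSum as i = listSum (map (λ a → digit a i) as)

  sum-points : ∀ as → listSum (map point as) ≡ encode base k (digitSum as)
  sum-points []       = sym (encode-0 base k)
  sum-points (a ∷ as) = trans (cong (λ s → point a + s) (sum-points as)) (sym (encode-+ base k (digit a) (digitSum as)))

  digitSum<base : ∀ as → length as ≤ k → ∀ i → digitSum as i < base
  digitSum<base as short i = s≤s (ℕₚ.≤-trans (bound as) (ℕₚ.*-monoˡ-≤ p short))
    where
    bound : ∀ as → digitSum as i ≤ length as * p
    bound []       = z≤n
    bound (a ∷ as) = ℕₚ.+-mono-≤ (ℕₚ.<⇒≤ (m%n<n (a ^ suc i) p)) (bound as)

  powerSum≈digitSum : ∀ as i → powerSum (map pos as) i ≈ pos (digitSum as i)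
  powerSum≈digitSum []       i = ≈-refl {0ℤ}
  powerSum≈digitSum (a ∷ as) i = +-≈ {pos a ℤ.^ suc i} {pos (digit a i)} {powerSum (map pos as) i} {pos (digitSum as i)}
    (dividesℤ (pos (a ^ suc i / p)) (begin
      pos a ℤ.^ suc i ℤ.- pos (digit a i)
        ≡⟨ cong (ℤ._- pos (digit a i)) (pos-^ (suc i)) ⟩
      pos (a ^ suc i) ℤ.- pos (digit a i)
        ≡⟨ cong (λ x → pos x ℤ.- pos (digit a i)) (m≡m%n+[m/n]*n (a ^ suc i) p) ⟩
      pos (digit a i + a ^ suc i / p * p) ℤ.- pos (digit a i)
        ≡⟨ cong (λ x → (pos (digit a i) ℤ.+ x) ℤ.- pos (digit a i)) (ℤₚ.pos-* (a ^ suc i / p) p) ⟩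
      (pos (digit a i) ℤ.+ pos (a ^ suc i / p) ℤ.* pos p) ℤ.- pos (digit a i)
        ≡⟨ lemma (pos (digit a i)) (pos (a ^ suc i / p) ℤ.* pos p) ⟩
      pos (a ^ suc i / p) ℤ.* pos p ∎))
    (powerSum≈digitSum as i)
    where
    open ≡-Reasoning
    pos-^ : ∀ i → pos a ℤ.^ i ≡ pos (a ^ i)
    pos-^ zero    = refl
    pos-^ (suc i) = trans (cong (pos a ℤ.*_) (pos-^ i)) (sym (ℤₚ.pos-* a (a ^ i)))
    lemma : ∀ u v → u ℤ.+ v ℤ.- u ≡ v
    lemma = ring

  -- The digits of the sum are the digit sums, as no carries occur, and modulo `p` these are the
  -- power sums of the residues. Membership without multiplicity is enough for locating a second
  -- edge with a given difference.
  sum-determines : ∀ as bs → length as ≡ length bs → length as ≤ k → All (_< p) as → All (_< p) bs →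
    listSum (map point as) ≡ listSum (map point bs) → ∀ {a} → a ∈ as → a ∈ bs
  sum-determines as bs same short as<p bs<p eq {a} a∈ =
    let (_ , y∈ , a≈y) = common-root k<p (map pos as) (map pos bs) power-sums
          (trans (Listₚ.length-map pos as) (trans same (sym (Listₚ.length-map pos bs))))
          (subst (_≤ k) (sym (Listₚ.length-map pos as)) short) (∈-map⁺ pos a∈)
        (b , b∈ , y≡b) = ∈-map⁻ pos y∈
    in subst (_∈ bs) (sym (small-≈⇒≡ (All.lookup as<p a∈) (All.lookup bs<p b∈) (subst (pos a ≈_) y≡b a≈y))) b∈
    where
    digits : ∀ i → i < k → digitSum as i ≡ digitSum bs i
    digits = encode-injective base k (digitSum<base as short) (digitSum<base bs (subst (_≤ k) same short))
      (trans (sym (sum-points as)) (trans eq (sum-points bs)))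
    power-sums : ∀ i → i < k → powerSum (map pos as) i ≈ powerSum (map pos bs) i
    power-sums i i<k = ≈-trans {powerSum (map pos as) i} {pos (digitSum as i)} {powerSum (map pos bs) i}
      (powerSum≈digitSum as i)
      (≈-sym {powerSum (map pos bs) i} {pos (digitSum as i)}
        (subst (λ x → powerSum (map pos bs) i ≈ pos x) (sym (digits i i<k)) (powerSum≈digitSum bs i)))

-- A graph without bordered cycles

%-suc : ∀ t ℓ .{{_ : NonZero ℓ}} →
  suc (t % ℓ) ≡ suc t % ℓ ⊎ (suc (t % ℓ) ≡ ℓ × suc t % ℓ ≡ 0)
%-suc t ℓ = Sum.map (λ lt → sym (trans reduce (m<n⇒m%n≡m lt)))
                    (λ eq → eq , trans reduce (trans (cong (_% ℓ) eq) (n%n≡0 ℓ)))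
                    (ℕₚ.m≤n⇒m<n∨m≡n (m%n<n t ℓ))
  where
  reduce : suc t % ℓ ≡ suc (t % ℓ) % ℓ
  reduce = trans (cong (λ x → suc x % ℓ) (m≡m%n+[m/n]*n t ℓ)) ([m+kn]%n≡m%n (suc (t % ℓ)) (t / ℓ) ℓ)

%-distinct : ∀ {t t′} ℓ .{{_ : NonZero ℓ}} → t < t′ → t′ < t + ℓ → t % ℓ ≢ t′ % ℓ
%-distinct {t} {t′} ℓ t<t′ t′<t+ℓ eq = ℕₚ.<⇒≱ t′<t+ℓ (begin
  t + ℓ                      ≡⟨ cong (_+ ℓ) (m≡m%n+[m/n]*n t ℓ) ⟩
  t % ℓ + t / ℓ * ℓ + ℓ      ≡⟨ ℕₚ.+-assoc (t % ℓ) _ ℓ ⟩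
  t % ℓ + (t / ℓ * ℓ + ℓ)    ≡⟨ cong (λ x → t % ℓ + x) (ℕₚ.+-comm (t / ℓ * ℓ) ℓ) ⟩
  t % ℓ + suc (t / ℓ) * ℓ    ≤⟨ ℕₚ.+-monoʳ-≤ (t % ℓ) (ℕₚ.*-monoˡ-≤ ℓ quotient<) ⟩
  t % ℓ + t′ / ℓ * ℓ         ≡⟨ cong (λ x → x + t′ / ℓ * ℓ) eq ⟩
  t′ % ℓ + t′ / ℓ * ℓ        ≡⟨ m≡m%n+[m/n]*n t′ ℓ ⟨
  t′                         ∎)
  where
  open ℕₚ.≤-Reasoning
  quotient< : t / ℓ < t′ / ℓ
  quotient< = ℕₚ.*-cancelʳ-< ℓ (t / ℓ) (t′ / ℓ) (ℕₚ.+-cancelˡ-< (t % ℓ) _ _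
    (subst₂ _<_ (m≡m%n+[m/n]*n t ℓ) (trans (m≡m%n+[m/n]*n t′ ℓ) (cong (λ x → x + t′ / ℓ * ℓ) (sym eq))) t<t′))

listSum-map-applyUpTo : ∀ (f : ℕ → ℕ) g j → listSum (map f (applyUpTo g j)) ≡ listSum (applyUpTo (f ∘ g) j)
listSum-map-applyUpTo f g j = cong listSum (Listₚ.map-applyUpTo g f j)

listSum-+ : ∀ (f g : ℕ → ℕ) j →
  listSum (applyUpTo (λ r → f r + g r) j) ≡ listSum (applyUpTo f j) + listSum (applyUpTo g j)
listSum-+ f g zero    = refl
listSum-+ f g (suc j) = trans (cong (λ s → f 0 + g 0 + s) (listSum-+ (f ∘ suc) (g ∘ suc) j))
  (lemma (f 0) (g 0) (listSum (applyUpTo (f ∘ suc) j)) (listSum (applyUpTo (g ∘ suc) j)))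
  where
  lemma : ∀ a b u v → a + b + (u + v) ≡ a + u + (b + v)
  lemma = solve-∀

listSum-cong : ∀ {f g : ℕ → ℕ} j → (∀ r → f r ≡ g r) → listSum (applyUpTo f j) ≡ listSum (applyUpTo g j)
listSum-cong zero    eq = refl
listSum-cong (suc j) eq = cong₂ _+_ (eq 0) (listSum-cong j (eq ∘ suc))

listSum-rotate : ∀ (f : ℕ → ℕ) j → f j + listSum (applyUpTo f j) ≡ f 0 + listSum (applyUpTo (f ∘ suc) j)
listSum-rotate f zero    = refl
listSum-rotate f (suc j) = begin
  f (suc j) + (f 0 + listSum (applyUpTo (f ∘ suc) j))
    ≡⟨ exchange (f (suc j)) (f 0) _ ⟩
  f 0 + (f (suc j) + listSum (applyUpTo (f ∘ suc) j))
    ≡⟨ cong (λ s → f 0 + s) (listSum-rotate (f ∘ suc) j) ⟩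
  f 0 + (f 1 + listSum (applyUpTo (λ r → f (suc (suc r))) j)) ∎
  where
  open ≡-Reasoning
  exchange : ∀ a b c → a + (b + c) ≡ b + (a + c)
  exchange = solve-∀

fromMatrix-< : ∀ (M : Fin n → Fin n → Bool) {u v} → u Fin.< v → OrderedGraph.adj (fromMatrix M) u v ≡ M u v
fromMatrix-< M {u} {v} u<v with u Finₚ.<? v | v Finₚ.<? u
... | yes _ | _     = refl
... | no ≮  | _     = contradiction u<v ≮

injective⇒≤length : ∀ {A : Set} {xs : List A} (f : Fin m → A) → Injective _≡_ _≡_ f →
  (∀ i → f i ∈ xs) → m ≤ length xs
injective⇒≤length {xs = xs} f inj f∈ = Finₚ.injective⇒≤ {f = Any.index ∘ f∈} λ {i} {j} eq →
  inj (trans (Anyₚ.lookup-index (f∈ i)) (trans (cong (List.lookup xs) eq) (sym (Anyₚ.lookup-index (f∈ j)))))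

module LowerGraph (n p k : ℕ) (p-prime : Prime p) (0<k : 0 < k) (k<p : k < p) where
  open MomentCurve p k p-prime 0<k k<p

  -- The residue 0 is left out because `point 0` is 0 and not a positive difference.
  Label : Fin n → Fin n → Fin p → Set
  Label u v a = 0 < toℕ a × toℕ v ≡ toℕ u + point (toℕ a)

  label? : ∀ u v → Dec (∃[ a ] Label u v a)
  label? u v = Finₚ.any? λ a → (0 ℕ.<? toℕ a) ×-dec (toℕ v ℕ.≟ toℕ u + point (toℕ a))

  graph : OrderedGraph n
  graph = fromMatrix λ u v → does (label? u v)

  label : ∀ {u v} → u Fin.< v → Adj graph u v → ∃[ a ] Label u v a
  label {u} {v} u<v a = T-does⇒ (label? u v) (subst T (fromMatrix-< _ u<v) a)

  labelled : ∀ {u v} → u Fin.< v → ∃[ a ] Label u v a → Adj graph u v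
  labelled {u} {v} u<v l = subst T (sym (fromMatrix-< _ u<v)) (T-does⇐ (label? u v) l)

  module _ {j : ℕ} (2≤j : 2 ≤ j) (j≤k : j ≤ k) {τ : Fin n} {w : Fin (2 * j) → Fin n}
           (trace : BorderedTrace graph τ w) where
    open BorderedTrace trace

    private
      ℓ′ : ℕ
      ℓ′ = 2 * j

      instance
        ℓ≢0 : NonZero ℓ′
        ℓ≢0 = ℕ.>-nonZero (ℕₚ.≤-trans (s≤s z≤n) (ℕₚ.*-monoʳ-≤ 2 2≤j))

      -- Extending the cyclic sequence periodically to all of ℕ removes the wrap-around case: `W t`
      -- is always followed by `W (suc t)`.
      index : ℕ → Fin ℓ′
      index t = fromℕ< (m%n<n t ℓ′)

      W : ℕ → Fin n
      W t = w (index t)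

      toℕ-index : ∀ t → toℕ (index t) ≡ t % ℓ′
      toℕ-index t = Finₚ.toℕ-fromℕ< (m%n<n t ℓ′)

      W-cong : ∀ {t} i → t % ℓ′ ≡ toℕ i → W t ≡ w i
      W-cong {t} i eq = cong w (Finₚ.toℕ-injective (trans (toℕ-index t) eq))

      W-toℕ : ∀ i → W (toℕ i) ≡ w i
      W-toℕ i = W-cong i (m<n⇒m%n≡m (Finₚ.toℕ<n i))

      W-periodic : ∀ t → W (t + ℓ′) ≡ W t
      W-periodic t = W-cong (index t) (trans ([m+n]%n≡m%n t ℓ′) (sym (toℕ-index t)))

      W-distinct : ∀ {t t′} → t < t′ → t′ < t + ℓ′ → W t ≢ W t′
      W-distinct {t} {t′} lt lt′ eq = %-distinct ℓ′ lt lt′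
        (trans (sym (toℕ-index t)) (trans (cong toℕ (injective _ _ eq)) (toℕ-index t′)))

      W-edge : ∀ t → Adj graph (W t) (W (suc t)) × (Crosses τ (W t) (W (suc t)) ⊎ Crosses τ (W (suc t)) (W t))
      W-edge t = edge (index t) (index (suc t)) (Sum.map
        (λ e → trans (cong suc (toℕ-index t)) (trans e (sym (toℕ-index (suc t)))))
        (λ (e , e′) → trans (cong suc (toℕ-index t)) e , trans (toℕ-index (suc t)) e′)
        (%-suc t ℓ′))

      upward : ∀ t → W t Fin.≤ τ → τ Fin.< W (suc t) × Σ[ a ∈ Fin p ] Label (W t) (W (suc t)) a
      upward t t≤τ with W-edge t
      ... | adj , inj₁ (_ , τ<) = τ< , label (ℕₚ.≤-<-trans t≤τ τ<) adj
      ... | _   , inj₂ (_ , τ<) = contradiction t≤τ (ℕₚ.<⇒≱ τ<)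

      downward : ∀ t → τ Fin.< W t → W (suc t) Fin.≤ τ × Σ[ a ∈ Fin p ] Label (W (suc t)) (W t) a
      downward t τ<t with W-edge t
      ... | _   , inj₁ (t≤τ , _) = contradiction t≤τ (ℕₚ.<⇒≱ τ<t)
      ... | adj , inj₂ (t≤τ , _) = t≤τ ,
        label (ℕₚ.≤-<-trans t≤τ τ<t) (subst T (OrderedGraph.sym graph (W t) (W (suc t))) adj)

    module _ (o : Fin (2 * j)) (o≤τ : w o Fin.≤ τ) where

      -- Defined by recursion rather than as `toℕ o + 2 * r`, so that two steps of the walk lead
      -- from `X r` to `X (suc r)` by definition.
      position : ℕ → ℕ
      position zero    = toℕ o
      position (suc r) = suc (suc (position r))

      position≡ : ∀ r → position r ≡ toℕ o + 2 * r
      position≡ zero    = sym (ℕₚ.+-identityʳ (toℕ o))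
      position≡ (suc r) = trans (cong (λ x → suc (suc x)) (position≡ r)) (shift (toℕ o) r)
        where
        shift : ∀ b r → suc (suc (b + 2 * r)) ≡ b + 2 * suc r
        shift = solve-∀

      private
        position-< : ∀ {r r′} → r < r′ → position r < position r′
        position-< {r} {r′} r<r′ = subst₂ _<_ (sym (position≡ r)) (sym (position≡ r′))
          (ℕₚ.+-monoʳ-< (toℕ o) (ℕₚ.*-monoʳ-< 2 r<r′))

        position-bound : ∀ {r r′} → r′ < j → position r′ < position r + ℓ′
        position-bound {r} {r′} r′<j = subst₂ _<_ (sym (position≡ r′)) refl
          (ℕₚ.<-≤-trans (ℕₚ.+-monoʳ-< (toℕ o) (ℕₚ.*-monoʳ-< 2 r′<j))
            (ℕₚ.+-monoˡ-≤ ℓ′ (subst (toℕ o ≤_) (sym (position≡ r)) (ℕₚ.m≤m+n (toℕ o) (2 * r)))))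

      -- From `o` on, the walk alternates between lower vertices `X r` and upper vertices `Y r`.
      -- Below, `α r` belongs to the edge from `X r` to `Y r`, and `β r` to the edge from `Y r` to
      -- `X (suc r)`.
      X Y : ℕ → Fin n
      X r = W (position r)
      Y r = W (suc (position r))

      X≤τ : ∀ r → X r Fin.≤ τ
      τ<Y : ∀ r → τ Fin.< Y r
      X≤τ zero    = subst (Fin._≤ τ) (sym (W-toℕ o)) o≤τ
      X≤τ (suc r) = proj₁ (downward (suc (position r)) (τ<Y r))
      τ<Y r       = proj₁ (upward (position r) (X≤τ r))

      X0 : X 0 ≡ w o
      X0 = W-toℕ o

      Xj : X j ≡ X 0
      Xj = trans (cong W (position≡ j)) (W-periodic (toℕ o))

      X-distinct : ∀ {r r′} → r < r′ → r′ < j → X r ≢ X r′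
      X-distinct {r} {r′} r<r′ r′<j = W-distinct (position-< r<r′) (position-bound {r} {r′} r′<j)

      Y-distinct : ∀ {r r′} → r < r′ → r′ < j → Y r ≢ Y r′
      Y-distinct {r} {r′} r<r′ r′<j = W-distinct (s≤s (position-< r<r′)) (s≤s (position-bound {r} {r′} r′<j))

      α β : ℕ → ℕ
      α r = toℕ (proj₁ (proj₂ (upward (position r) (X≤τ r))))
      β r = toℕ (proj₁ (proj₂ (downward (suc (position r)) (τ<Y r))))

      α-label : ∀ r → toℕ (Y r) ≡ toℕ (X r) + point (α r)
      α-label r = proj₂ (proj₂ (proj₂ (upward (position r) (X≤τ r))))

      β-label : ∀ r → toℕ (Y r) ≡ toℕ (X (suc r)) + point (β r)
      β-label r = proj₂ (proj₂ (proj₂ (downward (suc (position r)) (τ<Y r))))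

      αs βs : List ℕ
      αs = applyUpTo α j
      βs = applyUpTo β j

      αs<p : All (_< p) αs
      αs<p = Allₚ.applyUpTo⁺₂ α j (λ r → Finₚ.toℕ<n _)

      βs<p : All (_< p) βs
      βs<p = Allₚ.applyUpTo⁺₂ β j (λ r → Finₚ.toℕ<n _)

      same-length : length αs ≡ length βs
      same-length = trans (Listₚ.length-applyUpTo α j) (sym (Listₚ.length-applyUpTo β j))

      -- The sum of all `Y r` is computed once from the preceding and once from the following lower
      -- vertices. Both times the lower vertices have the same sum, because `X j` is `X 0`.
      same-sum : listSum (map point αs) ≡ listSum (map point βs)
      same-sum = ℕₚ.+-cancelˡ-≡ (listSum (applyUpTo x j)) _ _ (begin
        listSum (applyUpTo x j) + listSum (map point αs)
          ≡⟨ cong (λ s → listSum (applyUpTo x j) + s) (listSum-map-applyUpTo point α j) ⟩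
        listSum (applyUpTo x j) + listSum (applyUpTo (point ∘ α) j)
          ≡⟨ listSum-+ x (point ∘ α) j ⟨
        listSum (applyUpTo (λ r → x r + point (α r)) j)
          ≡⟨ listSum-cong j (λ r → trans (sym (α-label r)) (β-label r)) ⟩
        listSum (applyUpTo (λ r → x (suc r) + point (β r)) j)
          ≡⟨ listSum-+ (x ∘ suc) (point ∘ β) j ⟩
        listSum (applyUpTo (x ∘ suc) j) + listSum (applyUpTo (point ∘ β) j)
          ≡⟨ cong₂ _+_ (sym rotate) (sym (listSum-map-applyUpTo point β j)) ⟩
        listSum (applyUpTo x j) + listSum (map point βs) ∎)
        where
        open ≡-Reasoning
        x : ℕ → ℕ
        x = toℕ ∘ X
        rotate : listSum (applyUpTo x j) ≡ listSum (applyUpTo (x ∘ suc) j)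
        rotate = ℕₚ.+-cancelˡ-≡ (x 0) _ _
          (trans (cong (λ y → toℕ y + listSum (applyUpTo x j)) (sym Xj)) (listSum-rotate x j))

      αs-short : length αs ≤ k
      αs-short = subst (_≤ k) (sym (Listₚ.length-applyUpTo α j)) j≤k

      α∈βs : ∀ {r} → r < j → ∃[ s ] s < j × α r ≡ β s
      α∈βs r<j = ∈-applyUpTo⁻ β (sum-determines αs βs same-length αs-short αs<p βs<p same-sum (∈-applyUpTo⁺ α r<j))

      β∈αs : ∀ {r} → r < j → ∃[ s ] s < j × β r ≡ α s
      β∈αs r<j = ∈-applyUpTo⁻ α (sum-determines βs αs (sym same-length) (subst (_≤ k) same-length αs-short)
        βs<p αs<p (sym same-sum) (∈-applyUpTo⁺ β r<j))

    -- The outer border is the only edge of the cycle with its difference: the difference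
    -- determines both endpoints, as they are extreme.
    same-difference : ∀ {x x₀ y y₀ : Fin n} {d} → x₀ Fin.≤ x → y Fin.≤ y₀ →
      toℕ y ≡ toℕ x + d → toℕ y₀ ≡ toℕ x₀ + d → x ≡ x₀ × y ≡ y₀
    same-difference {x} {x₀} {y} {y₀} {d} x₀≤x y≤y₀ ey ey₀ =
      Finₚ.toℕ-injective x≡ , Finₚ.toℕ-injective (trans ey (trans (cong (_+ d) x≡) (sym ey₀)))
      where
      x≡ : toℕ x ≡ toℕ x₀
      x≡ = ℕₚ.≤-antisym (ℕₚ.+-cancelʳ-≤ d (toℕ x) (toℕ x₀) (subst₂ _≤_ ey ey₀ y≤y₀)) x₀≤x

    -- The trace may run through the outer border in either direction. Started at `o`, it meets the
    -- border as its first edge, with difference from `α 0`, or as its last one, with difference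
    -- from `β j′` where `j′` is `j` minus one. The same difference in the other class belongs to
    -- another edge of the cycle, which would have both ends in common with the border.
    no-trace : ⊥
    no-trace with outer
    ... | o , o′ , mkOuter (inj₁ next) (o≤τ , _) extreme = contradiction (proj₂ equal) Y≢
      where
      0<j : 0 < j
      0<j = ℕₚ.≤-trans (s≤s z≤n) 2≤j
      Y0 : Y o o≤τ 0 ≡ w o′
      Y0 = W-cong o′ (next-% next)
        where
        next-% : CyclicSucc o o′ → suc (toℕ o) % ℓ′ ≡ toℕ o′
        next-% (inj₁ e)        = trans (cong (_% ℓ′) e) (m<n⇒m%n≡m (Finₚ.toℕ<n o′))
        next-% (inj₂ (e , e′)) = trans (cong (_% ℓ′) e) (trans (n%n≡0 ℓ′) (sym e′))
      s : ℕ
      s = proj₁ (α∈βs o o≤τ 0<j)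
      equal : X o o≤τ (suc s) ≡ w o × Y o o≤τ s ≡ w o′
      equal = same-difference (proj₁ (extreme _) (X≤τ o o≤τ (suc s))) (proj₂ (extreme _) (τ<Y o o≤τ s))
        (β-label o o≤τ s)
        (subst₂ (λ x y → toℕ y ≡ toℕ x + point (β o o≤τ s)) (X0 o o≤τ) Y0
          (trans (α-label o o≤τ 0) (cong (λ a → toℕ (X o o≤τ 0) + point a) (proj₂ (proj₂ (α∈βs o o≤τ 0<j))))))
      Y≢ : Y o o≤τ s ≢ w o′
      Y≢ eq = go s (proj₁ (proj₂ (α∈βs o o≤τ 0<j))) (proj₁ equal) (trans eq (sym Y0))
        where
        -- For `s = 0` the edge found shares its upper end with the border, but its lower end is
        -- `X 1`, which differs from `X 0` because `j` is at least 2. For larger `s` the upper end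
        -- is already a different one.
        go : ∀ s → s < j → X o o≤τ (suc s) ≡ w o → Y o o≤τ s ≢ Y o o≤τ 0
        go zero    _   eX _  = X-distinct o o≤τ (s≤s z≤n) 2≤j (trans (X0 o o≤τ) (sym eX))
        go (suc s) s<j _  eY = Y-distinct o o≤τ (s≤s z≤n) s<j (sym eY)
    ... | o , o′ , mkOuter (inj₂ next) (o≤τ , _) extreme = contradiction (proj₁ equal) X≢
      where
      j′ : ℕ
      j′ = ℕ.pred j
      suc-j′ : suc j′ ≡ j
      suc-j′ = ℕₚ.suc-pred j {{ℕ.>-nonZero (ℕₚ.≤-trans (s≤s z≤n) 2≤j)}}
      j′<j : j′ < j
      j′<j = ℕₚ.≤-reflexive suc-j′
      Xsj′ : X o o≤τ (suc j′) ≡ w o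
      Xsj′ = trans (cong (X o o≤τ) suc-j′) (trans (Xj o o≤τ) (X0 o o≤τ))
      Yj′ : Y o o≤τ j′ ≡ w o′
      Yj′ = W-cong o′ (trans (cong (λ t → suc t % ℓ′) (position≡ o o≤τ j′)) (previous-% next))
        where
        double-suc : 2 * suc j′ ≡ ℓ′
        double-suc = cong (2 *_) suc-j′
        previous-% : CyclicSucc o′ o → suc (toℕ o + 2 * j′) % ℓ′ ≡ toℕ o′
        previous-% (inj₁ e) = trans (cong (_% ℓ′) (trans (cong (λ b → suc (b + 2 * j′)) (sym e)) shifted))
          (trans ([m+n]%n≡m%n (toℕ o′) ℓ′) (m<n⇒m%n≡m (Finₚ.toℕ<n o′)))
          where
          rearrange : ∀ b r → suc (suc b + 2 * r) ≡ b + 2 * suc r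
          rearrange = solve-∀
          shifted : suc (suc (toℕ o′) + 2 * j′) ≡ toℕ o′ + ℓ′
          shifted = trans (rearrange (toℕ o′) j′) (cong (λ l → toℕ o′ + l) double-suc)
        previous-% (inj₂ (e , e′)) = trans (cong (_% ℓ′) (trans (cong (λ b → suc (b + 2 * j′)) e′) last-index))
          (m<n⇒m%n≡m (Finₚ.toℕ<n o′))
          where
          last-index : suc (2 * j′) ≡ toℕ o′
          last-index = ℕₚ.suc-injective (trans (sym (ℕₚ.*-suc 2 j′)) (trans double-suc (sym e)))
      s : ℕ
      s = proj₁ (β∈αs o o≤τ j′<j)
      equal : X o o≤τ s ≡ w o × Y o o≤τ s ≡ w o′
      equal = same-difference (proj₁ (extreme _) (X≤τ o o≤τ s)) (proj₂ (extreme _) (τ<Y o o≤τ s))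
        (α-label o o≤τ s)
        (subst₂ (λ x y → toℕ y ≡ toℕ x + point (α o o≤τ s)) Xsj′ Yj′
          (trans (β-label o o≤τ j′) (cong (λ a → toℕ (X o o≤τ (suc j′)) + point a) (proj₂ (proj₂ (β∈αs o o≤τ j′<j))))))
      X≢ : X o o≤τ s ≢ w o
      X≢ eq = go s (proj₁ (proj₂ (β∈αs o o≤τ j′<j))) (trans eq (sym (X0 o o≤τ))) (proj₂ equal)
        where
        go : ∀ s → s < j → X o o≤τ s ≡ X o o≤τ 0 → Y o o≤τ s ≢ w o′
        go zero    _   _  eY = Y-distinct o o≤τ (ℕₚ.≤-pred (subst (2 ≤_) (sym suc-j′) 2≤j)) j′<j (trans eY (sym Yj′))
        go (suc s) s<j eX _  = X-distinct o o≤τ (s≤s z≤n) s<j (sym eX)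

  graph-avoids : ¬ HasShortBordered k graph
  graph-avoids (j , 2≤j , j≤k , τ , w , trace) = no-trace 2≤j j≤k trace

  module _ (M : ℕ) (M+base^k≤n : M + base ^ k ≤ n) where

    private
      q : ℕ
      q = ℕ.pred p

      suc-q : suc q ≡ p
      suc-q = ℕₚ.suc-pred p {{ℕ.>-nonZero (ℕₚ.≤-<-trans z≤n k<p)}}

      start : Fin M × Fin q → ℕ
      start (u , _) = toℕ u

      shift : Fin M × Fin q → ℕ
      shift (_ , a) = point (suc (toℕ a))

      suc-a<p : ∀ (a : Fin q) → suc (toℕ a) < p
      suc-a<p a = subst (suc (toℕ a) <_) suc-q (s≤s (Finₚ.toℕ<n a))

      end<n : ∀ c → start c + shift c < n
      end<n (u , a) = ℕₚ.<-≤-trans (ℕₚ.+-mono-< (Finₚ.toℕ<n u) (point<base^k (suc (toℕ a)))) M+base^k≤n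

      start<n : ∀ c → start c < n
      start<n c = ℕₚ.≤-<-trans (ℕₚ.m≤m+n (start c) (shift c)) (end<n c)

      edgeAt : Fin M × Fin q → Fin n × Fin n
      edgeAt c = fromℕ< (start<n c) , fromℕ< (end<n c)

      edgeAt-injective : ∀ {c c′} → edgeAt c ≡ edgeAt c′ → c ≡ c′
      edgeAt-injective {c@(u , a)} {c′@(u′ , a′)} eq = cong₂ _,_ (Finₚ.toℕ-injective starts)
        (Finₚ.toℕ-injective (ℕₚ.suc-injective (point-injective (suc-a<p a) (suc-a<p a′)
          (ℕₚ.+-cancelˡ-≡ (toℕ u) _ _ (trans ends (cong (λ x → x + shift c′) (sym starts)))))))
        where
        starts : toℕ u ≡ toℕ u′
        starts = trans (sym (Finₚ.toℕ-fromℕ< (start<n c))) (trans (cong (toℕ ∘ proj₁) eq) (Finₚ.toℕ-fromℕ< (start<n c′)))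
        ends : start c + shift c ≡ start c′ + shift c′
        ends = trans (sym (Finₚ.toℕ-fromℕ< (end<n c))) (trans (cong (toℕ ∘ proj₂) eq) (Finₚ.toℕ-fromℕ< (end<n c′)))

      edgeAt-∈ : ∀ c → edgeAt c ∈ OrderedGraph.edges graph
      edgeAt-∈ c@(u , a) = ∈-filter⁺ _ (∈-cartesianProduct⁺ (∈-allFin _) (∈-allFin _))
        (below , labelled below (fromℕ< (suc-a<p a)
          , subst (0 <_) (sym (Finₚ.toℕ-fromℕ< (suc-a<p a))) (s≤s z≤n)
          , trans (Finₚ.toℕ-fromℕ< (end<n c)) (cong₂ (λ x y → x + point y)
              (sym (Finₚ.toℕ-fromℕ< (start<n c))) (sym (Finₚ.toℕ-fromℕ< (suc-a<p a))))))
        where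
        below : fromℕ< (start<n c) Fin.< fromℕ< (end<n c)
        below = subst₂ _<_ (sym (Finₚ.toℕ-fromℕ< (start<n c))) (sym (Finₚ.toℕ-fromℕ< (end<n c)))
          (ℕₚ.m<m+n (start c) (point>0 (s≤s z≤n) (suc-a<p a)))

    -- Each start below `M` can be combined with each nonzero residue, since every difference is
    -- below `base ^ k` and the other end stays below `n`.
    graph-edgeCount : M * ℕ.pred p ≤ edgeCount graph
    graph-edgeCount = injective⇒≤length (edgeAt ∘ Fin.remQuot {M} q)
      (λ {i} {i′} eq → trans (sym (Finₚ.combine-remQuot {M} q i))
        (trans (cong (λ (u , a) → Fin.combine u a) (edgeAt-injective eq)) (Finₚ.combine-remQuot {M} q i′)))
      (λ i → edgeAt-∈ (Fin.remQuot {M} q i))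

-- Asymptotics

-- `u` is raised from `u₀` as long as `g (suc u)` does not exceed `n`. Since `u ≤ g u`, this ends
-- before `u` can pass `n`, so `n` is enough fuel.
bracket : ∀ (g : ℕ → ℕ) n u₀ → (∀ u → u ≤ g u) → g u₀ ≤ n → ∃[ u ] u₀ ≤ u × g u ≤ n × n < g (suc u)
bracket g n u₀ grows g≤n = go n u₀ ℕₚ.≤-refl (ℕₚ.m≤m+n n u₀) g≤n
  where
  go : ∀ fuel u → u₀ ≤ u → n ≤ fuel + u → g u ≤ n → ∃[ u ] u₀ ≤ u × g u ≤ n × n < g (suc u)
  go fuel u u₀≤u n≤ gu≤n with n ℕ.<? g (suc u)
  ... | yes n<  = u , u₀≤u , gu≤n , n<
  ... | no  n≮  with fuel
  ... | zero     = contradiction (ℕₚ.≤-trans (grows (suc u)) (ℕₚ.≤-trans (ℕₚ.≮⇒≥ n≮) n≤)) ℕₚ.1+n≰n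
  ... | suc fuel = go fuel (suc u) (ℕₚ.m≤n⇒m≤1+n u₀≤u) (subst (n ≤_) (sym (ℕₚ.+-suc fuel u)) n≤) (ℕₚ.≮⇒≥ n≮)

m≤m^n : ∀ m n → 0 < n → m ≤ m ^ n
m≤m^n zero      n       _ = z≤n
m≤m^n m@(suc _) (suc n) _ = ℕₚ.m≤m*n m (m ^ n) {{ℕₚ.m^n≢0 m n}}

^-distribʳ-* : ∀ m n o → (m * n) ^ o ≡ m ^ o * n ^ o
^-distribʳ-* m n zero    = refl
^-distribʳ-* m n (suc o) = trans (cong (m * n *_) (^-distribʳ-* m n o)) (lemma m n (m ^ o) (n ^ o))
  where
  lemma : ∀ m n x y → m * n * (x * y) ≡ m * x * (n * y)
  lemma = solve-∀

edgeCount-upper-power : ∀ k → 0 < k → 0 < n → (G : OrderedGraph n) → ¬ HasShortBordered k G →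
  edgeCount G ^ k ≤ (4 * k) ^ k * n ^ (k + 1)
edgeCount-upper-power {n} k 0<k 0<n G none
  with bracket (_^ k) n 0 (λ u → m≤m^n u k 0<k) (subst (_≤ n) (sym (0^k 0<k)) z≤n)
  where
  0^k : ∀ {k} → 0 < k → 0 ^ k ≡ 0
  0^k (s≤s _) = refl
... | zero  , _ , _    , n<1  = contradiction (subst (n <_) (ℕₚ.^-zeroˡ k) n<1) (ℕₚ.≤⇒≯ 0<n)
-- `suc c` is the integer part of the `k`-th root of `n`. The degree `d = 2 + c` is at most twice
-- that, which turns the factor `2 * k` into `4 * k`.
... | suc c , _ , cᵏ≤n , n<dᵏ = begin
  edgeCount G ^ k                        ≤⟨ ℕₚ.^-monoˡ-≤ k (edgeCount-upper k (suc (suc c)) G n<dᵏ none) ⟩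
  (k * (n * (2 + c) + n * (2 + c))) ^ k  ≤⟨ ℕₚ.^-monoˡ-≤ k (ℕₚ.≤-trans (ℕₚ.m≤m+n _ (2 * (k * n * c))) (ℕₚ.≤-reflexive (lemma k n c))) ⟩
  ((4 * k) * (n * suc c)) ^ k            ≡⟨ ^-distribʳ-* (4 * k) (n * suc c) k ⟩
  (4 * k) ^ k * (n * suc c) ^ k          ≡⟨ cong ((4 * k) ^ k *_) (^-distribʳ-* n (suc c) k) ⟩
  (4 * k) ^ k * (n ^ k * suc c ^ k)      ≤⟨ ℕₚ.*-monoʳ-≤ ((4 * k) ^ k) (ℕₚ.*-monoʳ-≤ (n ^ k) cᵏ≤n) ⟩
  (4 * k) ^ k * (n ^ k * n)              ≡⟨ cong (λ x → (4 * k) ^ k * (n ^ k * x)) (ℕₚ.^-identityʳ n) ⟨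
  (4 * k) ^ k * (n ^ k * n ^ 1)          ≡⟨ cong ((4 * k) ^ k *_) (ℕₚ.^-distribˡ-+-* n k 1) ⟨
  (4 * k) ^ k * n ^ (k + 1)              ∎
  where
  open ℕₚ.≤-Reasoning
  lemma : ∀ k n c → k * (n * (2 + c) + n * (2 + c)) + 2 * (k * n * c) ≡ (4 * k) * (n * suc c)
  lemma = solve-∀

ex-upper-bound : ∀ k n → 0 < k → 0 < n → ex k n ^ k ≤ (4 * k) ^ k * n ^ (k + 1)
ex-upper-bound k n 0<k 0<n = let (G , none , eq) = extremal-graph k n in
  subst (λ e → e ^ k ≤ (4 * k) ^ k * n ^ (k + 1)) eq (edgeCount-upper-power k 0<k 0<n G none)

-- The value that `base ^ k` would have at the upper end of the `u`-th prime window; it bounds the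
-- differences for every prime of that window.
scale : ℕ → ℕ → ℕ
scale k u = suc (k * 2 ^ (2 * u + 4)) ^ k

-- `prime-in-window` asks for 9, and the maximum with `k` makes the prime exceed `k`. The factor 2
-- leaves at least half of the vertices as starting points of edges.
threshold : ℕ → ℕ
threshold k = 2 * scale k (9 ℕ.⊔ k)

n<2^n : ∀ n → n < 2 ^ n
n<2^n zero    = s≤s z≤n
n<2^n (suc n) = ℕₚ.+-mono-≤ (ℕₚ.m^n>0 2 n) (ℕₚ.≤-trans (n<2^n n) (ℕₚ.m≤m+n (2 ^ n) 0))

scale-grows : ∀ k → 0 < k → ∀ u → u ≤ 2 * scale k u
scale-grows k 0<k u = begin
  u                              ≤⟨ ℕₚ.<⇒≤ (n<2^n u) ⟩
  2 ^ u                          ≤⟨ ℕₚ.^-monoʳ-≤ 2 (ℕₚ.≤-trans (ℕₚ.m≤m+n u (u + 0)) (ℕₚ.m≤m+n (2 * u) 4)) ⟩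
  2 ^ (2 * u + 4)                ≤⟨ ℕₚ.m≤n*m (2 ^ (2 * u + 4)) k {{ℕ.>-nonZero 0<k}} ⟩
  k * 2 ^ (2 * u + 4)            ≤⟨ ℕₚ.n≤1+n _ ⟩
  suc (k * 2 ^ (2 * u + 4))      ≤⟨ m≤m^n _ k 0<k ⟩
  scale k u                      ≤⟨ ℕₚ.m≤m+n _ _ ⟩
  2 * scale k u                  ∎
  where open ℕₚ.≤-Reasoning

-- The next window ends at `32 * 2 ^ (2 * u + 1)`, which is below `32 * p`, so its base is at most
-- `33 * k * p` and `n` at most `(66 * k * p) ^ k`. At least half of `n` serves as starts and
-- `p - 1` is at least half of `p`, which costs a factor 4 and gives 264 = 4 * 66.
ex-lower-bound : ∀ k n → 0 < k → threshold k ≤ n → n ^ (k + 1) ≤ (264 * k * ex k n) ^ k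
ex-lower-bound k n 0<k n₀≤n
  with bracket (λ u → 2 * scale k u) n (9 ℕ.⊔ k) (scale-grows k 0<k) n₀≤n
... | u , u₀≤u , 2h≤n , n<
  with prime-in-window u (ℕₚ.≤-trans (ℕₚ.m≤m⊔n 9 k) u₀≤u)
... | p , p-prime , <p , p≤ = begin
  n ^ (k + 1)                    ≡⟨ trans (ℕₚ.^-distribˡ-+-* n k 1) (cong (n ^ k *_) (ℕₚ.^-identityʳ n)) ⟩
  n ^ k * n                      ≤⟨ ℕₚ.*-monoʳ-≤ (n ^ k) n≤ ⟩
  n ^ k * (66 * k * p) ^ k       ≡⟨ ^-distribʳ-* n (66 * k * p) k ⟨
  (n * (66 * k * p)) ^ k         ≤⟨ ℕₚ.^-monoˡ-≤ k n*66kp≤ ⟩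
  (264 * k * ex k n) ^ k         ∎
  where
  open ℕₚ.≤-Reasoning
  h M : ℕ
  h = scale k u
  M = n ∸ h

  k<p : k < p
  k<p = begin-strict
    k               ≤⟨ ℕₚ.≤-trans (ℕₚ.m≤n⊔m 9 k) u₀≤u ⟩
    u               <⟨ n<2^n u ⟩
    2 ^ u           ≤⟨ ℕₚ.^-monoʳ-≤ 2 (ℕₚ.≤-trans (ℕₚ.m≤m+n u (u + 0)) (ℕₚ.m≤m+n (2 * u) 1)) ⟩
    2 ^ (2 * u + 1) <⟨ <p ⟩
    p               ∎

  open LowerGraph n p k p-prime 0<k k<p
  open MomentCurve p k p-prime 0<k k<p using (base)

  M+h≡n : M + h ≡ n
  M+h≡n = ℕₚ.m∸n+n≡m (ℕₚ.≤-trans (ℕₚ.m≤m+n h (h + 0)) 2h≤n)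

  h≤M : h ≤ M
  h≤M = ℕₚ.+-cancelʳ-≤ h h M (subst₂ _≤_ (cong (h +_) (ℕₚ.+-identityʳ h)) (sym M+h≡n) 2h≤n)

  n≤2M : n ≤ M + M
  n≤2M = subst (_≤ M + M) M+h≡n (ℕₚ.+-monoʳ-≤ M h≤M)

  many-edges : M * ℕ.pred p ≤ ex k n
  many-edges = ℕₚ.≤-trans
    (graph-edgeCount M (subst (M + base ^ k ≤_) M+h≡n
      (ℕₚ.+-monoʳ-≤ M (ℕₚ.^-monoˡ-≤ k (s≤s (ℕₚ.*-monoʳ-≤ k p≤))))))
    (ex-upper k n graph graph-avoids)

  np≤4ex : n * p ≤ 4 * ex k n
  np≤4ex = begin
    n * p                              ≤⟨ ℕₚ.*-mono-≤ n≤2M (p≤2pred (prime>1 p-prime)) ⟩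
    (M + M) * (ℕ.pred p + ℕ.pred p)    ≡⟨ lemma M (ℕ.pred p) ⟩
    4 * (M * ℕ.pred p)                 ≤⟨ ℕₚ.*-monoʳ-≤ 4 many-edges ⟩
    4 * ex k n                         ∎
    where
    p≤2pred : ∀ {p} → 1 < p → p ≤ ℕ.pred p + ℕ.pred p
    p≤2pred (s≤s 0<q) = ℕₚ.+-monoˡ-≤ _ 0<q
    lemma : ∀ M q → (M + M) * (q + q) ≡ 4 * (M * q)
    lemma = solve-∀

  n*66kp≤ : n * (66 * k * p) ≤ 264 * k * ex k n
  n*66kp≤ = begin
    n * (66 * k * p)        ≡⟨ lemma₁ n k p ⟩
    66 * k * (n * p)        ≤⟨ ℕₚ.*-monoʳ-≤ (66 * k) np≤4ex ⟩
    66 * k * (4 * ex k n)   ≡⟨ lemma₂ k (ex k n) ⟩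
    264 * k * ex k n        ∎
    where
    lemma₁ : ∀ n k p → n * (66 * k * p) ≡ 66 * k * (n * p)
    lemma₁ = solve-∀
    lemma₂ : ∀ k e → 66 * k * (4 * e) ≡ 264 * k * e
    lemma₂ = solve-∀

  next-scale : suc (k * 2 ^ (2 * suc u + 4)) ≤ 33 * k * p
  next-scale = begin
    suc (k * 2 ^ (2 * suc u + 4))      ≡⟨ cong (λ x → suc (k * 2 ^ x)) (exponent u) ⟩
    suc (k * 2 ^ (5 + (2 * u + 1)))    ≡⟨ cong (λ x → suc (k * x)) (ℕₚ.^-distribˡ-+-* 2 5 (2 * u + 1)) ⟩
    suc (k * (32 * 2 ^ (2 * u + 1)))   ≤⟨ s≤s (ℕₚ.*-monoʳ-≤ k (ℕₚ.*-monoʳ-≤ 32 (ℕₚ.<⇒≤ <p))) ⟩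
    suc (k * (32 * p))                 ≤⟨ ℕₚ.+-monoˡ-≤ (k * (32 * p)) (ℕₚ.*-mono-≤ 0<k (ℕₚ.≤-trans (s≤s z≤n) k<p)) ⟩
    k * p + k * (32 * p)               ≡⟨ lemma k p ⟩
    33 * k * p                         ∎
    where
    exponent : ∀ u → 2 * suc u + 4 ≡ 5 + (2 * u + 1)
    exponent = solve-∀
    lemma : ∀ k p → k * p + k * (32 * p) ≡ 33 * k * p
    lemma = solve-∀

  n≤ : n ≤ (66 * k * p) ^ k
  n≤ = begin
    n                             ≤⟨ ℕₚ.<⇒≤ n< ⟩
    2 * scale k (suc u)           ≤⟨ ℕₚ.*-mono-≤ (m≤m^n 2 k 0<k) (ℕₚ.^-monoˡ-≤ k next-scale) ⟩
    2 ^ k * (33 * k * p) ^ k      ≡⟨ ^-distribʳ-* 2 (33 * k * p) k ⟨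
    (2 * (33 * k * p)) ^ k        ≡⟨ cong (_^ k) (lemma k p) ⟩
    (66 * k * p) ^ k              ∎
    where
    lemma : ∀ k p → 2 * (33 * k * p) ≡ 66 * k * p
    lemma = solve-∀

theorem2 : ∀ (k : ℕ) → 1 < k →
    Σ[ ex ∈ (ℕ → ℕ) ] (∀ n → IsEx n (𝓒ᴮ-upTo k) (ex n)) × IsΘ-power ex (k + 1) k
theorem2 k 1<k = ex k , isEx k ,
  264 * k , 4 * k , threshold k , positive 264 , positive 4 ,
  λ n n₀≤n → ex-lower-bound k n 0<k n₀≤n , ex-upper-bound k n 0<k (ℕₚ.≤-trans threshold>0 n₀≤n)
  where
  0<k : 0 < k
  0<k = ℕₚ.<⇒≤ 1<k
  positive : ∀ c {{_ : NonZero c}} → 0 < c * k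
  positive c = ℕₚ.≤-trans 0<k (ℕₚ.m≤n*m k c)
  threshold>0 : 0 < threshold k
  threshold>0 = ℕₚ.≤-trans (ℕₚ.m^n>0 (suc (k * 2 ^ (2 * (9 ℕ.⊔ k) + 4))) k) (ℕₚ.m≤m+n _ _)
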